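{- Let $G=(V,E)$ be a finite simple bipartite graph with maximum degree $\Delta$, let $k\ge\Delta$, and let $C_1$ and $C_2$ be two edge $k$-colorings of $G$. Then $C_1$ can be transformed into $C_2$ in at most $6|E|$ steps in the Markov chain $M(G,k)$ (that is, via a sequence of at most $6|E|$ transitions of $M(G,k)$, each having positive probability).
   Context: **Colorings.** An edge $k$-coloring of $G=(V,E)$ is a map $C:E\to\{c_1,\dots,c_k\}$ such that no two adjacent edges have the same color. For a map $C:E\to\{c_1,\dots,c_k\}$, a vertex $v$ has a $(+c-c')$-deficiency (and is called deficient) if exactly two $c$-colored edges are incident to $v$, all other edges incident to $v$ have different colors, and no $c'$-colored edge is incident to $v$. An almost edge $k$-coloring is a map $C:E\to\{c_1,\dots,c_k\}$ such that at most two vertices have deficiency and all other vertices have no two incident edges of the same color. Flipping the colors along an alternating path, walk or cycle with colors $a,b$ means interchanging $a$ and $b$ on its edges. Eliminating a $(+a-b)$-deficiency at a vertex $v$ means: select uniformly one of the two $a$-edges at $v$ and flip the colors along the appropriate maximal alternating path (walk) with colors $a,b$ starting at $v$ with the selected edge. **The Markov chain $M(G,k)$.** $G$ is bipartite and $k\ge\Delta$. The states are the edge $k$-colorings of $G$. From the current coloring $C$, a random edge $k$-coloring is drawn as follows. (1) With probability $\frac12$, do nothing. (2) With probability $\frac14$, select two colors $c,c'$ uniformly among the $\binom{k}{2}$ unordered pairs. Let $H$ be the subgraph of $G$ formed by the edges of colors $c$ and $c'$; its non-trivial components are paths and cycles. Select one of the following: (a) with probability $\frac13$, do nothing; (b)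 with probability $\frac13$, uniformly select a sub-path or a cycle of $H$ from all sub-paths and cycles in $H$; (c) with probability $\frac13$, uniformly select two sub-paths of $H$ from all possible pairs of sub-paths such that both of them have exactly one end vertex which is also an end vertex in $H$. Flip the colors in the selected sub-paths (or cycle). If there is any deficient vertex, select one of them uniformly, then select uniformly one of the edges with the same color incident to the selected vertex and change its color from $c$ to $c'$ or from $c'$ to $c$. Otherwise, with probability $\frac12$ select an edge uniformly from all edges of color $c$ or $c'$ and change its color to the opposite ($c'$ or $c$), and with probability $\frac12$ do nothing. Finally eliminate all deficiencies by flipping the colors on appropriate alternating paths, selecting uniformly from the two edges with the same color incident to a deficient vertex. (3) With probability $\frac14$, select three colors uniformly from all $\binom{k}{3}$ unordered triples, and select uniformly one of the three as distinguished. Let $c''$ be the distinguished color and $c,c'$ the other two. Let $H$ be the subgraph consisting of the edges of colors $c$ and $c'$; its non-trivial components are paths and cycles. Select one of the following: (a) with probability $\frac13$, do nothing; (b) with probability $\frac13$, uniformly select a sub-path of $H$ from all sub-paths such that at least one of its end vertices is not an end vertex in $H$; (c) with probability $\frac13$, uniformly select two sub-paths of $H$ from all possible pairs of sub-paths such that both of them have exactly one end vertex which is also an end vertex in $H$. Flip the colors in the selected sub-paths. If there are two deficient vertices, select one of them uniformly. If there is only one deficient vertex, then with probability $\frac12$ select it, and with probability $\frac12$ select uniformly a non-deficient vertex among those incident to both a $c''$-edge and at least one of a $c$- or a $c'$-edge. If there is no deficient vertex, select uniformly a non-deficient vertex among those incident to both a $c''$-edge and at least one of a $c$- or a $c'$-edge.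 - If a deficient vertex is selected, select uniformly one of the edges with the same color incident to it, and let this color be $\tilde c$. Consider the maximal alternating path or cycle with colors $\tilde c$ and $c''$ containing the selected edge, and flip the colors in it. - If a non-deficient vertex is selected, let $e$ be its incident edge of color $c''$ and $f$ its incident edge of color $c$ or $c'$ (if it has incident edges of both colors, one of them is selected uniformly), and let $\tilde c$ be the color of $f$. Take the maximal alternating path with colors $c''$ and $\tilde c$ that contains $e$ but does not contain $f$, and flip the colors in it. Finally eliminate all deficiencies by flipping the colors on appropriate alternating paths, selecting uniformly from the two edges with the same color incident to a deficient vertex. -}

module Defs where

open import Data.Bool.Base using (Bool)
open import Data.Fin.Base using (Fin) renaming (_<_ to _<ᶠ_)
open import Data.Fin.Properties using (any?; all?) renaming (_≟_ to _≟ᶠ_; _<?_ to _<ᶠ?_)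
open import Data.Integer.Base using (+_)
open import Data.List.Base
  using (List; []; _∷_; [_]; _++_; map; concatMap; filter; foldr; length; allFin; cartesianProduct)
open import Data.List.Membership.DecPropositional using (_∈?_)
open import Data.List.Relation.Unary.All using (All) renaming (all? to allList?)
open import Data.Nat.Base using (ℕ; zero; suc; _≤_; _⊔_)
open import Data.Nat.Properties using () renaming (_≟_ to _≟ⁿ_; _≤?_ to _≤ⁿ?_)
open import Data.Product.Base using (Σ; ∃; _×_; _,_; proj₁; proj₂; Σ-syntax)
open import Data.Rational.Base using (ℚ; 0ℚ; 1ℚ; _+_; _*_; _/_; _<_)
open import Data.Sum.Base using (_⊎_)
open import Data.Vec.Base using (Vec; lookup; tabulate)
open import Data.Vec.Properties using (≡-dec)
open import Function.Base using (_∘_)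
open import Level using (0ℓ)
open import Relation.Binary.PropositionalEquality using (_≡_; _≢_)
open import Relation.Nullary.Decidable using (Dec; yes; no; ¬?; _×-dec_; _⊎-dec_; _→-dec_)
open import Relation.Unary using (Pred; Decidable)

-- A finite distribution as a list of weighted outcomes, the probability of an
-- outcome being the sum of the weights at all its occurrences.  A mixture of
-- distributions is the concatenation of their scaled lists.
Dist : Set → Set
Dist A = List (ℚ × A)

infixl 1 _>>=_

return : {A : Set} → A → Dist A
return x = [ (1ℚ , x) ]

scale : {A : Set} → ℚ → Dist A → Dist A
scale p = map (λ (q , x) → (p * q , x))

_>>=_ : {A B : Set} → Dist A → (A → Dist B) → Dist B
d >>= f = concatMap (λ (p , x) → scale p (f x)) d

uniform : {A : Set} → A → List A → Dist A
uniform x xs = map (λ y → (+ 1 / suc (length xs) , y)) (x ∷ xs)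

-- The third argument is what happens when there is nothing to select from.
select : {A B : Set} → List A → (A → Dist B) → Dist B → Dist B
select []       f none = none
select (x ∷ xs) f none = uniform x xs >>= f

half third quarter : ℚ
half    = + 1 / 2
third   = + 1 / 3
quarter = + 1 / 4

Pr : {A : Set} {P : Pred A 0ℓ} → Dist A → Decidable P → ℚ
Pr d P? = foldr _+_ 0ℚ (map proj₁ (filter (P? ∘ proj₂) d))

-- Unordered selections without repetition, each listed once.
pairs : {A : Set} → List A → List (A × A)
pairs []       = []
pairs (x ∷ xs) = map (x ,_) xs ++ pairs xs

triples : {A : Set} → List A → List (A × A × A)
triples []       = []
triples (x ∷ xs) = map (x ,_) (pairs xs) ++ triples xs

record Graph : Set where
  field
    order : ℕ
    size  : ℕ

  Vertex = Fin order
  Edge   = Fin size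

  field
    ends : Edge → Vertex × Vertex

  Joins : Edge → Vertex → Vertex → Set
  Joins e u v = (ends e ≡ (u , v)) ⊎ (ends e ≡ (v , u))

  field
    loopless : ∀ e u → ends e ≢ (u , u)
    simple   : ∀ e f u v → Joins e u v → Joins f u v → e ≡ f

module _ (G : Graph) where
  open Graph G

  Bipartite : Set
  Bipartite = Σ[ side ∈ (Vertex → Bool) ]
    (∀ e → side (proj₁ (ends e)) ≢ side (proj₂ (ends e)))

  Incident : Vertex → Edge → Set
  Incident v e = (proj₁ (ends e) ≡ v) ⊎ (proj₂ (ends e) ≡ v)

  incident? : ∀ v → Decidable (Incident v)
  incident? v e = (proj₁ (ends e) ≟ᶠ v) ⊎-dec (proj₂ (ends e) ≟ᶠ v)

  edges : List Edge
  edges = allFin size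

  vertices : List Vertex
  vertices = allFin order

  edgesAt : Vertex → List Edge
  edgesAt v = filter (incident? v) edges

  degree : Vertex → ℕ
  degree v = length (edgesAt v)

  maxDegree : ℕ
  maxDegree = foldr _⊔_ 0 (map degree vertices)

  -- Only meaningful when the given vertex is an end of the given edge.
  otherEnd : Edge → Vertex → Vertex
  otherEnd e v with proj₁ (ends e) ≟ᶠ v
  ... | yes _ = proj₂ (ends e)
  ... | no  _ = proj₁ (ends e)

  module _ (k : ℕ) where

    Color : Set
    Color = Fin k

    Coloring : Set
    Coloring = Vec Color size

    _≟ᶜ_ : (C D : Coloring) → Dec (C ≡ D)
    _≟ᶜ_ = ≡-dec _≟ᶠ_

    Proper : Coloring → Set
    Proper C = ∀ v e f → Incident v e → Incident v f → e ≢ f → lookup C e ≢ lookup C f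

    EdgeColoring : Set
    EdgeColoring = Σ Coloring Proper

    coloredAt : Coloring → Vertex → Color → List Edge
    coloredAt C v c = filter (λ e → lookup C e ≟ᶠ c) (edgesAt v)

    -- C has a (+c-c′)-deficiency at v.
    HasDeficiency : Coloring → Vertex → Color × Color → Set
    HasDeficiency C v (c , c′) =
        length (coloredAt C v c) ≡ 2
      × (∀ d → d ≢ c → length (coloredAt C v d) ≤ 1)
      × length (coloredAt C v c′) ≡ 0

    hasDeficiency? : ∀ C v → Decidable (HasDeficiency C v)
    hasDeficiency? C v (c , c′) =
      (length (coloredAt C v c) ≟ⁿ 2)
        ×-dec all? (λ d → ¬? (d ≟ᶠ c) →-dec (length (coloredAt C v d) ≤ⁿ? 1))
        ×-dec (length (coloredAt C v c′) ≟ⁿ 0)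

    Deficient : Coloring → Vertex → Set
    Deficient C v = ∃ λ c → ∃ λ c′ → HasDeficiency C v (c , c′)

    deficient? : ∀ C → Decidable (Deficient C)
    deficient? C v = any? λ c → any? λ c′ → hasDeficiency? C v (c , c′)

    deficientVertices : Coloring → List Vertex
    deficientVertices C = filter (deficient? C) vertices

    repeatedAt : Coloring → Vertex → List Edge
    repeatedAt C v =
      filter (λ e → 2 ≤ⁿ? length (coloredAt C v (lookup C e))) (edgesAt v)

    swap : Color → Color → Color → Color
    swap a b x with x ≟ᶠ a | x ≟ᶠ b
    ... | yes _ | _     = b
    ... | no  _ | yes _ = a
    ... | no  _ | no  _ = x

    flip : Color → Color → List Edge → Coloring → Coloring
    flip a b es C = tabulate color
      where
      color : Edge → Color
      color e with _∈?_ _≟ᶠ_ e es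
      ... | yes _ = swap a b (lookup C e)
      ... | no  _ = lookup C e

  module _ (H : List Edge) where

    -- The paths from u avoiding the vertices in `visited` (u is taken to be
    -- one of these), as edge list and final vertex.  The trivial path is
    -- included; the first argument bounds the number of edges.
    pathsFrom : ℕ → List Vertex → Vertex → List (List Edge × Vertex)
    pathsFrom zero    visited u = [ ([] , u) ]
    pathsFrom (suc n) visited u = ([] , u) ∷ concatMap continue next
      where
      next : List Edge
      next = filter (λ e → ¬? (_∈?_ _≟ᶠ_ (otherEnd e u) visited))
                    (filter (incident? u) H)

      continue : Edge → List (List Edge × Vertex)
      continue e = map (λ (es , t) → (e ∷ es , t))
        (pathsFrom n (otherEnd e u ∷ visited) (otherEnd e u))

    SubPath : Set
    SubPath = Vertex × List Edge × Vertex

    pathEdges : SubPath → List Edge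
    pathEdges (_ , es , _) = es

    -- A path is unoriented, hence is listed only from its smaller to its
    -- larger end vertex; this also discards the trivial paths.
    subPaths : List SubPath
    subPaths = filter (λ (u , _ , t) → u <ᶠ? t)
      (concatMap (λ u → map (u ,_) (pathsFrom order [ u ] u)) vertices)

    -- A cycle is listed once, as its smallest edge together with the
    -- path that remains when this edge is removed.
    cycles : List (List Edge)
    cycles = map (λ ((_ , es , _) , e) → e ∷ es)
      (filter closes? (cartesianProduct subPaths H))
      where
      closes? : Decidable {A = SubPath × Edge} λ ((u , es , t) , e) →
                  (Incident u e × Incident t e) × All (e <ᶠ_) es
      closes? ((u , es , t) , e) =
        (incident? u e ×-dec incident? t e) ×-dec allList? (e <ᶠ?_) es

    EndVertex : Vertex → Set
    EndVertex v = length (filter (incident? v) H) ≡ 1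

    endVertex? : Decidable EndVertex
    endVertex? v = length (filter (incident? v) H) ≟ⁿ 1

    subPathsWithInnerEnd : List SubPath
    subPathsWithInnerEnd =
      filter (λ (u , _ , t) → ¬? (endVertex? u) ⊎-dec ¬? (endVertex? t)) subPaths

    subPathsWithOneInnerEnd : List SubPath
    subPathsWithOneInnerEnd =
      filter (λ (u , _ , t) → (endVertex? u ×-dec ¬? (endVertex? t))
                                ⊎-dec (¬? (endVertex? u) ×-dec endVertex? t)) subPaths

  module _ (k : ℕ) where

    private
      K   = Color k
      Col = Coloring k

    colored₂ : Col → K → K → List Edge
    colored₂ C c c′ =
      filter (λ e → (lookup C e ≟ᶠ c) ⊎-dec (lookup C e ≟ᶠ c′)) edges

    available : Col → List Edge → Vertex → K → List Edge
    available C used w p =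
      filter (λ e → ¬? (_∈?_ _≟ᶠ_ e used)) (coloredAt k C w p)

    -- Starting at w, with the next edge to have color p and the one after it
    -- color q, follow unused edges until the walk cannot be continued or is
    -- back at v.  There is more than one continuation only at a vertex that
    -- has a deficiency; then one of its two edges is selected uniformly.  The
    -- first argument is only a bound on the length.
    continueWalk : ℕ → Col → Vertex → List Edge → Vertex → K → K → Dist (List Edge)
    continueWalk zero    C v used w p q = return []
    continueWalk (suc n) C v used w p q with w ≟ᶠ v
    ... | yes _ = return []
    ... | no  _ = select (available C used w p)
      (λ e → continueWalk n C v (e ∷ used) (otherEnd e w) q p >>= λ es →
             return (e ∷ es))
      (return [])

    -- The maximal alternating walk with colors a, b which starts at v with its
    -- edge e of color a and avoids the given edges.
    walk : Col → Vertex → Edge → List Edge → K → K → Dist (List Edge)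
    walk C v e avoid a b =
      continueWalk size C v (e ∷ avoid) (otherEnd e v) b a >>= λ es →
      return (e ∷ es)

    -- The maximal alternating path or cycle with colors a, b containing the
    -- edge e of color a at v: first away from v along e, and then, unless this
    -- has closed a cycle, in the other direction from v.
    walkThrough : Col → Vertex → Edge → K → K → Dist (List Edge)
    walkThrough C v e a b =
      walk C v e [] a b >>= λ es →
      select (available C es v b)
        (λ f → walk C v f es b a >>= λ fs → return (es ++ fs))
        (return es)

    -- Eliminate an (+a-b)-deficiency at v.
    eliminate : Col → Vertex → K × K → Dist Col
    eliminate C v (a , b) =
      select (coloredAt k C v a)
        (λ e → walk C v e [] a b >>= λ es → return (flip k a b es C))
        (return C)

    -- Eliminate deficiencies, using only the colors in cs, until none is left.
    -- Every round removes one, so the bound in the first argument is not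
    -- reached if it is the number of vertices.
    eliminateUpTo : ℕ → List K → Col → Dist Col
    eliminateUpTo zero    cs C = return C
    eliminateUpTo (suc n) cs C =
      select (deficientVertices k C)
        (λ v → select (filter (hasDeficiency? k C v) (cartesianProduct cs cs))
          (λ ab → eliminate C v ab >>= eliminateUpTo n cs)
          (return C))
        (return C)

    eliminateAll : List K → Col → Dist Col
    eliminateAll = eliminateUpTo order

    -- The flips are done one after the other, so an edge common to both
    -- sub-paths keeps its color.
    flipTwo : K → K → Col → Dist Col
    flipTwo c c′ C =
      select (pairs (subPathsWithOneInnerEnd H))
        (λ (P , Q) → return (flip k c c′ (pathEdges H Q) (flip k c c′ (pathEdges H P) C)))
        (return C)
      where
      H : List Edge
      H = colored₂ C c c′

    module TwoColors (c c′ : K) where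

      flipInitial : Col → Dist Col
      flipInitial C =
           scale third (return C)
        ++ scale third (select (map (pathEdges H) (subPaths H) ++ cycles H)
                               (λ es → return (flip k c c′ es C))
                               (return C))
        ++ scale third (flipTwo c c′ C)
        where
        H : List Edge
        H = colored₂ C c c′

      changeEdge : Col → Edge → Dist Col
      changeEdge C e = return (flip k c c′ [ e ] C)

      perturb : Col → Dist Col
      perturb C =
        select (deficientVertices k C)
          (λ v → select (repeatedAt k C v) (changeEdge C) (return C))
          (   scale half (select (colored₂ C c c′) (changeEdge C) (return C))
           ++ scale half (return C))

      move : Col → Dist Col
      move C = flipInitial C >>= perturb >>= eliminateAll (c ∷ c′ ∷ [])

    -- c″ is the distinguished color.
    module ThreeColors (c″ c c′ : K) where

      flipInitial : Col → Dist Col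
      flipInitial C =
           scale third (return C)
        ++ scale third (select (subPathsWithInnerEnd H)
                               (λ P → return (flip k c c′ (pathEdges H P) C))
                               (return C))
        ++ scale third (flipTwo c c′ C)
        where
        H : List Edge
        H = colored₂ C c c′

      otherEdges : Col → Vertex → List Edge
      otherEdges C v = coloredAt k C v c ++ coloredAt k C v c′

      perturbDeficient : Col → Vertex → Dist Col
      perturbDeficient C v =
        select (repeatedAt k C v)
          (λ e → walkThrough C v e (lookup C e) c″ >>= λ es →
                 return (flip k (lookup C e) c″ es C))
          (return C)

      candidates : Col → List Vertex
      candidates C = filter
        (λ v → ¬? (deficient? k C v)
                 ×-dec (1 ≤ⁿ? length (coloredAt k C v c″))
                 ×-dec (1 ≤ⁿ? length (otherEdges C v)))
        vertices

      perturbNonDeficient : Col → Dist Col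
      perturbNonDeficient C =
        select (candidates C)
          (λ v → select (coloredAt k C v c″)
            (λ e → select (otherEdges C v)
              (λ f → walk C v e [ f ] c″ (lookup C f) >>= λ es →
                     return (flip k c″ (lookup C f) es C))
              (return C))
            (return C))
          (return C)

      perturb : Col → Dist Col
      perturb C with deficientVertices k C
      ... | []         = perturbNonDeficient C
      ... | v ∷ []     = scale half (perturbDeficient C v) ++ scale half (perturbNonDeficient C)
      ... | v ∷ w ∷ vs = uniform v (w ∷ vs) >>= perturbDeficient C

      move : Col → Dist Col
      move C = flipInitial C >>= perturb >>= eliminateAll (c ∷ c′ ∷ c″ ∷ [])

    colors : List K
    colors = allFin k

    -- M(G,k): the distribution of the next state.  If k < 2 (or k < 3) there
    -- is no pair (or triple) of colors to select, and the state is kept.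
    M : Col → Dist Col
    M C =
         scale half (return C)
      ++ scale quarter (select (pairs colors)
                               (λ (c , c′) → TwoColors.move c c′ C)
                               (return C))
      ++ scale quarter (select (triples colors)
                               (λ (x , y , z) →
                                 uniform (x , y , z) ((y , x , z) ∷ (z , x , y) ∷ [])
                                   >>= λ (c″ , c , c′) → ThreeColors.move c″ c c′ C)
                               (return C))

    transitionProbability : EdgeColoring k → EdgeColoring k → ℚ
    transitionProbability (C , _) (D , _) = Pr (M C) (λ X → _≟ᶜ_ k X D)

    -- Transformation in exactly n steps, all of positive probability.  States
    -- are compared as maps, disregarding the proof of properness.
    data Reaches : ℕ → EdgeColoring k → EdgeColoring k → Set where
      done : ∀ {C D} → proj₁ C ≡ proj₁ D → Reaches 0 C D
      step : ∀ {n C D E} → 0ℚ < transitionProbability C D →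
             Reaches n D E → Reaches (suc n) C E

{-# OPTIONS --safe #-}

-- The colors are made final one after the other.  While some colors are
-- unfinished, one of them, c, is used at most as often in the current coloring
-- as in C₂; the components of the symmetric difference of the two classes of c
-- are then removed one by one, at a cost of at most three steps for each of its
-- (at most 2 |C₂⁻¹(c)|) edges.
--
-- A component is followed by almost colorings X with a (+a-c)-deficiency at a
-- vertex w (and, if the component is a cycle, a (+c-a)-deficiency at a fixed
-- vertex v), each of them represented by a proper coloring Y from which it
-- arises by flipping at most two alternating paths.  If the final edge e at w,
-- of color b say, is not one of the two edges of color a at w, a step with the
-- three colors a, b, c makes it one: the paths are flipped back, then an
-- (a,b)-path through w and e is flipped which leaves v untouched, and the
-- deficiencies are eliminated starting with e.  After that e has color c in Y,
-- and dropping e and the next edge from the path moves the deficiency along the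
-- component by two edges, without any further step.

module Submission where

open import Data.Bool.Base using (Bool; true; false; not; if_then_else_)
open import Data.Fin.Base using (Fin; zero; suc) renaming (_<_ to _<ᶠ_)
open import Data.Fin.Properties using (any?) renaming (_≟_ to _≟ᶠ_; _<?_ to _<ᶠ?_; <-cmp to <ᶠ-cmp)
open import Data.Integer.Base using (+_)
open import Data.List.Base
  using (List; []; _∷_; [_]; _++_; map; concatMap; filter; foldr; length; allFin; cartesianProduct)
open import Data.List.Membership.Propositional using (_∈_; _∉_; lose)
open import Data.List.Membership.Propositional.Properties
  using (∈-map⁺; ∈-map⁻; ∈-++⁺ˡ; ∈-++⁺ʳ; ∈-++⁻; ∈-filter⁺; ∈-filter⁻; ∈-allFin; ∈-cartesianProduct⁺; ∈-∃++; ∈-concatMap⁺)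
open import Data.List.Membership.DecPropositional using (_∈?_)
open import Data.List.Properties using (length-++; length-map; length-tabulate; ++-identityʳ)
open import Data.List.Relation.Unary.All as All using (All; []; _∷_)
open import Data.List.Relation.Unary.All.Properties using () renaming (++⁺ to All-++⁺; map⁺ to All-map⁺)
open import Data.List.Relation.Unary.AllPairs using ([]; _∷_)
open import Data.List.Relation.Unary.Any using (here; there)
open import Data.List.Relation.Unary.Unique.Propositional using (Unique)
open import Data.List.Relation.Unary.Unique.Propositional.Properties
  using (allFin⁺) renaming (filter⁺ to Unique-filter⁺; ++⁺ to Unique-++⁺)
open import Data.Maybe.Base using (Maybe; just; nothing)
open import Data.Nat.Base using (ℕ; zero; suc; _≤_; _<_; z≤n; s≤s; _+_; _*_)
open import Data.Nat.Properties as ℕₚ using (_≤?_)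
open import Data.Product.Base using (Σ; ∃; ∃₂; ∃-syntax; _×_; _,_; proj₁; proj₂)
open import Data.Rational.Base using (0ℚ; _/_; positive)
  renaming (_+_ to _+ʳ_; _*_ to _*ʳ_; _<_ to _<ʳ_; _≤_ to _≤ʳ_)
import Data.Rational.Properties as ℚₚ
open import Data.Sum.Base using (_⊎_; inj₁; inj₂)
open import Data.Unit.Base using (⊤; tt)
open import Data.Vec.Base using (lookup; tabulate)
open import Data.Vec.Properties using (lookup∘tabulate; tabulate∘lookup; tabulate-cong)
open import Function.Base using (_∘_; case_of_)
open import Level using (0ℓ)
open import Relation.Binary.Definitions using (tri<; tri≈; tri>)
open import Relation.Binary.PropositionalEquality
  using (_≡_; _≢_; refl; sym; trans; cong; subst; ≢-sym)
open import Relation.Nullary.Decidable using (Dec; yes; no; ¬?; _×-dec_; _⊎-dec_)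
open import Relation.Nullary.Negation using (¬_; contradiction)
open import Relation.Unary using (Pred; Decidable)
open import Defs

-- An almost coloring X occurs only inside a step, so it has to be recovered from the proper Y at
-- the start of the next one. Flipping back the paths between X and Y must therefore be a possible
-- initial choice: one sub-path with an inner end, or two different sub-paths with exactly one inner
-- end each. Hence the care for simple, disjoint paths that end at end vertices. Bipartiteness turns
-- two colors into an orientation in which a deficiency is a source or a sink; a trail from such a
-- source cannot come back, and so is a path. The delicate point is the deficiency at v. As v is on
-- the same side as w, color a is absent there, so v has no outgoing edge for the colors a, b, and
-- at most one of the two trails from w meets v. A component may also lead to a vertex without color
-- c in C₂. Counting the unfinished colors there yields another missing color, and one step with it
-- removes the deficiency; this is the 1 in the bounds 3φ + 1.

private
  variable
    A B : Set

-- Positive weights and supports of finite distributions.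

Positive : Dist A → Set
Positive = All λ (q , _) → 0ℚ <ʳ q

private
  *-pos : ∀ {p q} → 0ℚ <ʳ p → 0ℚ <ʳ q → 0ℚ <ʳ p *ʳ q
  *-pos {p} {q} 0<p 0<q = ℚₚ.positive⁻¹ (p *ʳ q) {{ℚₚ.pos*pos⇒pos p {{positive 0<p}} q {{positive 0<q}}}}

  1/suc-pos : ∀ n → 0ℚ <ʳ + 1 / suc n
  1/suc-pos n = ℚₚ.positive⁻¹ _ {{ℚₚ.normalize-pos 1 (suc n)}}

Positive-return : (x : A) → Positive (return x)
Positive-return x = 1/suc-pos 0 ∷ []

Positive-scale : ∀ {p} → 0ℚ <ʳ p → {d : Dist A} → Positive d → Positive (scale p d)
Positive-scale 0<p = All-map⁺ ∘ All.map (*-pos 0<p)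

Positive->>= : {d : Dist A} {f : A → Dist B} → Positive d → (∀ x → Positive (f x)) →
               Positive (d >>= f)
Positive->>= []         _  = []
Positive->>= (0<p ∷ ps) fs = All-++⁺ (Positive-scale 0<p (fs _)) (Positive->>= ps fs)

Positive-uniform : (x : A) (xs : List A) → Positive (uniform x xs)
Positive-uniform x xs = All-map⁺ (All.universal (λ _ → 1/suc-pos (length xs)) (x ∷ xs))

Positive-select : (xs : List A) {f : A → Dist B} {none : Dist B} →
                  (∀ x → Positive (f x)) → Positive none → Positive (select xs f none)
Positive-select []       _  none = none
Positive-select (x ∷ xs) fs _    = Positive->>= (Positive-uniform x xs) fs

Positive-mix : ∀ {p q r} → 0ℚ <ʳ p → 0ℚ <ʳ q → 0ℚ <ʳ r → {d e f : Dist A} →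
               Positive d → Positive e → Positive f →
               Positive (scale p d ++ scale q e ++ scale r f)
Positive-mix 0<p 0<q 0<r d e f =
  All-++⁺ (Positive-scale 0<p d) (All-++⁺ (Positive-scale 0<q e) (Positive-scale 0<r f))

infix 4 _∈ˢ_

-- As all weights in the chain are positive, occurring in the list already means positive
-- probability, and no weight has to be computed.
_∈ˢ_ : A → Dist A → Set
x ∈ˢ d = ∃ λ q → (q , x) ∈ d

∈ˢ-return : {x : A} → x ∈ˢ return x
∈ˢ-return = _ , here refl

∈ˢ-scale : ∀ {x : A} {d} p → x ∈ˢ d → x ∈ˢ scale p d
∈ˢ-scale p (_ , x∈d) = _ , ∈-map⁺ _ x∈d

∈ˢ-++ˡ : ∀ {x : A} {d e} → x ∈ˢ d → x ∈ˢ d ++ e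
∈ˢ-++ˡ (_ , x∈d) = _ , ∈-++⁺ˡ x∈d

∈ˢ-++ʳ : ∀ {x : A} d {e} → x ∈ˢ e → x ∈ˢ d ++ e
∈ˢ-++ʳ d (_ , x∈e) = _ , ∈-++⁺ʳ d x∈e

∈ˢ->>= : ∀ {x : A} {y : B} {d f} → x ∈ˢ d → y ∈ˢ f x → y ∈ˢ (d >>= f)
∈ˢ->>= (q , here refl)     y∈fx = ∈ˢ-++ˡ (∈ˢ-scale q y∈fx)
∈ˢ->>= {d = (p , z) ∷ _} {f} (q , there x∈d) y∈fx = ∈ˢ-++ʳ (scale p (f z)) (∈ˢ->>= (q , x∈d) y∈fx)

∈ˢ-uniform : ∀ {x y : A} {xs} → x ∈ y ∷ xs → x ∈ˢ uniform y xs
∈ˢ-uniform x∈ = _ , ∈-map⁺ _ x∈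

∈ˢ-select : ∀ {x : A} {y : B} {xs f none} → x ∈ xs → y ∈ˢ f x → y ∈ˢ select xs f none
∈ˢ-select {xs = _ ∷ _} x∈ y∈fx = ∈ˢ->>= (∈ˢ-uniform x∈) y∈fx

∈ˢ-select-none : ∀ {y : B} {xs : List A} {f none} → (∀ x → x ∉ xs) → y ∈ˢ none → y ∈ˢ select xs f none
∈ˢ-select-none {xs = []}     _     y∈ = y∈
∈ˢ-select-none {xs = x ∷ xs} empty y∈ = contradiction (here refl) (empty x)

Pr-pos : {P : Pred A 0ℓ} (P? : Decidable P) {d : Dist A} {x : A} → Positive d → x ∈ˢ d → P x →
         0ℚ <ʳ Pr d P?
Pr-pos P? d>0 (q , x∈d) Px = sum-pos (weights d>0) (∈-map⁺ proj₁ (∈-filter⁺ (P? ∘ proj₂) x∈d Px))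
  where
  weights : ∀ {d} → Positive d → All (0ℚ <ʳ_) (map proj₁ (filter (P? ∘ proj₂) d))
  weights {[]}          []         = []
  weights {(_ , y) ∷ _} (0<p ∷ ps) with P? y
  ... | yes _ = 0<p ∷ weights ps
  ... | no  _ = weights ps

  sum-nonneg : ∀ {qs} → All (0ℚ <ʳ_) qs → 0ℚ ≤ʳ foldr _+ʳ_ 0ℚ qs
  sum-nonneg []         = ℚₚ.≤-refl
  sum-nonneg (0<q ∷ qs) = ℚₚ.<⇒≤ (ℚₚ.+-mono-<-≤ 0<q (sum-nonneg qs))

  sum-pos : ∀ {q qs} → All (0ℚ <ʳ_) qs → q ∈ qs → 0ℚ <ʳ foldr _+ʳ_ 0ℚ qs
  sum-pos (0<q ∷ qs) _ = ℚₚ.+-mono-<-≤ 0<q (sum-nonneg qs)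

-- Unordered selections, and counting in duplicate-free lists.

module _ {A : Set} where

  ∈-pairs : ∀ {x y : A} {xs} → x ∈ xs → y ∈ xs → x ≢ y → (x , y) ∈ pairs xs ⊎ (y , x) ∈ pairs xs
  ∈-pairs (here refl) (here refl) x≢y = contradiction refl x≢y
  ∈-pairs (here refl) (there y∈)  _   = inj₁ (∈-++⁺ˡ (∈-map⁺ _ y∈))
  ∈-pairs (there x∈)  (here refl) _   = inj₂ (∈-++⁺ˡ (∈-map⁺ _ x∈))
  ∈-pairs {xs = z ∷ zs} (there x∈) (there y∈) x≢y with ∈-pairs x∈ y∈ x≢y
  ... | inj₁ xy∈ = inj₁ (∈-++⁺ʳ (map (z ,_) zs) xy∈)
  ... | inj₂ yx∈ = inj₂ (∈-++⁺ʳ (map (z ,_) zs) yx∈)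

  TripleOf : A → A → A → List A → Set
  TripleOf x y z xs = ∃ λ ((u , v , w) : A × A × A) → (u , v , w) ∈ triples xs ×
    ((x , y , z) ∈ (u , v , w) ∷ (v , u , w) ∷ (w , u , v) ∷ [])

  -- The distinguished element x is selected from the triple afterwards and may stand anywhere; only
  -- the order of y and z is dictated by their positions in xs.
  ∈-triples : ∀ {x y z : A} {xs} → x ∈ xs → y ∈ xs → z ∈ xs → x ≢ y → x ≢ z → y ≢ z →
              TripleOf x y z xs ⊎ TripleOf x z y xs
  ∈-triples (here refl) (here refl) _           x≢y _   _   = contradiction refl x≢y
  ∈-triples (here refl) _           (here refl) _   x≢z _   = contradiction refl x≢z
  ∈-triples _           (here refl) (here refl) _   _   y≢z = contradiction refl y≢z
  ∈-triples (here refl) (there y∈)  (there z∈)  _ _ y≢z with ∈-pairs y∈ z∈ y≢z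
  ... | inj₁ yz∈ = inj₁ (_ , ∈-++⁺ˡ (∈-map⁺ _ yz∈) , here refl)
  ... | inj₂ zy∈ = inj₂ (_ , ∈-++⁺ˡ (∈-map⁺ _ zy∈) , here refl)
  ∈-triples (there x∈) (here refl) (there z∈) _ x≢z _ with ∈-pairs x∈ z∈ x≢z
  ... | inj₁ xz∈ = inj₁ (_ , ∈-++⁺ˡ (∈-map⁺ _ xz∈) , there (here refl))
  ... | inj₂ zx∈ = inj₁ (_ , ∈-++⁺ˡ (∈-map⁺ _ zx∈) , there (there (here refl)))
  ∈-triples (there x∈) (there y∈) (here refl) x≢y _ _ with ∈-pairs x∈ y∈ x≢y
  ... | inj₁ xy∈ = inj₂ (_ , ∈-++⁺ˡ (∈-map⁺ _ xy∈) , there (here refl))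
  ... | inj₂ yx∈ = inj₂ (_ , ∈-++⁺ˡ (∈-map⁺ _ yx∈) , there (there (here refl)))
  ∈-triples {xs = u ∷ us} (there x∈) (there y∈) (there z∈) x≢y x≢z y≢z
    with ∈-triples x∈ y∈ z∈ x≢y x≢z y≢z
  ... | inj₁ (t , t∈ , p) = inj₁ (t , ∈-++⁺ʳ (map (u ,_) (pairs us)) t∈ , p)
  ... | inj₂ (t , t∈ , p) = inj₂ (t , ∈-++⁺ʳ (map (u ,_) (pairs us)) t∈ , p)

  Unique-length-≤ : ∀ {xs ys : List A} → Unique xs → (∀ {x} → x ∈ xs → x ∈ ys) → length xs ≤ length ys
  Unique-length-≤ [] _ = z≤n
  Unique-length-≤ {x ∷ xs} (x∉ ∷ xs!) xs⊆ys with ∈-∃++ (xs⊆ys (here refl))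
  ... | us , vs , refl =
    subst (suc (length xs) ≤_) (sym (trans (length-++ us) (ℕₚ.+-suc (length us) (length vs))))
      (s≤s (subst (length xs ≤_) (length-++ us) (Unique-length-≤ xs! xs⊆)))
    where
    xs⊆ : ∀ {y} → y ∈ xs → y ∈ us ++ vs
    xs⊆ y∈ with ∈-++⁻ us (xs⊆ys (there y∈))
    ... | inj₁ y∈us          = ∈-++⁺ˡ y∈us
    ... | inj₂ (here refl)   = contradiction refl (All.lookup x∉ y∈)
    ... | inj₂ (there y∈vs)  = ∈-++⁺ʳ us y∈vs

  length≡1 : ∀ {xs : List A} {x} → Unique xs → x ∈ xs → (∀ {y} → y ∈ xs → y ≡ x) → length xs ≡ 1
  length≡1 {_ ∷ []}    _ _ _ = refl
  length≡1 {_ ∷ _ ∷ _} ((y≢z ∷ _) ∷ _) _ only =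
    contradiction (trans (only (here refl)) (sym (only (there (here refl))))) y≢z

  length≡1⇒≡ : ∀ {xs : List A} {x y} → length xs ≡ 1 → x ∈ xs → y ∈ xs → x ≡ y
  length≡1⇒≡ {_ ∷ []} _ (here refl) (here refl) = refl

  length≤1 : ∀ {xs : List A} → Unique xs → (∀ {x y} → x ∈ xs → y ∈ xs → x ≡ y) → length xs ≤ 1
  length≤1 {[]}        _ _ = z≤n
  length≤1 {_ ∷ []}    _ _ = s≤s z≤n
  length≤1 {_ ∷ _ ∷ _} ((y≢z ∷ _) ∷ _) only =
    contradiction (only (here refl) (there (here refl))) y≢z

  length≡0 : ∀ {xs : List A} → (∀ {x} → x ∉ xs) → length xs ≡ 0
  length≡0 {[]}    _     = refl
  length≡0 {_ ∷ _} empty = contradiction (here refl) empty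

  length≡2 : ∀ {xs : List A} {x y} → Unique xs → x ∈ xs → y ∈ xs → x ≢ y →
             (∀ {z} → z ∈ xs → z ≡ x ⊎ z ≡ y) → length xs ≡ 2
  length≡2 {x = x} {y} xs! x∈ y∈ x≢y only = ℕₚ.≤-antisym
    (Unique-length-≤ xs! upper)
    (Unique-length-≤ {x ∷ y ∷ []} ((x≢y ∷ []) ∷ [] ∷ []) λ where
      (here refl)         → x∈
      (there (here refl)) → y∈)
    where
    upper : ∀ {z} → z ∈ _ → z ∈ x ∷ y ∷ []
    upper z∈ with only z∈
    ... | inj₁ z≡x = here z≡x
    ... | inj₂ z≡y = there (here z≡y)

  length≡2⇒≢ : ∀ {xs : List A} → Unique xs → length xs ≡ 2 → ∃₂ λ x y → x ∈ xs × y ∈ xs × x ≢ y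
  length≡2⇒≢ {x ∷ y ∷ []} ((x≢y ∷ _) ∷ _) _ = x , y , here refl , there (here refl) , x≢y


-- Positivity of all weights in the Markov chain.

module Positivity (G : Graph) (k : ℕ) where
  open Graph G

  private
    Col = Coloring G k

  Positive-continueWalk : ∀ n C v used w p q → Positive (continueWalk G k n C v used w p q)
  Positive-continueWalk zero    C v used w p q = Positive-return _
  Positive-continueWalk (suc n) C v used w p q with w ≟ᶠ v
  ... | yes _ = Positive-return _
  ... | no  _ = Positive-select (available G k C used w p)
    (λ e → Positive->>= (Positive-continueWalk n C v (e ∷ used) (otherEnd G e w) q p)
                        (λ _ → Positive-return _))
    (Positive-return _)

  Positive-walk : ∀ C v e avoid a b → Positive (walk G k C v e avoid a b)
  Positive-walk C v e avoid a b =
    Positive->>= (Positive-continueWalk size C v (e ∷ avoid) (otherEnd G e v) b a)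
                 (λ _ → Positive-return _)

  Positive-walkThrough : ∀ C v e a b → Positive (walkThrough G k C v e a b)
  Positive-walkThrough C v e a b =
    Positive->>= (Positive-walk C v e [] a b) λ es →
    Positive-select (available G k C es v b)
      (λ f → Positive->>= (Positive-walk C v f es b a) (λ _ → Positive-return _))
      (Positive-return _)

  Positive-eliminate : ∀ C v ab → Positive (eliminate G k C v ab)
  Positive-eliminate C v (a , b) =
    Positive-select (coloredAt G k C v a)
      (λ e → Positive->>= (Positive-walk C v e [] a b) (λ _ → Positive-return _))
      (Positive-return _)

  Positive-eliminateUpTo : ∀ n cs C → Positive (eliminateUpTo G k n cs C)
  Positive-eliminateUpTo zero    cs C = Positive-return _
  Positive-eliminateUpTo (suc n) cs C =
    Positive-select (deficientVertices G k C)
      (λ v → Positive-select (filter (hasDeficiency? G k C v) (cartesianProduct cs cs))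
        (λ ab → Positive->>= (Positive-eliminate C v ab) (Positive-eliminateUpTo n cs))
        (Positive-return _))
      (Positive-return _)

  private
    half-pos : 0ℚ <ʳ half
    half-pos = ℚₚ.positive⁻¹ half

    third-pos : 0ℚ <ʳ third
    third-pos = ℚₚ.positive⁻¹ third

    quarter-pos : 0ℚ <ʳ quarter
    quarter-pos = ℚₚ.positive⁻¹ quarter

    Positive-half : {d e : Dist Col} → Positive d → Positive e →
                    Positive (scale half d ++ scale half e)
    Positive-half d e = All-++⁺ (Positive-scale half-pos d) (Positive-scale half-pos e)

  Positive-flipTwo : ∀ c c′ C → Positive (flipTwo G k c c′ C)
  Positive-flipTwo c c′ C =
    Positive-select (pairs (subPathsWithOneInnerEnd G (colored₂ G k C c c′)))
      (λ _ → Positive-return _) (Positive-return _)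

  module _ (c c′ : Color G k) where
    open TwoColors G k c c′

    Positive-flipInitial₂ : ∀ C → Positive (flipInitial C)
    Positive-flipInitial₂ C = Positive-mix third-pos third-pos third-pos
      (Positive-return C)
      (Positive-select (map (pathEdges G (colored₂ G k C c c′)) (subPaths G (colored₂ G k C c c′))
                         ++ cycles G (colored₂ G k C c c′))
        (λ _ → Positive-return _) (Positive-return _))
      (Positive-flipTwo c c′ C)

    Positive-perturb₂ : ∀ C → Positive (perturb C)
    Positive-perturb₂ C = Positive-select (deficientVertices G k C)
      (λ v → Positive-select (repeatedAt G k C v) (λ _ → Positive-return _) (Positive-return _))
      (Positive-half
        (Positive-select (colored₂ G k C c c′) (λ _ → Positive-return _) (Positive-return _))
        (Positive-return _))

    Positive-move₂ : ∀ C → Positive (move C)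
    Positive-move₂ C =
      Positive->>= (Positive->>= (Positive-flipInitial₂ C) Positive-perturb₂)
        (Positive-eliminateUpTo order (c ∷ c′ ∷ []))

  module _ (c″ c c′ : Color G k) where
    open ThreeColors G k c″ c c′

    Positive-flipInitial₃ : ∀ C → Positive (flipInitial C)
    Positive-flipInitial₃ C = Positive-mix third-pos third-pos third-pos
      (Positive-return C)
      (Positive-select (subPathsWithInnerEnd G (colored₂ G k C c c′))
        (λ _ → Positive-return _) (Positive-return _))
      (Positive-flipTwo c c′ C)

    Positive-perturbDeficient : ∀ C v → Positive (perturbDeficient C v)
    Positive-perturbDeficient C v = Positive-select (repeatedAt G k C v)
      (λ e → Positive->>= (Positive-walkThrough C v e (lookup C e) c″) (λ _ → Positive-return _))
      (Positive-return _)

    Positive-perturbNonDeficient : ∀ C → Positive (perturbNonDeficient C)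
    Positive-perturbNonDeficient C = Positive-select (candidates C)
      (λ v → Positive-select (coloredAt G k C v c″)
        (λ e → Positive-select (otherEdges C v)
          (λ f → Positive->>= (Positive-walk C v e [ f ] c″ (lookup C f)) (λ _ → Positive-return _))
          (Positive-return _))
        (Positive-return _))
      (Positive-return _)

    Positive-perturb₃ : ∀ C → Positive (perturb C)
    Positive-perturb₃ C with deficientVertices G k C
    ... | []         = Positive-perturbNonDeficient C
    ... | v ∷ []     = Positive-half (Positive-perturbDeficient C v) (Positive-perturbNonDeficient C)
    ... | v ∷ w ∷ vs = Positive->>= (Positive-uniform v (w ∷ vs)) (Positive-perturbDeficient C)

    Positive-move₃ : ∀ C → Positive (move C)
    Positive-move₃ C =
      Positive->>= (Positive->>= (Positive-flipInitial₃ C) Positive-perturb₃)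
        (Positive-eliminateUpTo order (c ∷ c′ ∷ c″ ∷ []))

  Positive-M : ∀ C → Positive (M G k C)
  Positive-M C = Positive-mix half-pos quarter-pos quarter-pos
    (Positive-return C)
    (Positive-select (pairs (colors G k)) (λ (c , c′) → Positive-move₂ c c′ C) (Positive-return C))
    (Positive-select (triples (colors G k))
      (λ (x , y , z) → Positive->>= (Positive-uniform (x , y , z) ((y , x , z) ∷ (z , x , y) ∷ []))
        (λ (c″ , c , c′) → Positive-move₃ c″ c c′ C))
      (Positive-return C))

  step-from-support : ∀ {n C D E} → proj₁ D ∈ˢ M G k (proj₁ C) → Reaches G k n D E →
                      Reaches G k (suc n) C E
  step-from-support {D = D} D∈ =
    step (Pr-pos (λ X → _≟ᶜ_ G k X (proj₁ D)) (Positive-M _) D∈ refl)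

  -- `pairs` lists p and q in one order only, depending on their positions, so the outcome is
  -- required for both orders.
  ∈ˢ-M₂ : ∀ {C D} {p q : Color G k} → p ≢ q →
          (∀ c c′ → (c ≡ p × c′ ≡ q) ⊎ (c ≡ q × c′ ≡ p) → D ∈ˢ TwoColors.move G k c c′ C) →
          D ∈ˢ M G k C
  ∈ˢ-M₂ {C} {D} {p} {q} p≢q D∈ = ∈ˢ-++ʳ (scale half (return C)) (∈ˢ-++ˡ (∈ˢ-scale quarter
    (case ∈-pairs (∈-allFin p) (∈-allFin q) p≢q of λ where
      (inj₁ pq∈) → ∈ˢ-select pq∈ (D∈ p q (inj₁ (refl , refl)))
      (inj₂ qp∈) → ∈ˢ-select qp∈ (D∈ q p (inj₂ (refl , refl))))))

  ∈ˢ-M₃ : ∀ {C D} {b p q : Color G k} → b ≢ p → b ≢ q → p ≢ q →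
          (∀ c c′ → (c ≡ p × c′ ≡ q) ⊎ (c ≡ q × c′ ≡ p) → D ∈ˢ ThreeColors.move G k b c c′ C) →
          D ∈ˢ M G k C
  ∈ˢ-M₃ {C} {D} {b} {p} {q} b≢p b≢q p≢q D∈ =
    ∈ˢ-++ʳ (scale half (return C)) (∈ˢ-++ʳ (scale quarter (select (pairs (colors G k)) _ _))
      (∈ˢ-scale quarter
        (case ∈-triples (∈-allFin b) (∈-allFin p) (∈-allFin q) b≢p b≢q p≢q of λ where
          (inj₁ (t , t∈ , bpq∈)) → ∈ˢ-select t∈
            (∈ˢ->>= {f = threeMove} (∈ˢ-uniform bpq∈) (D∈ p q (inj₁ (refl , refl))))
          (inj₂ (t , t∈ , bqp∈)) → ∈ˢ-select t∈
            (∈ˢ->>= {f = threeMove} (∈ˢ-uniform bqp∈) (D∈ q p (inj₂ (refl , refl)))))))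
    where
    threeMove : Color G k × Color G k × Color G k → Dist (Coloring G k)
    threeMove (c″ , c , c′) = ThreeColors.move G k c″ c c′ C

-- Flips as reversals of oriented edges, and conditions at a single vertex.

module Local (G : Graph) (bip : Bipartite G) (k : ℕ) where
  open Graph G

  K Col : Set
  K   = Color G k
  Col = Coloring G k

  infix 9 _!_

  opaque
    _!_ : Col → Edge → K
    _!_ = lookup

  side : Vertex → Bool
  side = proj₁ bip

  Inc : Vertex → Edge → Set
  Inc = Incident G

  other : Edge → Vertex → Vertex
  other = otherEnd G

  private
    ≢⇒not : ∀ {a b : Bool} → a ≢ b → b ≡ not a
    ≢⇒not {false} {false} a≢b = contradiction refl a≢b
    ≢⇒not {false} {true}  a≢b = refl
    ≢⇒not {true}  {false} a≢b = refl
    ≢⇒not {true}  {true}  a≢b = contradiction refl a≢b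

    not≢ : ∀ {a : Bool} → not a ≢ a
    not≢ {false} ()
    not≢ {true}  ()

  inc-other : ∀ e v → Inc (other e v) e
  inc-other e v with proj₁ (ends e) ≟ᶠ v
  ... | yes _ = inj₂ refl
  ... | no  _ = inj₁ refl

  inc-cases : ∀ {e u v} → Inc v e → Inc u e → u ≡ v ⊎ u ≡ other e v
  inc-cases {e} {u} {v} v∈e u∈e with proj₁ (ends e) ≟ᶠ v | v∈e | u∈e
  ... | yes p | _      | inj₁ q = inj₁ (trans (sym q) p)
  ... | yes p | _      | inj₂ q = inj₂ (sym q)
  ... | no ¬p | inj₁ p | _      = contradiction p ¬p
  ... | no ¬p | inj₂ p | inj₁ q = inj₂ (sym q)
  ... | no ¬p | inj₂ p | inj₂ q = inj₁ (trans (sym q) p)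

  side-other : ∀ {e v} → Inc v e → side (other e v) ≡ not (side v)
  side-other {e} {v} v∈e with proj₁ (ends e) ≟ᶠ v | v∈e
  ... | yes refl | _         = ≢⇒not (proj₂ bip e)
  ... | no ¬p    | inj₁ p    = contradiction p ¬p
  ... | no ¬p    | inj₂ refl = ≢⇒not (≢-sym (proj₂ bip e))

  other≢ : ∀ {e v} → Inc v e → other e v ≢ v
  other≢ v∈e eq = not≢ (trans (sym (side-other v∈e)) (cong side eq))

  other-other : ∀ {e v} → Inc v e → other e (other e v) ≡ v
  other-other {e} {v} v∈e with inc-cases (inc-other e v) v∈e
  ... | inj₁ eq = contradiction (sym eq) (other≢ v∈e)
  ... | inj₂ eq = sym eq

  swap-fst : ∀ (a b : K) → swap G k a b a ≡ b
  swap-fst a b with a ≟ᶠ a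
  ... | yes _   = refl
  ... | no a≢a = contradiction refl a≢a

  swap-snd : ∀ (a b : K) → swap G k a b b ≡ a
  swap-snd a b with b ≟ᶠ a | b ≟ᶠ b
  ... | yes b≡a | _       = b≡a
  ... | no _    | yes _   = refl
  ... | no _    | no b≢b = contradiction refl b≢b

  swap-other : ∀ {a b x : K} → x ≢ a → x ≢ b → swap G k a b x ≡ x
  swap-other {a} {b} {x} x≢a x≢b with x ≟ᶠ a | x ≟ᶠ b
  ... | yes x≡a | _       = contradiction x≡a x≢a
  ... | no _    | yes x≡b = contradiction x≡b x≢b
  ... | no _    | no _    = refl

  swap-comm : ∀ (a b x : K) → swap G k a b x ≡ swap G k b a x
  swap-comm a b x with x ≟ᶠ a | x ≟ᶠ b
  ... | yes refl | yes refl = refl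
  ... | yes refl | no _     = refl
  ... | no _     | yes refl = refl
  ... | no _     | no _     = refl

  swap-involutive : ∀ (a b x : K) → swap G k a b (swap G k a b x) ≡ x
  swap-involutive a b x with x ≟ᶠ a | x ≟ᶠ b
  ... | yes refl | _        = swap-snd a b
  ... | no _     | yes refl = swap-fst a b
  ... | no x≢a   | no x≢b   = swap-other x≢a x≢b

  opaque
    unfolding _!_

    private
      lookup-flip : ∀ a b D (X : Col) e → Σ (Edge → K) λ color →
                    flip G k a b D X ≡ tabulate color × flip G k a b D X ! e ≡ color e
      lookup-flip a b D X e = _ , refl , lookup∘tabulate _ e

    flip-∈ : ∀ {a b D e} (X : Col) → e ∈ D → flip G k a b D X ! e ≡ swap G k a b (X ! e)
    flip-∈ {a} {b} {D} {e} X e∈D with _∈?_ _≟ᶠ_ e D | proj₂ (proj₂ (lookup-flip a b D X e))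
    ... | yes _   | eq = eq
    ... | no e∉D | _  = contradiction e∈D e∉D

    flip-∉ : ∀ {a b D e} (X : Col) → e ∉ D → flip G k a b D X ! e ≡ X ! e
    flip-∉ {a} {b} {D} {e} X e∉D with _∈?_ _≟ᶠ_ e D | proj₂ (proj₂ (lookup-flip a b D X e))
    ... | yes e∈D | _  = contradiction e∈D e∉D
    ... | no _    | eq = eq

    ext : {X Y : Col} → (∀ e → X ! e ≡ Y ! e) → X ≡ Y
    ext {X} {Y} eq = trans (sym (tabulate∘lookup X)) (trans (tabulate-cong eq) (tabulate∘lookup Y))

  -- The pair (a , b) orients the edges of colors a and b: those of color a away
  -- from the vertices of side true, those of color b towards them.  Alternating
  -- walks are then directed walks, and flipping colors is reversing edges.
  Ori : Set
  Ori = K × K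

  out in′ : Ori → Bool → K
  out (a , b) s = if s then a else b
  in′ (a , b) s = if s then b else a

  op : Ori → Ori
  op (a , b) = b , a

  Distinct : Ori → Set
  Distinct (a , b) = a ≢ b

  opaque
    flipₒ : Ori → List Edge → Col → Col
    flipₒ (a , b) = flip G k a b

  Two : Ori → Col → Edge → Set
  Two (a , b) X e = X ! e ≡ a ⊎ X ! e ≡ b

  Out In : Ori → Col → Vertex → Edge → Set
  Out o X u e = Inc u e × X ! e ≡ out o (side u)
  In  o X u e = Inc u e × X ! e ≡ in′ o (side u)

  module _ {o : Ori} where

    out-not : ∀ s → out o (not s) ≡ in′ o s
    out-not true  = refl
    out-not false = refl

    in-not : ∀ s → in′ o (not s) ≡ out o s
    in-not true  = refl
    in-not false = refl

    out≢in : Distinct o → ∀ s → out o s ≢ in′ o s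
    out≢in o! true  = o!
    out≢in o! false = ≢-sym o!

    Two-out : ∀ {X e} s → X ! e ≡ out o s → Two o X e
    Two-out true  eq = inj₁ eq
    Two-out false eq = inj₂ eq

    Two-in : ∀ {X e} s → X ! e ≡ in′ o s → Two o X e
    Two-in true  eq = inj₂ eq
    Two-in false eq = inj₁ eq

    Two⇒ : ∀ {X e} s → Two o X e → X ! e ≡ out o s ⊎ X ! e ≡ in′ o s
    Two⇒ true  (inj₁ eq) = inj₁ eq
    Two⇒ true  (inj₂ eq) = inj₂ eq
    Two⇒ false (inj₁ eq) = inj₂ eq
    Two⇒ false (inj₂ eq) = inj₁ eq

    Two-resp : ∀ {X e f} → Two o X e → X ! e ≡ X ! f → Two o X f
    Two-resp (inj₁ p) q = inj₁ (trans (sym q) p)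
    Two-resp (inj₂ p) q = inj₂ (trans (sym q) p)

    Out-In-⊥ : ∀ {X u e} → Distinct o → Out o X u e → ¬ In o X u e
    Out-In-⊥ o! (_ , p) (_ , q) = out≢in o! _ (trans (sym p) q)

    Out⇒In-other : ∀ {X u e} → Out o X u e → In o X (other e u) e
    Out⇒In-other {u = u} {e} (u∈e , p) =
      inc-other e u , trans p (sym (trans (cong (in′ o) (side-other u∈e)) (in-not (side u))))

    In⇒Out-other : ∀ {X u e} → In o X u e → Out o X (other e u) e
    In⇒Out-other {u = u} {e} (u∈e , p) =
      inc-other e u , trans p (sym (trans (cong (out o) (side-other u∈e)) (out-not (side u))))

    Out-unique-end : ∀ {X u v e} → Distinct o → Out o X u e → Out o X v e → u ≡ v
    Out-unique-end o! u→ v→ with inc-cases (proj₁ v→) (proj₁ u→)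
    ... | inj₁ eq   = eq
    ... | inj₂ refl = contradiction (Out⇒In-other v→) (Out-In-⊥ o! u→)

    opaque
      unfolding flipₒ

      flipₒ-out : ∀ s D X → flip G k (out o s) (in′ o s) D X ≡ flipₒ o D X
      flipₒ-out true  D X = refl
      flipₒ-out false D X = ext lem
        where
        lem : ∀ e → flip G k (proj₂ o) (proj₁ o) D X ! e ≡ flipₒ o D X ! e
        lem e with _∈?_ _≟ᶠ_ e D
        ... | yes e∈D = trans (flip-∈ X e∈D) (trans (swap-comm (proj₂ o) (proj₁ o) (X ! e)) (sym (flip-∈ X e∈D)))
        ... | no e∉D  = trans (flip-∉ X e∉D) (sym (flip-∉ X e∉D))

      flipₒ-In : ∀ {X D u e} → In o X u e → e ∈ D → flipₒ o D X ! e ≡ out o (side u)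
      flipₒ-In {X} {D} {u} (_ , p) e∈D with side u
      ... | true  = trans (flip-∈ X e∈D) (trans (cong (swap G k _ _) p) (swap-snd (proj₁ o) (proj₂ o)))
      ... | false = trans (flip-∈ X e∈D) (trans (cong (swap G k _ _) p) (swap-fst (proj₁ o) (proj₂ o)))

      flipₒ-Out : ∀ {X D u e} → Out o X u e → e ∈ D → flipₒ o D X ! e ≡ in′ o (side u)
      flipₒ-Out {X} {D} {u} (_ , p) e∈D with side u
      ... | true  = trans (flip-∈ X e∈D) (trans (cong (swap G k _ _) p) (swap-fst (proj₁ o) (proj₂ o)))
      ... | false = trans (flip-∈ X e∈D) (trans (cong (swap G k _ _) p) (swap-snd (proj₁ o) (proj₂ o)))

      flipₒ-∉ : ∀ {X D e} → e ∉ D → flipₒ o D X ! e ≡ X ! e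
      flipₒ-∉ {X} = flip-∉ X

      ¬Two⇒flipₒ : ∀ {X D e} → ¬ Two o X e → flipₒ o D X ! e ≡ X ! e
      ¬Two⇒flipₒ {X} {D} {e} ¬two with _∈?_ _≟ᶠ_ e D
      ... | yes e∈D = trans (flip-∈ X e∈D) (swap-other (¬two ∘ inj₁) (¬two ∘ inj₂))
      ... | no e∉D  = flip-∉ X e∉D

      flipₒ-Two : ∀ {X D e} → Two o X e → Two o (flipₒ o D X) e
      flipₒ-Two {X} {D} {e} two with _∈?_ _≟ᶠ_ e D | two
      ... | yes e∈D | inj₁ eq = inj₂ (trans (flip-∈ X e∈D) (trans (cong (swap G k _ _) eq) (swap-fst (proj₁ o) (proj₂ o))))
      ... | yes e∈D | inj₂ eq = inj₁ (trans (flip-∈ X e∈D) (trans (cong (swap G k _ _) eq) (swap-snd (proj₁ o) (proj₂ o))))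
      ... | no e∉D  | inj₁ eq = inj₁ (trans (flip-∉ X e∉D) eq)
      ... | no e∉D  | inj₂ eq = inj₂ (trans (flip-∉ X e∉D) eq)

      flipₒ-involutive : ∀ D X → flipₒ o D (flipₒ o D X) ≡ X
      flipₒ-involutive D X = ext lem
        where
        lem : ∀ e → flipₒ o D (flipₒ o D X) ! e ≡ X ! e
        lem e with _∈?_ _≟ᶠ_ e D
        ... | yes e∈D = trans (flip-∈ _ e∈D) (trans (cong (swap G k _ _) (flip-∈ X e∈D)) (swap-involutive _ _ _))
        ... | no e∉D  = trans (flip-∉ _ e∉D) (flip-∉ X e∉D)

      Two-flipₒ⁻ : ∀ {X D e} → Two o (flipₒ o D X) e → Two o X e
      Two-flipₒ⁻ {X} {D} {e} two = subst (λ Z → Two o Z e) (flipₒ-involutive D X) (flipₒ-Two {D = D} two)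

      flipₒ-cong : ∀ {D E} X → (∀ {e} → e ∈ D → e ∈ E) → (∀ {e} → e ∈ E → e ∈ D) →
                   flipₒ o D X ≡ flipₒ o E X
      flipₒ-cong {D} {E} X D⊆E E⊆D = ext lem
        where
        lem : ∀ e → flipₒ o D X ! e ≡ flipₒ o E X ! e
        lem e with _∈?_ _≟ᶠ_ e D
        ... | yes e∈D = trans (flip-∈ X e∈D) (sym (flip-∈ X (D⊆E e∈D)))
        ... | no e∉D  = trans (flip-∉ X e∉D) (sym (flip-∉ X (e∉D ∘ E⊆D)))

      flipₒ-++ : ∀ {D E} X → (∀ {e} → e ∈ D → e ∉ E) → flipₒ o D (flipₒ o E X) ≡ flipₒ o (D ++ E) X
      flipₒ-++ {D} {E} X disj = ext lem
        where
        lem : ∀ e → flipₒ o D (flipₒ o E X) ! e ≡ flipₒ o (D ++ E) X ! e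
        lem e with _∈?_ _≟ᶠ_ e D | _∈?_ _≟ᶠ_ e E
        ... | yes e∈D | _       = trans (flip-∈ _ e∈D) (trans (cong (swap G k _ _) (flip-∉ X (disj e∈D))) (sym (flip-∈ X (∈-++⁺ˡ e∈D))))
        ... | no e∉D  | yes e∈E = trans (flip-∉ _ e∉D) (trans (flip-∈ X e∈E) (sym (flip-∈ X (∈-++⁺ʳ D e∈E))))
        ... | no e∉D  | no e∉E  = trans (flip-∉ _ e∉D) (trans (flip-∉ X e∉E) (sym (flip-∉ X λ e∈ → case ∈-++⁻ D e∈ of λ where
                (inj₁ e∈D) → e∉D e∈D
                (inj₂ e∈E) → e∉E e∈E)))

  -- Properness is restricted to the edges in S in order to treat proper vertices, holes (all edges
  -- but h) and vertices considered only for two colors by the same lemma `closed-flip`.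
  PropOn : (Edge → Set) → Col → Vertex → Set
  PropOn S X u = ∀ {e f} → Inc u e → Inc u f → S e → S f → X ! e ≡ X ! f → e ≡ f

  Prop : Col → Vertex → Set
  Prop X u = ∀ {e f} → Inc u e → Inc u f → X ! e ≡ X ! f → e ≡ f

  PropOff : Edge → Col → Vertex → Set
  PropOff h = PropOn (_≢ h)

  Agree : Col → Col → Vertex → Set
  Agree X Y u = ∀ {e} → Inc u e → X ! e ≡ Y ! e

  -- X has a (+ out - in)-deficiency at s, or loses it: h is one of at most two
  -- outgoing edges at s, and there is no incoming one.
  record Hole (o : Ori) (X : Col) (s : Vertex) (h : Edge) : Set where
    field
      outgoing : Out o X s h
      no-in    : ∀ {e} → ¬ In o X s e
      off      : PropOff h X s

  open Hole public

  Prop⇒PropOn : ∀ {S X u} → Prop X u → PropOn S X u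
  Prop⇒PropOn prop u∈e u∈f _ _ = prop u∈e u∈f

  PropOn⇒Prop : ∀ {X u} → PropOn (λ _ → ⊤) X u → Prop X u
  PropOn⇒Prop prop u∈e u∈f = prop u∈e u∈f tt tt

  Prop-resp : ∀ {X Y u} → Agree X Y u → Prop X u → Prop Y u
  Prop-resp agree prop u∈e u∈f eq = prop u∈e u∈f (trans (agree u∈e) (trans eq (sym (agree u∈f))))

  Hole-resp : ∀ {o X Y s h} → Agree X Y s → Hole o X s h → Hole o Y s h
  Hole-resp agree hole = record
    { outgoing = let s∈h , eq = outgoing hole in s∈h , trans (sym (agree s∈h)) eq
    ; no-in    = λ (s∈e , eq) → no-in hole (s∈e , trans (agree s∈e) eq)
    ; off      = λ s∈e s∈f e≢h f≢h eq →
        off hole s∈e s∈f e≢h f≢h (trans (agree s∈e) (trans eq (sym (agree s∈f))))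
    }

  module _ {o : Ori} (o! : Distinct o) where

    -- By properness e was the only incoming edge at s, and it is reversed.
    hole-opens : ∀ {X Y s e} → Prop X s → In o X s e → Y ! e ≡ out o (side s) →
                 (∀ {f} → Inc s f → f ≢ e → Y ! f ≡ X ! f) → Hole o Y s e
    hole-opens {X} {Y} {s} {e} prop (s∈e , Xe) Ye same = record
      { outgoing = s∈e , Ye
      ; no-in    = λ {f} (s∈f , Yf) → case f ≟ᶠ e of λ where
          (yes refl) → out≢in o! _ (trans (sym Ye) Yf)
          (no f≢e)   → f≢e (prop s∈f s∈e (trans (sym (same s∈f f≢e)) (trans Yf (sym Xe))))
      ; off      = λ s∈f s∈g f≢e g≢e eq →
          prop s∈f s∈g (trans (sym (same s∈f f≢e)) (trans eq (same s∈g g≢e)))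
      }

    -- There are at most two outgoing edges, h and g, and either of them can be the exceptional one:
    -- by `off`, an edge of this color other than h is g.
    hole-swap : ∀ {X s h g} → Hole o X s h → Out o X s g → Hole o X s g
    hole-swap {X} {s} {h} {g} hole (s∈g , Xg) = record
      { outgoing = s∈g , Xg
      ; no-in    = no-in hole
      ; off      = λ {e} {f} s∈e s∈f e≢g f≢g eq → lem s∈e s∈f e≢g f≢g eq (e ≟ᶠ h) (f ≟ᶠ h)
      }
      where
      Xh≡Xg : X ! h ≡ X ! g
      Xh≡Xg = trans (proj₂ (outgoing hole)) (sym Xg)

      lem : ∀ {e f} → Inc s e → Inc s f → e ≢ g → f ≢ g → X ! e ≡ X ! f → Dec (e ≡ h) → Dec (f ≡ h) → e ≡ f
      lem s∈e s∈f e≢g f≢g eq (yes refl) (yes refl) = refl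
      lem s∈e s∈f e≢g f≢g eq (yes refl) (no f≢h)   =
        contradiction (off hole s∈f s∈g f≢h (≢-sym e≢g) (trans (sym eq) Xh≡Xg)) f≢g
      lem s∈e s∈f e≢g f≢g eq (no e≢h)   (yes refl) =
        contradiction (off hole s∈e s∈g e≢h (≢-sym f≢g) (trans eq Xh≡Xg)) e≢g
      lem s∈e s∈f e≢g f≢g eq (no e≢h)   (no f≢h)   = off hole s∈e s∈f e≢h f≢h eq

    -- Reversing g leaves one outgoing edge, and g becomes the only incoming one.
    hole-closes : ∀ {X Y s h g} → Hole o X s h → Out o X s g → g ≢ h → Y ! g ≡ in′ o (side s) →
                  (∀ {f} → Inc s f → f ≢ g → Y ! f ≡ X ! f) → Prop Y s
    hole-closes {X} {Y} {s} {h} {g} hole g→ g≢h Yg same {e} {f} s∈e s∈f eq with e ≟ᶠ g | f ≟ᶠ g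
    ... | yes refl | yes refl = refl
    ... | yes refl | no f≢g   =
      contradiction (s∈f , trans (sym (same s∈f f≢g)) (trans (sym eq) Yg)) (no-in hole)
    ... | no e≢g   | yes refl =
      contradiction (s∈e , trans (sym (same s∈e e≢g)) (trans eq Yg)) (no-in hole)
    ... | no e≢g   | no f≢g   =
      off (hole-swap hole g→) s∈e s∈f e≢g f≢g (trans (sym (same s∈e e≢g)) (trans eq (same s∈f f≢g)))

    hole-trivial : ∀ {X s h} → Hole o X s h → (∀ {e} → Out o X s e → e ≡ h) → Prop X s
    hole-trivial {X} {s} {h} hole only {e} {f} s∈e s∈f eq with e ≟ᶠ h | f ≟ᶠ h
    ... | yes refl | yes refl = refl
    ... | yes refl | no f≢h   = sym (only (s∈f , trans (sym eq) (proj₂ (outgoing hole))))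
    ... | no e≢h   | yes refl = only (s∈e , trans eq (proj₂ (outgoing hole)))
    ... | no e≢h   | no f≢h   = off hole s∈e s∈f e≢h f≢h eq

    opaque
      unfolding flipₒ

      -- D contains either all or none of the relevant edges of the two colors at u, so there the
      -- flip is a permutation of the colors, which creates no coincidence.
      closed-flip : ∀ {S X D u} → PropOn S X u →
        (∀ {e f} → Inc u e → Inc u f → S e → S f → Two o X e → Two o X f → e ∈ D → f ∈ D) →
        PropOn S (flipₒ o D X) u
      closed-flip {S} {X} {D} {u} prop closed {e} {f} u∈e u∈f Se Sf eq
        with two? e | two? f
        where
        two? : ∀ e → Dec (Two o X e)
        two? e = (X ! e ≟ᶠ proj₁ o) ⊎-dec (X ! e ≟ᶠ proj₂ o)
      ... | no ¬two-e | no ¬two-f =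
        prop u∈e u∈f Se Sf (trans (sym (¬Two⇒flipₒ {o = o} {D = D} ¬two-e)) (trans eq (¬Two⇒flipₒ {o = o} {D = D} ¬two-f)))
      ... | yes two-e | no ¬two-f = contradiction (Two-flipₒ⁻ {o} {X} {D} (Two-resp (flipₒ-Two {o} {D = D} two-e) eq)) ¬two-f
      ... | no ¬two-e | yes two-f = contradiction (Two-flipₒ⁻ {o} {X} {D} (Two-resp (flipₒ-Two {o} {D = D} two-f) (sym eq))) ¬two-e
      ... | yes two-e | yes two-f with _∈?_ _≟ᶠ_ e D
      ...   | yes e∈D = prop u∈e u∈f Se Sf
        (trans (sym (swap-involutive (proj₁ o) (proj₂ o) _)) (trans (cong (swap G k _ _)
          (trans (sym (flip-∈ X e∈D)) (trans eq (flip-∈ X (closed u∈e u∈f Se Sf two-e two-f e∈D)))))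
          (swap-involutive (proj₁ o) (proj₂ o) _)))
      ...   | no e∉D  = prop u∈e u∈f Se Sf
        (trans (sym (flip-∉ X e∉D)) (trans eq (flip-∉ X (e∉D ∘ closed u∈f u∈e Sf Se two-f two-e))))

  opaque
    unfolding _!_

    ∈-coloredAt⁺ : ∀ {X v c e} → Inc v e → X ! e ≡ c → e ∈ coloredAt G k X v c
    ∈-coloredAt⁺ {X} {v} {c} {e} v∈e eq =
      ∈-filter⁺ (λ e → X ! e ≟ᶠ c) (∈-filter⁺ (incident? G v) (∈-allFin e) v∈e) eq

    ∈-coloredAt⁻ : ∀ {X v c e} → e ∈ coloredAt G k X v c → Inc v e × X ! e ≡ c
    ∈-coloredAt⁻ {X} {v} {c} e∈ with ∈-filter⁻ (λ e → X ! e ≟ᶠ c) {xs = edgesAt G v} e∈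
    ... | e∈′ , eq = proj₂ (∈-filter⁻ (incident? G v) {xs = edges G} e∈′) , eq

  Unique-coloredAt : ∀ {X v c} → Unique (coloredAt G k X v c)
  Unique-coloredAt {X} {v} {c} =
    Unique-filter⁺ (λ e → lookup X e ≟ᶠ c) (Unique-filter⁺ (incident? G v) (allFin⁺ size))

  Hole⇒HasDeficiency : ∀ {o X s h g} → Distinct o → Hole o X s h → Out o X s g → g ≢ h →
                       HasDeficiency G k X s (out o (side s) , in′ o (side s))
  Hole⇒HasDeficiency {o} {X} {s} {h} {g} o! hole (s∈g , Xg) g≢h =
      length≡2 (Unique-coloredAt {X}) (∈-coloredAt⁺ {X} s∈g Xg) (∈-coloredAt⁺ {X} s∈h Xh) g≢h only
    , (λ d d≢ → length≤1 (Unique-coloredAt {X}) (single d d≢))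
    , length≡0 λ e∈ → no-in hole (∈-coloredAt⁻ {X} e∈)
    where
    s∈h : Inc s h
    s∈h = proj₁ (outgoing hole)

    Xh : X ! h ≡ out o (side s)
    Xh = proj₂ (outgoing hole)

    only : ∀ {e} → e ∈ coloredAt G k X s (out o (side s)) → e ≡ g ⊎ e ≡ h
    only {e} e∈ with ∈-coloredAt⁻ {X} e∈ | e ≟ᶠ h
    ... | _         | yes e≡h = inj₂ e≡h
    ... | s∈e , Xe | no e≢h  = inj₁ (off hole s∈e s∈g e≢h g≢h (trans Xe (sym Xg)))

    single : ∀ d → d ≢ out o (side s) → ∀ {e f} → e ∈ coloredAt G k X s d → f ∈ coloredAt G k X s d → e ≡ f
    single d d≢ e∈ f∈ with ∈-coloredAt⁻ {X} e∈ | ∈-coloredAt⁻ {X} f∈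
    ... | s∈e , Xe | s∈f , Xf = off hole s∈e s∈f
      (λ { refl → d≢ (trans (sym Xe) Xh) }) (λ { refl → d≢ (trans (sym Xf) Xh) }) (trans Xe (sym Xf))

  Deficient⇒¬Prop : ∀ {X v} → Deficient G k X v → ¬ Prop X v
  Deficient⇒¬Prop {X} (c , c′ , len , _) prop with length≡2⇒≢ (Unique-coloredAt {X}) len
  ... | e , f , e∈ , f∈ , e≢f with ∈-coloredAt⁻ {X} e∈ | ∈-coloredAt⁻ {X} f∈
  ...   | v∈e , Xe | v∈f , Xf = e≢f (prop v∈e v∈f (trans Xe (sym Xf)))

  opaque
    unfolding _!_

    Proper⇒Prop : ∀ {C} → Proper G k C → ∀ v → Prop C v
    Proper⇒Prop proper v {e} {f} v∈e v∈f eq with e ≟ᶠ f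
    ... | yes e≡f = e≡f
    ... | no e≢f  = contradiction eq (proper v e f v∈e v∈f e≢f)

    Prop⇒Proper : ∀ {C} → (∀ v → Prop C v) → Proper G k C
    Prop⇒Proper prop v e f v∈e v∈f e≢f eq = e≢f (prop v v∈e v∈f eq)

  ∈-deficientVertices⁺ : ∀ {X v} → Deficient G k X v → v ∈ deficientVertices G k X
  ∈-deficientVertices⁺ {X} {v} = ∈-filter⁺ (deficient? G k X) (∈-allFin v)

  ∈-deficientVertices⁻ : ∀ {X v} → v ∈ deficientVertices G k X → Deficient G k X v
  ∈-deficientVertices⁻ {X} v∈ = proj₂ (∈-filter⁻ (deficient? G k X) {xs = vertices G} v∈)

  no-deficientVertices : ∀ {X} → (∀ v → Prop X v) → ∀ v → v ∉ deficientVertices G k X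
  no-deficientVertices {X} prop v v∈ = Deficient⇒¬Prop {X} (∈-deficientVertices⁻ {X} v∈) (prop v)

-- Alternating walks as directed walks.

module Walks (G : Graph) (bip : Bipartite G) (k : ℕ) where
  open Graph G
  open Local G bip k

  -- The possible outcomes of continueWalk with stopping vertex s, which stands
  -- at the given vertex and has used the given edges.
  data Walk (o : Ori) (X : Col) (s : Vertex) : List Edge → Vertex → List Edge → Vertex → Set where
    back  : ∀ {used} → Walk o X s used s [] s
    stuck : ∀ {used w} → w ≢ s → (∀ {e} → Out o X w e → e ∈ used) → Walk o X s used w [] w
    go    : ∀ {used w e es t} → w ≢ s → Out o X w e → e ∉ used →
            Walk o X s (e ∷ used) (other e w) es t → Walk o X s used w (e ∷ es) t


  -- The list of vertices omits the initial one.
  data Path (o : Ori) (X : Col) : Vertex → List Edge → List Vertex → Vertex → Set where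
    []  : ∀ {u} → Path o X u [] [] u
    _∷_ : ∀ {u e es vs t} → Out o X u e → Path o X (other e u) es vs t →
          Path o X u (e ∷ es) (other e u ∷ vs) t

  private
    length-≤-size : ∀ {es : List Edge} → Unique es → length es ≤ size
    length-≤-size {es} es! = subst (length es ≤_) (length-tabulate {n = size} (λ e → e)) (Unique-length-≤ es! λ {e} _ → ∈-allFin e)

    ∉⇒Unique : ∀ {es : List Edge} {e} → e ∉ es → Unique es → Unique (e ∷ es)
    ∉⇒Unique e∉ es! = All.tabulate (λ { x∈ refl → e∉ x∈ }) ∷ es!

    ∈-shift⁺ : ∀ {x e : Edge} es {fs} → x ∈ e ∷ es ++ fs → x ∈ es ++ e ∷ fs
    ∈-shift⁺ es (here refl) = ∈-++⁺ʳ es (here refl)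
    ∈-shift⁺ es (there x∈) with ∈-++⁻ es x∈
    ... | inj₁ x∈es = ∈-++⁺ˡ x∈es
    ... | inj₂ x∈fs = ∈-++⁺ʳ es (there x∈fs)

    ∈-shift⁻ : ∀ {x e : Edge} es {fs} → x ∈ es ++ e ∷ fs → x ∈ e ∷ es ++ fs
    ∈-shift⁻ es x∈ with ∈-++⁻ es x∈
    ... | inj₁ x∈es         = there (∈-++⁺ˡ x∈es)
    ... | inj₂ (here refl)  = here refl
    ... | inj₂ (there x∈fs) = there (∈-++⁺ʳ es x∈fs)

  walk-exists : ∀ o X s n {used} w → Unique used → size < n + length used →
                ∃₂ λ es t → Walk o X s used w es t
  walk-exists o X s zero    w used! size< = contradiction size< (ℕₚ.≤⇒≯ (length-≤-size used!))
  walk-exists o X s (suc n) {used} w used! size< with w ≟ᶠ s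
  ... | yes refl = [] , w , back
  ... | no w≢s
    with any? (λ e → (incident? G w e ×-dec (X ! e ≟ᶠ out o (side w))) ×-dec ¬? (_∈?_ _≟ᶠ_ e used))
  ...   | yes (e , e→ , e∉) =
    let es , t , walk = walk-exists o X s n (other e w) (∉⇒Unique e∉ used!)
                          (subst (size <_) (sym (ℕₚ.+-suc n (length used))) size<)
    in e ∷ es , t , go w≢s e→ e∉ walk
  ...   | no none = [] , w , stuck w≢s λ {e} e→ → case _∈?_ _≟ᶠ_ e used of λ where
    (yes e∈) → e∈
    (no e∉)  → contradiction (e , e→ , e∉) none

  walk-length : ∀ {o X s used w es t} → Walk o X s used w es t → Unique used →
                length es + length used ≤ size
  walk-length back          used! = length-≤-size used!
  walk-length (stuck _ _)   used! = length-≤-size used!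
  walk-length {used = used} (go {es = es} _ _ e∉ walk) used! =
    subst (_≤ size) (ℕₚ.+-suc (length es) (length used)) (walk-length walk (∉⇒Unique e∉ used!))

  opaque
    unfolding _!_

    ∈-available⁺ : ∀ {X used w p e} → Inc w e → X ! e ≡ p → e ∉ used → e ∈ available G k X used w p
    ∈-available⁺ {X} {used} {w} {p} w∈e eq e∉ =
      ∈-filter⁺ (λ e → ¬? (_∈?_ _≟ᶠ_ e used)) (∈-coloredAt⁺ {X} w∈e eq) e∉

    ∈-available⁻ : ∀ {X used w p e} → e ∈ available G k X used w p → (Inc w e × X ! e ≡ p) × e ∉ used
    ∈-available⁻ {X} {used} {w} {p} e∈ with ∈-filter⁻ (λ e → ¬? (_∈?_ _≟ᶠ_ e used)) {xs = coloredAt G k X w p} e∈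
    ... | e∈′ , e∉ = ∈-coloredAt⁻ {X} e∈′ , e∉

  ∈ˢ-continueWalk : ∀ {o X s used w es t} n → Walk o X s used w es t → length es ≤ n →
    es ∈ˢ continueWalk G k n X s used w (out o (side w)) (in′ o (side w))
  ∈ˢ-continueWalk zero    back        _ = ∈ˢ-return
  ∈ˢ-continueWalk zero    (stuck _ _) _ = ∈ˢ-return
  ∈ˢ-continueWalk {s = s} (suc n) back _ with s ≟ᶠ s
  ... | yes _  = ∈ˢ-return
  ... | no s≢s = contradiction refl s≢s
  ∈ˢ-continueWalk {X = X} {s} {w = w} (suc n) (stuck w≢s none) _ with w ≟ᶠ s
  ... | yes w≡s = contradiction w≡s w≢s
  ... | no _    = ∈ˢ-select-none (λ e e∈ → case ∈-available⁻ {X} e∈ of λ (e→ , e∉) → e∉ (none e→)) ∈ˢ-return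
  ∈ˢ-continueWalk {o} {X} {s} {used} {w} (suc n) (go {e = e} {es} w≢s e→ e∉ walk) (s≤s len) with w ≟ᶠ s
  ... | yes w≡s = contradiction w≡s w≢s
  ... | no _    = ∈ˢ-select (∈-available⁺ {X} (proj₁ e→) (proj₂ e→) e∉) (∈ˢ->>= {f = λ es → return (e ∷ es)} next ∈ˢ-return)
    where
    next : es ∈ˢ continueWalk G k n X s (e ∷ used) (other e w) (in′ o (side w)) (out o (side w))
    next rewrite sym (out-not {o} (side w)) | sym (in-not {o} (side w)) | sym (side-other (proj₁ e→)) =
      ∈ˢ-continueWalk n walk len

  -- The first edge g is not part of es.
  Trail : Ori → Col → Vertex → Edge → List Edge → List Edge → Vertex → Set
  Trail o X s g avoid es t = Walk o X s (g ∷ avoid) (other g s) es t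

  trail-exists : ∀ o X s g avoid → Unique (g ∷ avoid) → ∃₂ λ es t → Trail o X s g avoid es t
  trail-exists o X s g avoid used! =
    walk-exists o X s size (other g s) used! (subst (size <_) (sym (ℕₚ.+-suc size _)) (s≤s (ℕₚ.m≤m+n size _)))

  ∈ˢ-walk : ∀ {o X s g avoid es t} → Out o X s g → Unique (g ∷ avoid) → Trail o X s g avoid es t →
            (g ∷ es) ∈ˢ walk G k X s g avoid (out o (side s)) (in′ o (side s))
  ∈ˢ-walk {o} {X} {s} {g} {avoid} {es} g→ used! trail = ∈ˢ->>= {f = λ es → return (g ∷ es)} steps ∈ˢ-return
    where
    steps : es ∈ˢ continueWalk G k size X s (g ∷ avoid) (other g s) (in′ o (side s)) (out o (side s))
    steps rewrite sym (out-not {o} (side s)) | sym (in-not {o} (side s)) | sym (side-other (proj₁ g→)) =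
      ∈ˢ-continueWalk size trail (ℕₚ.m+n≤o⇒m≤o (length es) (walk-length trail used!))

  Closed : Ori → Col → List Edge → Vertex → Set
  Closed o X D u = ∀ {e f} → Inc u e → Inc u f → Two o X e → Two o X f → e ∈ D → f ∈ D

  Regular : Ori → Col → Vertex → Set
  Regular o X u = PropOn (Two o X) X u

  module _ {o : Ori} (o! : Distinct o) {X : Col} {s : Vertex} where

    walk-two : ∀ {used w es t e} → Walk o X s used w es t → e ∈ es → Two o X e
    walk-two (go {w = w} _ e→ _ walk) (here refl) = Two-out (side w) (proj₂ e→)
    walk-two (go _ e→ _ walk)         (there e∈)  = walk-two walk e∈

    walk-fresh : ∀ {used w es t e} → Walk o X s used w es t → e ∈ es → e ∉ used
    walk-fresh (go _ _ e∉ _)    (here refl) = e∉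
    walk-fresh (go _ _ _  walk) (there e∈)  = walk-fresh walk e∈ ∘ there

    walk-Unique : ∀ {used w es t} → Walk o X s used w es t → Unique es
    walk-Unique back            = []
    walk-Unique (stuck _ _)     = []
    walk-Unique (go _ _ _ walk) = ∉⇒Unique (λ e∈ → walk-fresh walk e∈ (here refl)) (walk-Unique walk)

    -- Invariant: the used edges are closed except at s and at the current vertex w, which was
    -- entered by ℓ. If w is regular, it has no edges of the two colors but ℓ and at most one
    -- outgoing edge. Leaving by the latter closes w; being stuck means that it is used or absent.
    walk-closed : ∀ {used w es t ℓ} → Walk o X s used w es t →
      (∀ {u} → u ≢ s → u ≢ w → Regular o X u → Closed o X used u) → ℓ ∈ used → In o X w ℓ →
      ∀ {u} → u ≢ s → Regular o X u → Closed o X (es ++ used) u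
    walk-closed back closed _ _ u≢s reg = closed u≢s u≢s reg
    walk-closed {used} {w} {ℓ = ℓ} (stuck w≢s none) closed ℓ∈ ℓ← {u} u≢s reg with u ≟ᶠ w
    ... | no u≢w   = closed u≢s u≢w reg
    ... | yes refl = λ _ w∈f _ two-f _ → case Two⇒ (side w) two-f of λ where
      (inj₁ Xf) → none (w∈f , Xf)
      (inj₂ Xf) → subst (_∈ used)
        (reg (proj₁ ℓ←) w∈f (Two-in (side w) (proj₂ ℓ←)) two-f (trans (proj₂ ℓ←) (sym Xf))) ℓ∈
    walk-closed {used} {w} {ℓ = ℓ} (go {e = e} {es} w≢s e→ e∉ walk) closed ℓ∈ ℓ← {u} u≢s reg u∈x u∈y two-x two-y x∈ =
      ∈-shift⁻ es (walk-closed walk closed′ (here refl) (Out⇒In-other e→) u≢s reg u∈x u∈y two-x two-y (∈-shift⁺ es x∈))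
      where
      closed′ : ∀ {u} → u ≢ s → u ≢ other e w → Regular o X u → Closed o X (e ∷ used) u
      closed′ {u} u≢s u≢w′ reg {x} {y} u∈x u∈y two-x two-y x∈ with u ≟ᶠ w
      ... | yes refl = case Two⇒ (side w) two-y of λ where
        (inj₁ Xy) → here (reg u∈y (proj₁ e→) two-y (Two-out (side w) (proj₂ e→)) (trans Xy (sym (proj₂ e→))))
        (inj₂ Xy) → there (subst (_∈ used)
          (reg (proj₁ ℓ←) u∈y (Two-in (side w) (proj₂ ℓ←)) two-y (trans (proj₂ ℓ←) (sym Xy))) ℓ∈)
      ... | no u≢w with x∈
      ...   | there x∈used = there (closed u≢s u≢w reg u∈x u∈y two-x two-y x∈used)
      ...   | here refl with inc-cases (proj₁ e→) u∈x
      ...     | inj₁ u≡w  = contradiction u≡w u≢w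
      ...     | inj₂ u≡w′ = contradiction u≡w′ u≢w′

    -- If A contained the edge by which the walk leaves a vertex, it would by closedness contain the
    -- edge by which it entered; backwards this reaches ℓ.
    walk-disjoint : ∀ {used w es t ℓ A} → Walk o X s used w es t →
      (∀ {u e} → u ≢ s → Out o X u e → Closed o X A u) → In o X w ℓ → ℓ ∉ A →
      ∀ {e} → e ∈ es → e ∉ A
    walk-disjoint {w = w} {A = A} (go {e = e} {es} w≢s e→ _ walk) closed ℓ← ℓ∉ = λ where
        (here refl) → e∉A
        (there x∈)  → walk-disjoint walk closed (Out⇒In-other e→) e∉A x∈
      where
      e∉A : e ∉ A
      e∉A = ℓ∉ ∘ closed w≢s e→ (proj₁ e→) (proj₁ ℓ←) (Two-out (side w) (proj₂ e→)) (Two-in (side w) (proj₂ ℓ←))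

    -- The walk stops as soon as it is back at s, so it can touch s only by entering it at the very
    -- end.
    walk-start : ∀ {used w es t e} → Walk o X s used w es t → e ∈ es → Inc s e → In o X s e × t ≡ s
    walk-start (go w≢s e→ _ walk) (there e∈)  s∈e = walk-start walk e∈ s∈e
    walk-start (go w≢s e→ _ walk) (here refl) s∈e with inc-cases (proj₁ e→) s∈e
    ... | inj₁ s≡w  = contradiction (sym s≡w) w≢s
    ... | inj₂ refl = Out⇒In-other e→ , stops walk
      where
      stops : ∀ {used es t} → Walk o X s used s es t → t ≡ s
      stops back           = refl
      stops (stuck s≢s _)  = contradiction refl s≢s
      stops (go s≢s _ _ _) = contradiction refl s≢s

    -- Every vertex on the walk, the first one included, has been entered by some edge.
    walk-avoids-source : ∀ {used w es t e ℓ u} → Walk o X s used w es t → In o X w ℓ →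
      (∀ {f} → ¬ In o X u f) → e ∈ es → ¬ Inc u e
    walk-avoids-source (go _ e→ _ walk) ℓ← no-in (there e∈) u∈e = walk-avoids-source walk (Out⇒In-other e→) no-in e∈ u∈e
    walk-avoids-source (go _ e→ _ walk) ℓ← no-in (here refl) u∈e with inc-cases (proj₁ e→) u∈e
    ... | inj₁ refl = no-in ℓ←
    ... | inj₂ refl = no-in (Out⇒In-other e→)

    -- The walk cannot leave v, so it meets v at most once, at its end, and by a single edge m. If v
    -- is not met, m is arbitrary.
    walk-sink : ∀ {used w es t v} → Walk o X s used w es t → (∀ {e} → ¬ Out o X v e) →
      (∃ λ m → ∀ {e} → e ∈ used → Inc v e → w ≡ v × e ≡ m) →
      (∃ λ m → ∀ {e} → e ∈ es ++ used → Inc v e → t ≡ v × e ≡ m)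
    walk-sink back        _      inv = inv
    walk-sink (stuck _ _) _      inv = inv
    walk-sink {used} {w} {v = v} (go {e = e} {es} _ e→ _ walk) no-out (m , inv) =
      let m′ , conclusion = walk-sink walk no-out (e , inv′)
      in m′ , λ x∈ → conclusion (∈-shift⁺ es x∈)
      where
      w≢v : w ≢ v
      w≢v refl = no-out e→

      inv′ : ∀ {x} → x ∈ e ∷ used → Inc v x → other e w ≡ v × x ≡ e
      inv′ (there x∈)  v∈x = contradiction (proj₁ (inv x∈ v∈x)) w≢v
      inv′ (here refl) v∈x with inc-cases (proj₁ e→) v∈x
      ... | inj₁ v≡w  = contradiction (sym v≡w) w≢v
      ... | inj₂ refl = refl , refl

    -- Every visited vertex but s has been entered by its only incoming edge, and s has none, so
    -- none can be entered again. An outgoing edge at the last vertex would be used already, hence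
    -- would leave a vertex visited before; but an edge leaves only one vertex.
    walk-simple : ∀ {used w es t ℓ} visited → Walk o X s used w es t →
      (∀ {e} → ¬ In o X s e) →
      (∀ {u e} → u ≢ s → Out o X u e → ∀ {f g} → In o X u f → In o X u g → f ≡ g) →
      s ∈ visited → w ∉ visited → ℓ ∈ used → In o X w ℓ →
      (∀ {u} → u ∈ visited → u ≡ s ⊎ ((∀ {f g} → In o X u f → In o X u g → f ≡ g) × ∃ λ ℓ → ℓ ∈ used × In o X u ℓ)) →
      (∀ {e} → e ∈ used → ∃ λ u → u ∈ visited × Out o X u e) →
      ∃ λ vs → Path o X w es vs t × Unique (w ∷ vs) × (∀ {u} → u ∈ w ∷ vs → u ∉ visited) ×
               (∀ {e} → ¬ Out o X t e)
    walk-simple visited back _ _ s∈ s∉ _ _ _ _ = contradiction s∈ s∉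
    walk-simple {w = w} visited (stuck _ none) _ _ _ w∉ _ _ _ tails =
      [] , [] , [] ∷ [] , (λ { (here refl) → w∉ }) , λ e→ →
        let u , u∈ , u→ = tails (none e→) in w∉ (subst (_∈ visited) (Out-unique-end o! u→ e→) u∈)
    walk-simple {used} {w} {ℓ = ℓ} visited (go {e = e} w≢s e→ e∉ walk) no-in in! s∈ w∉ ℓ∈ ℓ← heads tails =
      let vs , path , vs! , new , end =
            walk-simple (w ∷ visited) walk no-in in! (there s∈) w′∉ (here refl) (Out⇒In-other e→) heads′ tails′
      in other e w ∷ vs , e→ ∷ path
       , All.tabulate (λ { u∈ refl → new u∈ (here refl) }) ∷ vs!
       , (λ { (here refl) → w∉ ; (there u∈) → new u∈ ∘ there })
       , end
      where
      w′∉ : other e w ∉ w ∷ visited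
      w′∉ (here eq)  = other≢ (proj₁ e→) eq
      w′∉ (there w′∈) with heads w′∈
      ... | inj₁ eq                    = no-in (subst (λ u → In o X u e) eq (Out⇒In-other e→))
      ... | inj₂ (in!′ , ℓ′ , ℓ′∈ , ℓ′←) = e∉ (subst (_∈ used) (in!′ ℓ′← (Out⇒In-other e→)) ℓ′∈)

      heads′ : ∀ {u} → u ∈ w ∷ visited →
        u ≡ s ⊎ ((∀ {f g} → In o X u f → In o X u g → f ≡ g) × ∃ λ ℓ → ℓ ∈ e ∷ used × In o X u ℓ)
      heads′ (here refl) = inj₂ (in! w≢s e→ , ℓ , there ℓ∈ , ℓ←)
      heads′ (there u∈) with heads u∈
      ... | inj₁ u≡s                     = inj₁ u≡s
      ... | inj₂ (in!′ , ℓ′ , ℓ′∈ , ℓ′←) = inj₂ (in!′ , ℓ′ , there ℓ′∈ , ℓ′←)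

      tails′ : ∀ {x} → x ∈ e ∷ used → ∃ λ u → u ∈ w ∷ visited × Out o X u x
      tails′ (here refl) = w , here refl , e→
      tails′ (there x∈)  = let u , u∈ , u→ = tails x∈ in u , there u∈ , u→

    trail-closed : ∀ {g es t} → Out o X s g → Trail o X s g [] es t →
      ∀ {u} → u ≢ s → Regular o X u → Closed o X (g ∷ es) u
    trail-closed {g} {es} g→ trail u≢s reg u∈e u∈f two-e two-f e∈ =
      ∈-∷ʳ⁻ (walk-closed trail initially (here refl) (Out⇒In-other g→) u≢s reg u∈e u∈f two-e two-f (∈-∷ʳ⁺ e∈))
      where
      initially : ∀ {u} → u ≢ s → u ≢ other g s → Regular o X u → Closed o X (g ∷ []) u
      initially u≢s u≢w _ u∈e _ _ _ (here refl) with inc-cases (proj₁ g→) u∈e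
      ... | inj₁ u≡s = contradiction u≡s u≢s
      ... | inj₂ u≡w = contradiction u≡w u≢w

      ∈-∷ʳ⁺ : ∀ {x} → x ∈ g ∷ es → x ∈ es ++ g ∷ []
      ∈-∷ʳ⁺ (here refl) = ∈-++⁺ʳ es (here refl)
      ∈-∷ʳ⁺ (there x∈)  = ∈-++⁺ˡ x∈

      ∈-∷ʳ⁻ : ∀ {x} → x ∈ es ++ g ∷ [] → x ∈ g ∷ es
      ∈-∷ʳ⁻ x∈ with ∈-++⁻ es x∈
      ... | inj₁ x∈es        = there x∈es
      ... | inj₂ (here refl) = here refl

    trail-sink : ∀ {g es t v} → Out o X s g → Trail o X s g [] es t → v ≢ s → (∀ {e} → ¬ Out o X v e) →
      ∃ λ m → ∀ {e} → e ∈ g ∷ es → Inc v e → t ≡ v × e ≡ m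
    trail-sink {g} {es} {t} {v} g→ trail v≢s no-out =
      let m , conclusion = walk-sink trail no-out (g , λ { (here refl) v∈g → head v∈g , refl })
      in m , λ where
        (here refl) → conclusion (∈-++⁺ʳ es (here refl))
        (there e∈)  → conclusion (∈-++⁺ˡ e∈)
      where
      head : Inc v g → other g s ≡ v
      head v∈g with inc-cases (proj₁ g→) v∈g
      ... | inj₁ v≡s = contradiction v≡s v≢s
      ... | inj₂ eq  = sym eq

    trail-simple : ∀ {g es t} → Out o X s g → Trail o X s g [] es t → (∀ {e} → ¬ In o X s e) →
      (∀ {u e} → u ≢ s → Out o X u e → ∀ {f g} → In o X u f → In o X u g → f ≡ g) →
      ∃ λ vs → Path o X s (g ∷ es) vs t × Unique (s ∷ vs) × (∀ {e} → ¬ Out o X t e)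
    trail-simple {g} g→ trail no-in in! =
      let vs , path , vs! , new , end = walk-simple (s ∷ []) trail no-in in! (here refl)
            (λ { (here eq) → other≢ (proj₁ g→) eq }) (here refl) (Out⇒In-other g→)
            (λ { (here refl) → inj₁ refl }) (λ { (here refl) → s , here refl , g→ })
      in _ , g→ ∷ path , All.tabulate (λ { u∈ refl → new u∈ (here refl) }) ∷ vs! , end

    walk-arrives : ∀ {used w es t ℓ} → Walk o X s used w es t → In o X w ℓ →
      ∃ λ e → e ∈ ℓ ∷ es × In o X t e
    walk-arrives back            ℓ← = _ , here refl , ℓ←
    walk-arrives (stuck _ _)     ℓ← = _ , here refl , ℓ←
    walk-arrives (go _ e→ _ walk) _ =
      let e , e∈ , e← = walk-arrives walk (Out⇒In-other e→) in e , there e∈ , e←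

  Path-resp : ∀ {o X Y u es vs t} → (∀ {e} → e ∈ es → X ! e ≡ Y ! e) → Path o X u es vs t → Path o Y u es vs t
  Path-resp same []             = []
  Path-resp same ((u∈e , Xe) ∷ path) = (u∈e , trans (sym (same (here refl))) Xe) ∷ Path-resp (same ∘ there) path

  Path-ends : ∀ {o X u es vs t e v} → Path o X u es vs t → e ∈ es → Inc v e → v ∈ u ∷ vs
  Path-ends (e→ ∷ path) (here refl) v∈e with inc-cases (proj₁ e→) v∈e
  ... | inj₁ refl = here refl
  ... | inj₂ refl = there (here refl)
  Path-ends (_ ∷ path)  (there e∈)  v∈e = there (Path-ends path e∈ v∈e)

  Path-touches : ∀ {o X u es vs t v} → Path o X u es vs t → v ∈ vs → ∃ λ e → e ∈ es × Inc v e
  Path-touches {u = u} (_∷_ {e = e} _ _) (here refl) = e , here refl , inc-other e u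
  Path-touches (_ ∷ path) (there v∈) = let e , e∈ , v∈e = Path-touches path v∈ in e , there e∈ , v∈e

  Path-target : ∀ {o X u es vs t} → Path o X u es vs t → t ∈ u ∷ vs
  Path-target []         = here refl
  Path-target (_ ∷ path) = there (Path-target path)

-- Elimination of one or two deficiencies.

module Elimination (G : Graph) (bip : Bipartite G) (k : ℕ) where
  open Graph G
  open Local G bip k
  open Walks G bip k

  -- The vertex shows that `order`, the bound on the rounds, allows one round; two different
  -- vertices guarantee two rounds in `eliminateTwo`.
  eliminateOne : ∀ {cs X Z} → Vertex → (∀ n → Z ∈ˢ eliminateUpTo G k (suc n) cs X) → Z ∈ˢ eliminateAll G k cs X
  eliminateOne {cs} {X} {Z} = lem order
    where
    lem : ∀ n → Fin n → (∀ n → Z ∈ˢ eliminateUpTo G k (suc n) cs X) → Z ∈ˢ eliminateUpTo G k n cs X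
    lem (suc n) _ Z∈ = Z∈ n

  eliminateTwo : ∀ {cs X Z} {u v : Vertex} → u ≢ v → (∀ n → Z ∈ˢ eliminateUpTo G k (suc (suc n)) cs X) →
                 Z ∈ˢ eliminateAll G k cs X
  eliminateTwo {cs} {X} {Z} = lem order
    where
    lem : ∀ n {u v : Fin n} → u ≢ v → (∀ n → Z ∈ˢ eliminateUpTo G k (suc (suc n)) cs X) →
          Z ∈ˢ eliminateUpTo G k n cs X
    lem (suc zero)    {zero} {zero} u≢v _  = contradiction refl u≢v
    lem (suc (suc n))               _   Z∈ = Z∈ n

  eliminate-proper : ∀ {cs X} n → (∀ v → Prop X v) → X ∈ˢ eliminateUpTo G k n cs X
  eliminate-proper zero    _    = ∈ˢ-return
  eliminate-proper (suc n) prop = ∈ˢ-select-none (no-deficientVertices prop) ∈ˢ-return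

  HasBoth : Ori → List K → Set
  HasBoth (a , b) cs = a ∈ cs × b ∈ cs

  HasBoth-out : ∀ {o cs} s → HasBoth o cs → out o s ∈ cs
  HasBoth-out true  = proj₁
  HasBoth-out false = proj₂

  HasBoth-in : ∀ {o cs} s → HasBoth o cs → in′ o s ∈ cs
  HasBoth-in true  = proj₂
  HasBoth-in false = proj₁

  eliminate-step : ∀ {o cs X s h g es t Z} n → Distinct o → HasBoth o cs → Hole o X s h → Out o X s g → g ≢ h →
    Trail o X s g [] es t → Z ∈ˢ eliminateUpTo G k n cs (flipₒ o (g ∷ es) X) → Z ∈ˢ eliminateUpTo G k (suc n) cs X
  eliminate-step {o} {cs} {X} {s} {h} {g} {es} {Z = Z} n o! both hole g→ g≢h trail Z∈ =
    ∈ˢ-select (∈-deficientVertices⁺ {X} (_ , _ , deficient))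
      (∈ˢ-select
        (∈-filter⁺ (hasDeficiency? G k X s)
          (∈-cartesianProduct⁺ (HasBoth-out (side s) both) (HasBoth-in (side s) both)) deficient)
        (∈ˢ->>= {f = eliminateUpTo G k n cs}
          (∈ˢ-select (∈-coloredAt⁺ {X} (proj₁ g→) (proj₂ g→))
            (∈ˢ->>= {f = λ es → return (flip G k (out o (side s)) (in′ o (side s)) es X)}
              (∈ˢ-walk g→ ([] ∷ []) trail) ∈ˢ-return))
          (subst (λ Y → Z ∈ˢ eliminateUpTo G k n cs Y) (sym (flipₒ-out (side s) (g ∷ es) X)) Z∈)))
    where
    deficient : HasDeficiency G k X s (out o (side s) , in′ o (side s))
    deficient = Hole⇒HasDeficiency o! hole g→ g≢h

  Prop⇒Regular : ∀ {o X u} → Prop X u → Regular o X u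
  Prop⇒Regular prop = Prop⇒PropOn prop

  opaque
    unfolding flipₒ

    flipₒ-op : ∀ o D X → flipₒ (op o) D X ≡ flipₒ o D X
    flipₒ-op o D X = flipₒ-out {o} false D X

  Two-op : ∀ {o X e} → Two o X e → Two (op o) X e
  Two-op (inj₁ eq) = inj₂ eq
  Two-op (inj₂ eq) = inj₁ eq

  module _ {o : Ori} (o! : Distinct o) {X : Col} {s g es t} (g→ : Out o X s g) (trail : Trail o X s g [] es t) where

    private
      X₁ = flipₒ o (g ∷ es) X

    trail-flip-prop : ∀ {u} → u ≢ s → Prop X u → Prop X₁ u
    trail-flip-prop {u} u≢s prop = PropOn⇒Prop {X₁} (closed-flip o! {X = X} {D = g ∷ es} (Prop⇒PropOn prop)
      λ u∈e u∈f _ _ → trail-closed o! g→ trail u≢s (Prop⇒Regular {o} prop) u∈e u∈f)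

    trail-flip-start : ∀ {h} → Hole o X s h → g ≢ h → Prop X₁ s
    trail-flip-start hole g≢h = hole-closes o! hole g→ g≢h (flipₒ-Out g→ (here refl)) same
      where
      same : ∀ {f} → Inc s f → f ≢ g → X₁ ! f ≡ X ! f
      same s∈f f≢g = flipₒ-∉ {o} {X} {g ∷ es} λ where
        (here f≡g) → f≢g f≡g
        (there f∈) → no-in hole (proj₁ (walk-start o! trail f∈ s∈f))

    trail-flip-end : ∀ {h r} → t ≢ s → Hole (op o) X t h → In o X t r → r ≢ h → Prop X₁ t
    trail-flip-end {h} {r} t≢s hole r← r≢h with walk-arrives o! trail (Out⇒In-other g→)
                                              | trail-sink o! g→ trail t≢s (no-in hole)
    ... | e , e∈ , e← | m , sink = hole-closes (≢-sym o!) (proj₁ (proj₂ hole′)) e← (proj₂ (proj₂ hole′))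
        (flipₒ-In {D = g ∷ es} e← e∈) same
      where
      -- The exceptional edge at t should be one that the trail did not use; the two incoming edges
      -- are interchangeable.
      hole′ : ∃ λ h → Hole (op o) X t h × e ≢ h
      hole′ with e ≟ᶠ h
      ... | yes refl = r , hole-swap (≢-sym o!) hole r← , ≢-sym r≢h
      ... | no e≢h   = h , hole , e≢h

      same : ∀ {f} → Inc t f → f ≢ e → X₁ ! f ≡ X ! f
      same t∈f f≢e = flipₒ-∉ {o} {X} λ f∈ →
        f≢e (trans (proj₂ (sink f∈ t∈f)) (sym (proj₂ (sink e∈ (proj₁ e←)))))

    trail-flip-untouched : ∀ {v} → v ≢ s → (∀ {e} → ¬ Out o X v e) → t ≢ v → ∀ {e} → Inc v e → e ∉ g ∷ es
    trail-flip-untouched v≢s no-out t≢v v∈e e∈ =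
      let m , sink = trail-sink o! g→ trail v≢s no-out in t≢v (proj₁ (sink e∈ v∈e))

  -- Unlike a hole, this is always a genuine deficiency: two incoming edges are required.
  record SinkAt (o : Ori) (X : Col) (v : Vertex) : Set where
    constructor sinkAt
    field
      {first second} : Edge
      hole           : Hole (op o) X v first
      incoming       : In o X v second
      different      : second ≢ first

  SinkAt-resp : ∀ {o X Y v} → Agree X Y v → SinkAt o X v → SinkAt o Y v
  SinkAt-resp agree (sinkAt hole (v∈r , Xr) r≢h) =
    sinkAt (Hole-resp agree hole) (v∈r , trans (sym (agree v∈r)) Xr) r≢h

  -- A coloring that is proper but for a hole at s and, possibly, a second
  -- deficiency, of the opposite type, at V.
  record Near (o : Ori) (X : Col) (s : Vertex) (h : Edge) (V : Maybe Vertex) : Set where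
    field
      hole : Hole o X s h
      prop : ∀ {u} → u ≢ s → just u ≢ V → Prop X u
      sink : ∀ {v} → V ≡ just v → v ≢ s × SinkAt o X v

  open Near public

  -- This says that t is an end vertex of the subgraph of the two colors, a property that no flip of
  -- these colors affects.
  LastAt : Ori → Col → Vertex → Set
  LastAt o X t = ∃ λ ℓ → (Inc t ℓ × Two o X ℓ) × (∀ {e} → Inc t e → Two o X e → e ≡ ℓ)

  -- The proper coloring Y arises from X by flipping the path D from the hole s
  -- and, if D does not end at the second deficiency v, a path D₀ from v.
  data Ending (o : Ori) (X Y : Col) (D : List Edge) (vs : List Vertex) (t : Vertex) : Maybe Vertex → Set where
    alone  : Y ≡ flipₒ o D X → Ending o X Y D vs t nothing
    joined : Y ≡ flipₒ o D X → Ending o X Y D vs t (just t)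
    apart  : ∀ {v r D₀ vs₀ t₀} → v ∉ vs → LastAt o X t → Path (op o) X v (r ∷ D₀) vs₀ t₀ → Unique (v ∷ vs₀) →
             LastAt o X t₀ → (∀ {e} → e ∈ D → e ∉ r ∷ D₀) → Y ≡ flipₒ o (r ∷ D₀ ++ D) X →
             Ending o X Y D vs t (just v)

  -- By `fresh`, h and the first edge of a nonempty D are two different edges at s, so s is not an
  -- end vertex of the subgraph of the two colors. This makes D an admissible choice when X is
  -- recovered from Y.
  record Config (o : Ori) (X Y : Col) (s : Vertex) (h : Edge) (D : List Edge) (V : Maybe Vertex) : Set where
    field
      near   : Near o X s h V
      proper : ∀ v → Prop Y v
      {vs}   : List Vertex
      {t}    : Vertex
      path   : Path o X s D vs t
      simple : Unique (s ∷ vs)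
      fresh  : h ∉ D
      ending : Ending o X Y D vs t V

  open Config public

  -- Only the sink may have two incoming edges, and it has no outgoing one.
  Near⇒in! : ∀ {o X s h V} → Near o X s h V → ∀ {u e} → u ≢ s → Out o X u e →
             ∀ {f g} → In o X u f → In o X u g → f ≡ g
  Near⇒in! {V = V} near {u} u≢s e→ (u∈f , Xf) (u∈g , Xg) =
    prop near u≢s (λ { refl → no-in (SinkAt.hole (proj₂ (sink near refl))) e→ }) u∈f u∈g (trans Xf (sym Xg))

  LastAt-trail : ∀ {o X s g es t} → Distinct o → Out o X s g → Trail o X s g [] es t → (∀ {e} → ¬ Out o X t e) → Prop X t →
                 LastAt o X t
  LastAt-trail {t = t} o! g→ trail no-out propₜ with walk-arrives o! trail (Out⇒In-other g→)
  ... | ℓ , _ , t∈ℓ , Xℓ = ℓ , (t∈ℓ , Two-in (side t) Xℓ) , λ t∈e two → case Two⇒ (side t) two of λ where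
    (inj₁ Xe) → contradiction (t∈e , Xe) no-out
    (inj₂ Xe) → propₜ t∈e t∈ℓ (trans Xe (sym Xℓ))

  module _ {o : Ori} (o! : Distinct o) {X s h g} (g→ : Out o X s g) (g≢h : g ≢ h) where

    Eliminated : Maybe Vertex → Set
    Eliminated V = ∃₂ λ D Y → Config o X Y s h (g ∷ D) V ×
      (∀ {cs} → HasBoth o cs → Y ∈ˢ eliminateAll G k cs X)

    private
      ∉-trail : ∀ {es t} → Hole o X s h → Trail o X s g [] es t → h ∉ g ∷ es
      ∉-trail hole trail (here h≡g) = g≢h (sym h≡g)
      ∉-trail hole trail (there h∈) = no-in hole (proj₁ (walk-start o! trail h∈ (proj₁ (outgoing hole))))

      t≢s : ∀ {es t} → Hole o X s h → Trail o X s g [] es t → t ≢ s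
      t≢s hole trail refl = let _ , _ , e← = walk-arrives o! trail (Out⇒In-other g→) in no-in hole e←

      module Apart {v} (near : Near o X s h (just v)) {es t} (trail : Trail o X s g [] es t) (t≢v : t ≢ v) where

        X₁ : Col
        X₁ = flipₒ o (g ∷ es) X

        v≢s : v ≢ s
        v≢s = proj₁ (sink near refl)

        no-out : ∀ {e} → ¬ Out o X v e
        no-out = no-in (SinkAt.hole (proj₂ (sink near refl)))

        untouched : ∀ {e} → Inc v e → e ∉ g ∷ es
        untouched = trail-flip-untouched o! g→ trail v≢s no-out t≢v

        prop₁ : ∀ {u} → u ≢ v → Prop X₁ u
        prop₁ {u} u≢v with u ≟ᶠ s
        ... | yes refl = trail-flip-start o! g→ trail (hole near) g≢h
        ... | no u≢s   = trail-flip-prop o! g→ trail u≢s (prop near u≢s λ { refl → u≢v refl })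

        two₁ : ∀ {e} → Two o X e → Two (op o) X₁ e
        two₁ two = Two-op (flipₒ-Two {D = g ∷ es} two)

        two₁⁻ : ∀ {e} → Two (op o) X₁ e → Two o X e
        two₁⁻ two = Two-flipₒ⁻ {D = g ∷ es} (Two-op two)

        op! : Distinct (op o)
        op! = ≢-sym o!

        -- The trail from v is closed at all vertices but v, which the trail from s cannot leave. A
        -- common edge would thus force all earlier edges of the trail from s into it, down to g;
        -- but it avoids s. Disjointness then allows both flips to be undone in one step.
        finish : ∀ {r h′ es₀ t₀} → Hole (op o) X₁ v h′ → Out (op o) X₁ v r → r ≢ h′ →
          Trail (op o) X₁ v r [] es₀ t₀ → (∀ {e} → e ∈ r ∷ es₀ → ¬ Inc s e) →
          Eliminated (just v)
        finish {r} {h′} {es₀} {t₀} hole₁ r→ r≢h′ trail₀ avoids =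
          let vs , path , simple , end = trail-simple o! g→ trail (no-in (hole near)) (Near⇒in! near)
              vs₀ , path₀ , simple₀ , end₀ = trail-simple op! r→ trail₀ (no-in hole₁) (λ u≢v _ → in! (prop₁ u≢v))
              last , (t₀∈last , two-last) , only = LastAt-trail op! r→ trail₀ end₀ (prop₁ (t₀≢v trail₀))
          in es , Y , record
            { near   = near
            ; proper = proper-Y
            ; path   = path
            ; simple = simple
            ; fresh  = ∉-trail (hole near) trail
            ; ending = apart
                (λ v∈ → let e , e∈ , v∈e = Path-touches path v∈ in untouched v∈e e∈)
                (LastAt-trail o! g→ trail end (prop near (t≢s (hole near) trail) λ { refl → t≢v refl }))
                (Path-resp (λ e∈ → flipₒ-∉ {o} {X} λ e∈′ → disjoint e∈′ e∈) path₀)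
                simple₀
                (last , (t₀∈last , two₁⁻ two-last) , λ t₀∈e two → only t₀∈e (two₁ two))
                disjoint
                (trans (flipₒ-op o (r ∷ es₀) X₁) (flipₒ-++ X λ e∈ e∈′ → disjoint e∈′ e∈))
            } , λ both → eliminateTwo (≢-sym v≢s) λ n →
              eliminate-step (suc n) o! both (hole near) g→ g≢h trail
                (eliminate-step n op! (proj₂ both , proj₁ both) hole₁ r→ r≢h′ trail₀ (eliminate-proper n proper-Y))
          where
          Y : Col
          Y = flipₒ (op o) (r ∷ es₀) X₁

          in! : ∀ {u} → Prop X₁ u → ∀ {f g} → In (op o) X₁ u f → In (op o) X₁ u g → f ≡ g
          in! prop (u∈f , p) (u∈g , q) = prop u∈f u∈g (trans p (sym q))

          t₀≢v : ∀ {es t} → Trail (op o) X₁ v r [] es t → t ≢ v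
          t₀≢v trail refl = let _ , _ , e← = walk-arrives op! trail (Out⇒In-other r→) in no-in hole₁ e←

          proper-Y : ∀ u → Prop Y u
          proper-Y u with u ≟ᶠ v
          ... | yes refl = trail-flip-start op! r→ trail₀ hole₁ r≢h′
          ... | no u≢v   = trail-flip-prop op! r→ trail₀ u≢v (prop₁ u≢v)

          g∉ : g ∉ r ∷ es₀
          g∉ g∈ = avoids g∈ (proj₁ g→)

          closed : ∀ {u e} → u ≢ s → Out o X u e → Closed o X (r ∷ es₀) u
          closed {u} u≢s e→ u∈e u∈f two-e two-f =
            trail-closed op! r→ trail₀ u≢v (Prop⇒Regular {op o} (prop₁ u≢v)) u∈e u∈f (two₁ two-e) (two₁ two-f)
            where
            u≢v : u ≢ v
            u≢v refl = no-out e→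

          disjoint : ∀ {e} → e ∈ g ∷ es → e ∉ r ∷ es₀
          disjoint (here refl) = g∉
          disjoint (there e∈)  = walk-disjoint o! trail closed (Out⇒In-other g→) g∉ e∈

        eliminated : Eliminated (just v)
        eliminated with SinkAt-resp (λ v∈e → sym (flipₒ-∉ {o} {X} (untouched v∈e))) (proj₂ (sink near refl))
        ... | sinkAt {h₀} {r} hole₁ r→ r≢h₀ with trail-exists (op o) X₁ v r [] ([] ∷ []) | trail-exists (op o) X₁ v h₀ [] ([] ∷ [])
        ...   | es₁ , _ , trail₁ | es₂ , _ , trail₂
          with any? (λ e → _∈?_ _≟ᶠ_ e (r ∷ es₁) ×-dec incident? G s e)
        ...     | no none = finish hole₁ r→ r≢h₀ trail₁ λ e∈ s∈e → none (_ , e∈ , s∈e)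
        -- The two trails from v are disjoint and closed, so only one of them meets s.
        ...     | yes (e , e∈ , s∈e) = finish (hole-swap op! hole₁ r→) (outgoing hole₁) (≢-sym r≢h₀) trail₂ avoids
          where
          h₀∉ : h₀ ∉ r ∷ es₁
          h₀∉ (here eq)  = r≢h₀ (sym eq)
          h₀∉ (there h₀∈) = no-in hole₁ (proj₁ (walk-start op! trail₁ h₀∈ (proj₁ (outgoing hole₁))))

          trail₁-closed : ∀ {u} → u ≢ v → Closed (op o) X₁ (r ∷ es₁) u
          trail₁-closed u≢v = trail-closed op! r→ trail₁ u≢v (Prop⇒Regular {op o} (prop₁ u≢v))

          two-trail : ∀ {r es t x} → Out (op o) X₁ v r → Trail (op o) X₁ v r [] es t → x ∈ r ∷ es → Two (op o) X₁ x
          two-trail r→ trail (here refl) = Two-out (side v) (proj₂ r→)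
          two-trail r→ trail (there x∈)  = walk-two op! trail x∈

          disjoint : ∀ {x} → x ∈ h₀ ∷ es₂ → x ∉ r ∷ es₁
          disjoint (here refl) = h₀∉
          disjoint (there x∈)  =
            walk-disjoint op! trail₂ (λ u≢v _ → trail₁-closed u≢v) (Out⇒In-other (outgoing hole₁)) h₀∉ x∈

          avoids : ∀ {x} → x ∈ h₀ ∷ es₂ → ¬ Inc s x
          avoids x∈ s∈x = disjoint x∈
            (trail₁-closed (≢-sym v≢s) s∈e s∈x (two-trail r→ trail₁ e∈) (two-trail (outgoing hole₁) trail₂ x∈) e∈)

    -- The trail through the prescribed edge g may end at the sink; then its flip repairs both
    -- deficiencies (`joined`). Otherwise it leaves the sink untouched, which is eliminated
    -- separately (`apart`).
    eliminate-near : ∀ {V} → Near o X s h V → Eliminated V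
    eliminate-near {V} near with trail-exists o X s g [] ([] ∷ [])
    ... | es , t , trail with trail-simple o! g→ trail (no-in (hole near)) (Near⇒in! near)
    ...   | vs , path , simple , _ = go-on V near
      where
      Y : Col
      Y = flipₒ o (g ∷ es) X

      single : ∀ {V} → Near o X s h V → (∀ v → Prop Y v) → Ending o X Y (g ∷ es) vs t V → Eliminated V
      single near proper-Y ending = es , Y , record
        { near = near ; proper = proper-Y ; path = path ; simple = simple
        ; fresh = ∉-trail (hole near) trail ; ending = ending
        } , λ both → eliminateOne s λ n → eliminate-step n o! both (hole near) g→ g≢h trail (eliminate-proper n proper-Y)

      start : ∀ {V} → Near o X s h V → Prop Y s
      start near = trail-flip-start o! g→ trail (hole near) g≢h

      go-on : ∀ V → Near o X s h V → Eliminated V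
      go-on nothing near = single near proper-Y (alone refl)
        where
        proper-Y : ∀ u → Prop Y u
        proper-Y u with u ≟ᶠ s
        ... | yes refl = start near
        ... | no u≢s   = trail-flip-prop o! g→ trail u≢s (prop near u≢s λ ())
      go-on (just v) near with t ≟ᶠ v
      ... | no t≢v   = Apart.eliminated near trail t≢v
      ... | yes refl = single near proper-Y (joined refl)
        where
        proper-Y : ∀ u → Prop Y u
        proper-Y u with u ≟ᶠ s | u ≟ᶠ t
        ... | yes refl | _        = start near
        ... | no u≢s   | yes refl = let v≢s , sinkAt hole₀ r← r≢h₀ = sink near refl in
                                    trail-flip-end o! g→ trail v≢s hole₀ r← r≢h₀
        ... | no u≢s   | no u≢t   = trail-flip-prop o! g→ trail u≢s (prop near u≢s λ { refl → u≢t refl })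

  other-edge? : ∀ {o X s} h → Dec (∃ λ g → Out o X s g × g ≢ h)
  other-edge? {o} {X} {s} h = any? λ g → (incident? G s g ×-dec (X ! g ≟ᶠ out o (side s))) ×-dec ¬? (g ≟ᶠ h)

  -- A hole whose only outgoing edge is h is no deficiency; then X is proper already and D is empty.
  settle : ∀ {o X s h} → Distinct o → Near o X s h nothing →
    ∃₂ λ D Y → Config o X Y s h D nothing × (∀ {cs} → HasBoth o cs → Y ∈ˢ eliminateAll G k cs X)
  settle {o} {X} {s} {h} o! near with other-edge? {o} {X} {s} h
  ... | yes (g , g→ , g≢h) = let D , Y , config , Y∈ = eliminate-near o! g→ g≢h near in g ∷ D , Y , config , Y∈
  ... | no none = [] , X , record
      { near = near ; proper = all-prop ; path = [] ; simple = [] ∷ [] ; fresh = λ ()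
      ; ending = alone (ext λ e → sym (flipₒ-∉ {o} {X} {[]} λ ()))
      } , λ _ → eliminate-proper order all-prop
    where
    only : ∀ {e} → Out o X s e → e ≡ h
    only {e} e→ with e ≟ᶠ h
    ... | yes e≡h = e≡h
    ... | no e≢h  = contradiction (e , e→ , e≢h) none

    all-prop : ∀ v → Prop X v
    all-prop v with v ≟ᶠ s
    ... | yes refl = hole-trivial o! (hole near) only
    ... | no v≢s   = prop near v≢s λ ()

-- Moving the hole along its path without changing the represented state.

module Popping (G : Graph) (bip : Bipartite G) (k : ℕ) where
  open Graph G
  open Local G bip k
  open Walks G bip k
  open Elimination G bip k

  flipₒ-split : ∀ {o g} {D E : List Edge} X → g ∉ E → (∀ {e} → e ∈ D → e ∈ g ∷ E) → (∀ {e} → e ∈ g ∷ E → e ∈ D) →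
                flipₒ o D X ≡ flipₒ o E (flipₒ o [ g ] X)
  flipₒ-split {o} {g} {D} {E} X g∉E D⊆ ⊆D = trans
    (flipₒ-cong {o} {D} {E ++ [ g ]} X (λ e∈ → to (D⊆ e∈)) (λ e∈ → ⊆D (from e∈)))
    (sym (flipₒ-++ {o} {E} {[ g ]} X (λ { e∈ (here refl) → g∉E e∈ })))
    where
    to : ∀ {e} → e ∈ g ∷ E → e ∈ E ++ [ g ]
    to (here refl) = ∈-++⁺ʳ E (here refl)
    to (there e∈)  = ∈-++⁺ˡ e∈

    from : ∀ {e} → e ∈ E ++ [ g ] → e ∈ g ∷ E
    from e∈ with ∈-++⁻ E e∈
    ... | inj₁ e∈E         = there e∈E
    ... | inj₂ (here refl) = here refl

  LastAt-flip : ∀ {o X t} D → LastAt o X t → LastAt o (flipₒ o D X) t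
  LastAt-flip {o} D (ℓ , (t∈ℓ , two) , only) =
    ℓ , (t∈ℓ , flipₒ-Two {o} {D = D} two) , λ t∈e two → only t∈e (Two-flipₒ⁻ {o} {D = D} two)

  module _ {o : Ori} (o! : Distinct o) where

    module _ {X Y s h g D V} (config : Config o X Y s h (g ∷ D) V) where

      private
        X′ : Col
        X′ = flipₒ o [ g ] X

        g→ : Out o X s g
        g→ with path config
        ... | g→ ∷ _ = g→

        s′ : Vertex
        s′ = other g s

        same : ∀ {f} → f ≢ g → X′ ! f ≡ X ! f
        same f≢g = flipₒ-∉ {o} {X} {[ g ]} λ { (here f≡g) → f≢g f≡g }

        agree : ∀ {u} → u ≢ s → u ≢ s′ → Agree X X′ u
        agree u≢s u≢s′ u∈f = sym (same λ { refl → case inc-cases (proj₁ g→) u∈f of λ where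
          (inj₁ u≡s)  → u≢s u≡s
          (inj₂ u≡s′) → u≢s′ u≡s′ })

        g∉D : g ∉ D
        g∉D g∈ with path config | simple config
        ... | _ ∷ path′ | s∉ ∷ _ = All.lookup s∉ (Path-ends path′ g∈ (proj₁ g→)) refl

        g≢h : g ≢ h
        g≢h refl = fresh config (here refl)

        near′ : just s′ ≢ V → Near o X′ s′ g V
        near′ s′≢V = record
          { hole = hole-opens o! (prop (near config) (other≢ (proj₁ g→)) s′≢V) g←
              (trans (flipₒ-Out {o} {X} {[ g ]} g→ (here refl)) (trans (sym (out-not {o} (side s))) (cong (out o) (sym (side-other (proj₁ g→))))))
              (λ _ f≢g → same f≢g)
          ; prop = λ {u} u≢s′ u≢V → case u ≟ᶠ s of λ where
              (yes refl) → hole-closes o! (hole (near config)) g→ g≢h (flipₒ-Out {o} {X} {[ g ]} g→ (here refl)) (λ _ f≢g → same f≢g)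
              (no u≢s)   → Prop-resp {X} (agree u≢s u≢s′) (prop (near config) u≢s u≢V)
          ; sink = λ where
              refl → let v≢s , sink-v = sink (near config) refl in
                ≢-sym (λ s′≡v → s′≢V (cong just s′≡v)) , SinkAt-resp (agree v≢s (λ v≡s′ → s′≢V (cong just (sym v≡s′)))) sink-v
          }
          where
          g← : In o X s′ g
          g← = Out⇒In-other g→

        pop-same : ∀ {e} → e ∉ [ g ] → X ! e ≡ X′ ! e
        pop-same e∉ = sym (flipₒ-∉ {o} {X} {[ g ]} e∉)

        split : ∀ {Y} → Y ≡ flipₒ o (g ∷ D) X → Y ≡ flipₒ o D X′
        split eq = trans eq (flipₒ-split {o} X g∉D (λ e∈ → e∈) (λ e∈ → e∈))

        module Pop {vs t} (path′ : Path o X s′ D vs t) (vs! : Unique (s′ ∷ vs)) where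

          path″ : Path o X′ s′ D vs t
          path″ = Path-resp (λ e∈ → sym (same λ { refl → g∉D e∈ })) path′

          continue : ∀ {V} → Near o X′ s′ g V → Ending o X′ Y D vs t V → Config o X′ Y s′ g D V
          continue near″ ending″ = record
            { near = near″ ; proper = proper config ; path = path″ ; simple = vs! ; fresh = g∉D ; ending = ending″ }

          stops : ∀ {D vs} → Path o X′ s′ D vs s′ → Unique (s′ ∷ vs) → D ≡ []
          stops []         _        = refl
          stops (_ ∷ path) (t∉ ∷ _) = contradiction refl (All.lookup t∉ (Path-target path))

          go-on : ∀ {V} → Ending o X Y (g ∷ D) (s′ ∷ vs) t V → (just s′ ≢ V → Near o X′ s′ g V) →
                  X′ ≡ Y ⊎ Config o X′ Y s′ g D V
          go-on (alone eq) near″ = inj₂ (continue (near″ λ ()) (alone (split eq)))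
          go-on (joined eq) near″ with s′ ≟ᶠ t
          ... | no s′≢t  = inj₂ (continue (near″ λ { refl → s′≢t refl }) (joined (split eq)))
          ... | yes refl with stops path″ vs!
          ...   | refl = inj₁ (sym eq)
          go-on (apart {v} {r} {D₀} v∉ last path₀ simple₀ last₀ disjoint eq) near″ = inj₂ (continue
            (near″ λ { refl → v∉ (here refl) })
            (apart (v∉ ∘ there) (LastAt-flip [ g ] last)
              (Path-resp (λ e∈ → pop-same λ { (here refl) → disjoint (here refl) e∈ }) path₀) simple₀
              (LastAt-flip [ g ] last₀) (disjoint ∘ there)
              (trans eq (flipₒ-split {o} {g} {r ∷ D₀ ++ g ∷ D} {r ∷ D₀ ++ D} X g∉ to from))))
            where
            g∉ : g ∉ r ∷ D₀ ++ D
            g∉ g∈ with ∈-++⁻ (r ∷ D₀) g∈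
            ... | inj₁ g∈D₀ = disjoint (here refl) g∈D₀
            ... | inj₂ g∈D  = g∉D g∈D

            to : ∀ {e} → e ∈ (r ∷ D₀) ++ g ∷ D → e ∈ g ∷ (r ∷ D₀) ++ D
            to e∈ with ∈-++⁻ (r ∷ D₀) e∈
            ... | inj₁ e∈D₀        = there (∈-++⁺ˡ e∈D₀)
            ... | inj₂ (here eq)   = here eq
            ... | inj₂ (there e∈D) = there (∈-++⁺ʳ (r ∷ D₀) e∈D)

            from : ∀ {e} → e ∈ g ∷ (r ∷ D₀) ++ D → e ∈ (r ∷ D₀) ++ g ∷ D
            from (here eq) = ∈-++⁺ʳ (r ∷ D₀) (here eq)
            from (there e∈) with ∈-++⁻ (r ∷ D₀) e∈
            ... | inj₁ e∈D₀ = ∈-++⁺ˡ e∈D₀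
            ... | inj₂ e∈D  = ∈-++⁺ʳ (r ∷ D₀) (there e∈D)

      -- Reversing g closes the hole at s and opens one at the other end of g, with g in the role of
      -- h; the rest of the path leads from there to the same Y. Only at the sink no hole opens.
      -- There the path ends, so X′ is Y itself.
      pop : X′ ≡ Y ⊎ Config o X′ Y s′ g D V
      pop = from-path (path config) (simple config) (ending config)
        where
        from-path : ∀ {vs t} → Path o X s (g ∷ D) vs t → Unique (s ∷ vs) → Ending o X Y (g ∷ D) vs t V →
                    X′ ≡ Y ⊎ Config o X′ Y s′ g D V
        from-path (_ ∷ path′) (_ ∷ vs!) ending₀ = Pop.go-on path′ vs! ending₀ near′
    config-alone-done : ∀ {X Y s h} → Config o X Y s h [] nothing → X ≡ Y
    config-alone-done {X} config with ending config
    ... | alone refl = ext λ e → sym (flipₒ-∉ {o} {X} {[]} λ ())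

    -- With an empty path from s, `joined` means that s is v. In the case `apart`, s is itself the
    -- end vertex of the path and has a single edge of the two colors, so the hole is trivial.
    config-prop : ∀ {X Y s h v} → Config o X Y s h [] (just v) → ∀ {u} → u ≢ v → Prop X u
    config-prop {X} {Y} {s} {h} {v} config {u} u≢v with u ≟ᶠ s
    ... | no u≢s   = prop (near config) u≢s λ { refl → u≢v refl }
    ... | yes refl with path config | ending config
    ...   | [] | joined _ = contradiction refl u≢v
    ...   | [] | apart _ (ℓ , _ , only) _ _ _ _ _ = hole-trivial o! (hole (near config)) λ (s∈e , Xe) →
      let s∈h , Xh = outgoing (hole (near config)) in
      trans (only s∈e (Two-out (side s) Xe)) (sym (only s∈h (Two-out (side s) Xh)))

-- Exchanging an edge of the deficiency by a flip with a third color.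

module Rotation (G : Graph) (bip : Bipartite G) (k : ℕ) where
  open Graph G
  open Local G bip k
  open Walks G bip k
  open Elimination G bip k

  walkThrough-stops : ∀ {o X s g es t} → Out o X s g → Trail o X s g [] es t →
    (∀ {e} → In o X s e → e ∈ g ∷ es) → (g ∷ es) ∈ˢ walkThrough G k X s g (out o (side s)) (in′ o (side s))
  walkThrough-stops {o} {X} {s} {g} {es} g→ trail all-in =
    ∈ˢ->>= {f = λ es → select (available G k X es s b) (λ f → walk G k X s f es b a >>= λ fs → return (es ++ fs)) (return es)}
      (∈ˢ-walk g→ ([] ∷ []) trail)
      (∈ˢ-select-none (λ e e∈ → let e← , e∉ = ∈-available⁻ {X} e∈ in e∉ (all-in e←)) ∈ˢ-return)
    where
    a b : K
    a = out o (side s)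
    b = in′ o (side s)

  walkThrough-continues : ∀ {o X s g es t f fs t′} → Distinct o → Out o X s g → Trail o X s g [] es t →
    In o X s f → f ∉ g ∷ es → Trail (op o) X s f (g ∷ es) fs t′ →
    (g ∷ es ++ f ∷ fs) ∈ˢ walkThrough G k X s g (out o (side s)) (in′ o (side s))
  walkThrough-continues {o} {X} {s} {g} {es} {f = f} {fs} o! g→ trail f← f∉ trail′ =
    ∈ˢ->>= {f = λ es → select (available G k X es s b) (λ f → walk G k X s f es b a >>= λ fs → return (es ++ fs)) (return es)}
      (∈ˢ-walk g→ ([] ∷ []) trail)
      (∈ˢ-select (∈-available⁺ {X} (proj₁ f←) (proj₂ f←) f∉)
        (∈ˢ->>= {f = λ fs → return (g ∷ es ++ fs)} (∈ˢ-walk f← unique trail′) ∈ˢ-return))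
    where
    a b : K
    a = out o (side s)
    b = in′ o (side s)

    unique : Unique (f ∷ g ∷ es)
    unique = All.tabulate (λ { x∈ refl → f∉ x∈ })
           ∷ All.tabulate (λ { x∈ refl → walk-fresh o! trail x∈ (here refl) })
           ∷ walk-Unique o! trail

  opaque
    unfolding _!_

    ∈-repeatedAt : ∀ {o X s h g r} → Distinct o → Hole o X s h → Out o X s g → g ≢ h → Out o X s r →
      r ∈ repeatedAt G k X s
    ∈-repeatedAt {X = X} {s} {r = r} o! hole g→ g≢h (s∈r , Xr) =
      ∈-filter⁺ (λ e → 2 ≤? length (coloredAt G k X s (lookup X e))) (∈-filter⁺ (incident? G s) (∈-allFin r) s∈r)
        (subst (λ c → 2 ≤ length (coloredAt G k X s c)) (sym Xr)
          (ℕₚ.≤-reflexive (sym (proj₁ (Hole⇒HasDeficiency {X = X} o! hole g→ g≢h)))))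

    -- Here o describes the deficiency at s and o₂ the two colors that are flipped. They share the
    -- repeated color, and the other color of o₂ at s is the distinguished one.
    ∈ˢ-perturbDeficient : ∀ {o o₂ X s h g r es} {c c′ : K} → Distinct o → Hole o X s h → Out o X s g → g ≢ h →
      out o₂ (side s) ≡ out o (side s) → Out o X s r → es ∈ˢ walkThrough G k X s r (out o₂ (side s)) (in′ o₂ (side s)) →
      flipₒ o₂ es X ∈ˢ ThreeColors.perturbDeficient G k (in′ o₂ (side s)) c c′ X s
    ∈ˢ-perturbDeficient {o} {o₂} {X} {s} {r = r} {es} o! hole g→ g≢h same r→ es∈ =
      ∈ˢ-select (∈-repeatedAt {X = X} o! hole g→ g≢h r→)
        (∈ˢ->>= {f = λ es → return (flip G k (lookup X r) b es X)}
          (subst (λ c → es ∈ˢ walkThrough G k X s r c b) (trans same (sym (proj₂ r→))) es∈)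
          (subst (_∈ˢ return (flip G k (lookup X r) b es X))
            (trans (cong (λ c → flip G k c b es X) (trans (proj₂ r→) (sym same))) (flipₒ-out {o₂} (side s) es X)) ∈ˢ-return))
      where
      b : K
      b = in′ o₂ (side s)

  -- The edges of X of the two colors at the hole w are those of o₂; flipping the
  -- walk through one of the two outgoing edges makes the incoming edge outgoing.
  module _ {o o₂ : Ori} (o! : Distinct o) (o₂! : Distinct o₂) {X w h g V} (near : Near o X w h V)
           (g→ : Out o X w g) (g≢h : g ≢ h)
           (same-out : out o₂ (side w) ≡ out o (side w)) (new-in : in′ o₂ (side w) ≢ in′ o (side w))
           (same-side : ∀ {v} → V ≡ just v → side v ≡ side w) where

    private
      op₂! : Distinct (op o₂)
      op₂! = ≢-sym o₂!

      to₂ : ∀ {e} → Out o X w e → Out o₂ X w e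
      to₂ (w∈e , Xe) = w∈e , trans Xe (sym same-out)

      two₂≢in : ∀ {Z e} → Two o₂ Z e → Z ! e ≢ in′ o (side w)
      two₂≢in two Ze with Two⇒ (side w) two
      ... | inj₁ eq = out≢in o! (side w) (trans (sym same-out) (trans (sym eq) Ze))
      ... | inj₂ eq = new-in (trans (sym eq) Ze)

      -- As v is on the side of w, an outgoing edge of o₂ at v would have the very color that is
      -- absent at the sink.
      no-out₂ : ∀ {v} → V ≡ just v → ∀ {e} → ¬ Out o₂ X v e
      no-out₂ {v} V≡ (v∈e , Xe) = no-in (SinkAt.hole (proj₂ (sink near V≡)))
        (v∈e , trans Xe (trans (cong (out o₂) (same-side V≡)) (trans same-out (cong (out o) (sym (same-side V≡))))))

      -- The color repeated at the sink is not one of o₂, so the sink is no exception.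
      regular₂ : ∀ {u} → u ≢ w → Regular o₂ X u
      regular₂ {u} u≢w = by-cases V refl
        where
        by-cases : ∀ W → V ≡ W → Regular o₂ X u
        by-cases nothing  V≡ = Prop⇒Regular {o₂} (prop near u≢w λ eq → case trans eq V≡ of λ ())
        by-cases (just v) V≡ with u ≟ᶠ v
        ... | no u≢v   = Prop⇒Regular {o₂} (prop near u≢w λ eq → case trans eq V≡ of λ { refl → u≢v refl })
        ... | yes refl = λ u∈e u∈f two-e two-f eq → off hole₀ u∈e u∈f (≢first two-e) (≢first two-f) eq
          where
          hole₀ = SinkAt.hole (proj₂ (sink near V≡))

          ≢first : ∀ {e} → Two o₂ X e → e ≢ SinkAt.first (proj₂ (sink near V≡))
          ≢first two refl = two₂≢in two (trans (proj₂ (outgoing hole₀)) (cong (in′ o) (same-side V≡)))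

      closed₂ : ∀ {r es t} → Out o X w r → Trail o₂ X w r [] es t → ∀ {u} → u ≢ w → Closed o₂ X (r ∷ es) u
      closed₂ r→ trail u≢w = trail-closed o₂! (to₂ r→) trail u≢w (regular₂ u≢w)

      Closed-op : ∀ {D u} → Closed o₂ X D u → Closed (op o₂) X D u
      Closed-op closed u∈e u∈f two-e two-f = closed u∈e u∈f (Two-op two-e) (Two-op two-f)

    record Rotated (c c′ : K) (e′ : Edge) : Set where
      field
        {W}      : List Edge
        {h′}     : Edge
        possible : flipₒ o₂ W X ∈ˢ ThreeColors.perturbDeficient G k (in′ o₂ (side w)) c c′ X w
        near′    : Near o (flipₒ o₂ W X) w h′ V
        out′     : Out o (flipₒ o₂ W X) w e′
        e′≢h′    : e′ ≢ h′

    module _ {c c′ : K} {e′} (e′← : In o₂ X w e′) where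

      private
        module Pair {h₁ h₂} (h₁→ : Out o X w h₁) (hole₂ : Hole o X w h₂) (h₁≢h₂ : h₁ ≢ h₂) where

          e′≢ : ∀ {r} → Out o X w r → e′ ≢ r
          e′≢ r→ refl = Out-In-⊥ o₂! (to₂ r→) e′←

          e′-only : ∀ {e} → In o₂ X w e → e ≡ e′
          e′-only {e} e←@(w∈e , Xe) = off hole₂ w∈e (proj₁ e′←)
            (λ { refl → Out-In-⊥ o₂! (to₂ (outgoing hole₂)) e← }) (e′≢ (outgoing hole₂)) (trans Xe (sym (proj₂ e′←)))

          -- Flipping W exchanges the colors of h₁ and e′ at w while h₂ keeps its color, so that e′
          -- and h₂ are now the two edges of the deficiency. At every other vertex W is closed.
          rotated : ∀ {W} → W ∈ˢ walkThrough G k X w h₁ (out o₂ (side w)) (in′ o₂ (side w)) →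
            h₁ ∈ W → h₂ ∉ W → e′ ∈ W → (∀ {u} → u ≢ w → Closed o₂ X W u) →
            (∀ {v e} → V ≡ just v → Inc v e → e ∉ W) → Rotated c c′ e′
          rotated {W} W∈ h₁∈ h₂∉ e′∈ closed untouched = record
            { W        = W
            ; h′       = h₂
            ; possible = ∈ˢ-perturbDeficient {o} {o₂} {c = c} {c′} o! (hole near) g→ g≢h same-out h₁→ W∈
            ; near′    = record
              { hole = record
                { outgoing = proj₁ (outgoing hole₂) , trans (flipₒ-∉ {o₂} {X} {W} h₂∉) (proj₂ (outgoing hole₂))
                ; no-in    = λ {e} (w∈e , X′e) → case two? e of λ where
                    (yes two) → two₂≢in (flipₒ-Two {o₂} {X} {W} two) X′e
                    (no ¬two) → no-in hole₂ (w∈e , trans (sym (¬Two⇒flipₒ {o₂} {X} {W} ¬two)) X′e)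
                ; off      = closed-flip o₂! {X = X} {D = W} (off hole₂) λ _ w∈f _ f≢h₂ _ two-f _ → case Two⇒ (side w) two-f of λ where
                    (inj₁ Xf) → subst (_∈ W) (sym (off hole₂ w∈f (proj₁ h₁→) f≢h₂ h₁≢h₂ (trans Xf (trans same-out (sym (proj₂ h₁→)))))) h₁∈
                    (inj₂ Xf) → subst (_∈ W) (sym (e′-only (w∈f , Xf))) e′∈
                }
              ; prop = λ u≢w u≢V → PropOn⇒Prop {flipₒ o₂ W X} (closed-flip o₂! {X = X} {D = W} (Prop⇒PropOn (prop near u≢w u≢V))
                  λ u∈e u∈f _ _ → closed u≢w u∈e u∈f)
              ; sink = λ V≡ → let v≢w , sink-v = sink near V≡ in
                  v≢w , SinkAt-resp (λ v∈e → sym (flipₒ-∉ {o₂} {X} {W} (untouched V≡ v∈e))) sink-v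
              }
            ; out′     = proj₁ e′← , trans (flipₒ-In {o₂} {X} {W} e′← e′∈) same-out
            ; e′≢h′    = e′≢ (outgoing hole₂)
            }
            where
            two? : ∀ e → Dec (Two o₂ X e)
            two? e = (X ! e ≟ᶠ proj₁ o₂) ⊎-dec (X ! e ≟ᶠ proj₂ o₂)

          h₂∉trail : ∀ {es t} → Trail o₂ X w h₁ [] es t → h₂ ∉ h₁ ∷ es
          h₂∉trail trail (here eq)  = h₁≢h₂ (sym eq)
          h₂∉trail trail (there h₂∈) =
            Out-In-⊥ o₂! (to₂ (outgoing hole₂)) (proj₁ (walk-start o₂! trail h₂∈ (proj₁ (outgoing hole₂))))

          -- The trail through h₁ has come back to w by e′, so there is nothing to add in the other
          -- direction. It ends at w and thus misses v, which it could meet only as its end.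
          closes : ∀ {es t} → Trail o₂ X w h₁ [] es t → e′ ∈ h₁ ∷ es → Rotated c c′ e′
          closes trail (here eq) = contradiction eq (e′≢ h₁→)
          closes {es} {t} trail (there e′∈) = rotated
            (walkThrough-stops (to₂ h₁→) trail (λ e← → subst (_∈ h₁ ∷ es) (sym (e′-only e←)) (there e′∈)))
            (here refl) (h₂∉trail trail) (there e′∈) (closed₂ h₁→ trail) untouched
            where
            untouched : ∀ {v e} → V ≡ just v → Inc v e → e ∉ h₁ ∷ es
            untouched V≡ = trail-flip-untouched o₂! (to₂ h₁→) trail v≢w (no-out₂ V≡) λ t≡v →
              v≢w (trans (sym t≡v) (proj₂ (walk-start o₂! trail e′∈ (proj₁ e′←))))
              where v≢w = proj₁ (sink near V≡)

          -- The walk consists of the trail through h₁ and a trail through e′ in the reversed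
          -- orientation. The second part misses h₂, because the trail through h₂ is closed away
          -- from w and does not contain e′. It also misses v, which cannot be entered in the
          -- reversed orientation. So v has to be kept off the first part only.
          opens : ∀ {es₁ t₁ es₂ t₂} → Trail o₂ X w h₁ [] es₁ t₁ → Trail o₂ X w h₂ [] es₂ t₂ →
            e′ ∉ h₁ ∷ es₁ → e′ ∉ h₂ ∷ es₂ → (∀ {v e} → V ≡ just v → Inc v e → e ∉ h₁ ∷ es₁) → Rotated c c′ e′
          opens {es₁} {es₂ = es₂} trail₁ trail₂ e′∉₁ e′∉₂ untouched₁ = continue (trail-exists (op o₂) X w e′ T₁ unique)
            where
            T₁ : List Edge
            T₁ = h₁ ∷ es₁

            unique : Unique (e′ ∷ T₁)
            unique = All.tabulate (λ { x∈ refl → e′∉₁ x∈ })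
                   ∷ All.tabulate (λ { x∈ refl → walk-fresh o₂! trail₁ x∈ (here refl) })
                   ∷ walk-Unique o₂! trail₁

            w″ : Vertex
            w″ = other e′ w

            initially : ∀ {u} → u ≢ w → u ≢ w″ → Regular (op o₂) X u → Closed (op o₂) X (e′ ∷ T₁) u
            initially u≢w u≢w″ _ u∈e u∈f two-e two-f (there e∈) =
              there (closed₂ h₁→ trail₁ u≢w u∈e u∈f (Two-op two-e) (Two-op two-f) e∈)
            initially u≢w u≢w″ _ u∈e u∈f two-e two-f (here refl) with inc-cases (proj₁ e′←) u∈e
            ... | inj₁ u≡w  = contradiction u≡w u≢w
            ... | inj₂ u≡w″ = contradiction u≡w″ u≢w″

            continue : (∃₂ λ fs t → Trail (op o₂) X w e′ T₁ fs t) → Rotated c c′ e′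
            continue (fs , t , trail) = rotated
              (walkThrough-continues o₂! (to₂ h₁→) trail₁ e′← e′∉₁ trail)
              (here refl) h₂∉ (∈-++⁺ʳ T₁ (here refl)) closed untouched
              where
              W : List Edge
              W = T₁ ++ e′ ∷ fs

              to : ∀ {e} → e ∈ W → e ∈ fs ++ e′ ∷ T₁
              to e∈ with ∈-++⁻ T₁ e∈
              ... | inj₁ e∈T₁        = ∈-++⁺ʳ fs (there e∈T₁)
              ... | inj₂ (here eq)   = ∈-++⁺ʳ fs (here eq)
              ... | inj₂ (there e∈fs) = ∈-++⁺ˡ e∈fs

              from : ∀ {e} → e ∈ fs ++ e′ ∷ T₁ → e ∈ W
              from e∈ with ∈-++⁻ fs e∈
              ... | inj₁ e∈fs         = ∈-++⁺ʳ T₁ (there e∈fs)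
              ... | inj₂ (here eq)    = ∈-++⁺ʳ T₁ (here eq)
              ... | inj₂ (there e∈T₁) = ∈-++⁺ˡ e∈T₁

              closed : ∀ {u} → u ≢ w → Closed o₂ X W u
              closed u≢w u∈e u∈f two-e two-f e∈ = from (walk-closed op₂! trail initially (here refl)
                (Out⇒In-other {op o₂} e′←) u≢w (λ u∈x u∈y two-x two-y → regular₂ u≢w u∈x u∈y (Two-op two-x) (Two-op two-y))
                u∈e u∈f (Two-op two-e) (Two-op two-f) (to e∈))

              h₂∉ : h₂ ∉ W
              h₂∉ h₂∈ with ∈-++⁻ T₁ h₂∈
              ... | inj₁ h₂∈T₁        = h₂∉trail trail₁ h₂∈T₁
              ... | inj₂ (here eq)    = e′≢ (outgoing hole₂) (sym eq)
              ... | inj₂ (there h₂∈fs) = walk-disjoint op₂! trail (λ u≢w _ → Closed-op {h₂ ∷ es₂} (closed₂ (outgoing hole₂) trail₂ u≢w))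
                (Out⇒In-other {op o₂} e′←) e′∉₂ h₂∈fs (here refl)

              untouched : ∀ {v e} → V ≡ just v → Inc v e → e ∉ W
              untouched V≡ v∈e e∈ with ∈-++⁻ T₁ e∈
              ... | inj₁ e∈T₁         = untouched₁ V≡ v∈e e∈T₁
              ... | inj₂ (there e∈fs) = walk-avoids-source op₂! trail (Out⇒In-other {op o₂} e′←) (no-out₂ V≡) e∈fs v∈e
              ... | inj₂ (here refl) with inc-cases (proj₁ e′←) v∈e
              ...   | inj₁ v≡w  = proj₁ (sink near V≡) v≡w
              ...   | inj₂ refl = no-out₂ V≡ (In⇒Out-other e′←)

      -- Either edge of the deficiency may start the walk: one whose trail returns by e′ is taken if
      -- there is any, and otherwise one whose trail misses the sink.
      rotate : Rotated c c′ e′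
      rotate with trail-exists o₂ X w g [] ([] ∷ []) | trail-exists o₂ X w h [] ([] ∷ [])
      ... | es₁ , _ , trail₁ | es₂ , _ , trail₂ with _∈?_ _≟ᶠ_ e′ (g ∷ es₁) | _∈?_ _≟ᶠ_ e′ (h ∷ es₂)
      ...   | yes e′∈ | _       = Pair.closes g→ (hole near) g≢h trail₁ e′∈
      ...   | no _    | yes e′∈ = Pair.closes (outgoing (hole near)) (hole-swap o! (hole near) g→) (≢-sym g≢h) trail₂ e′∈
      ...   | no e′∉₁ | no e′∉₂ = by-cases V refl
        where
        by-cases : ∀ U → V ≡ U → Rotated c c′ e′
        by-cases nothing V≡ =
          Pair.opens g→ (hole near) g≢h trail₁ trail₂ e′∉₁ e′∉₂ λ V≡′ → case trans (sym V≡) V≡′ of λ ()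
        by-cases (just v) V≡ with any? (λ e → _∈?_ _≟ᶠ_ e (g ∷ es₁) ×-dec incident? G v e)
        ... | no none = Pair.opens g→ (hole near) g≢h trail₁ trail₂ e′∉₁ e′∉₂ λ V≡′ v∈e e∈ →
          case trans (sym V≡) V≡′ of λ { refl → none (_ , e∈ , v∈e) }
        -- At v there is only one edge of o₂, so it is not on both trails.
        ... | yes (x , x∈ , v∈x) =
          Pair.opens (outgoing (hole near)) (hole-swap o! (hole near) g→) (≢-sym g≢h) trail₂ trail₁ e′∉₂ e′∉₁ untouched
          where
          h∉₁ : h ∉ g ∷ es₁
          h∉₁ = Pair.h₂∉trail g→ (hole near) g≢h trail₁

          disjoint : ∀ {e} → e ∈ h ∷ es₂ → e ∉ g ∷ es₁
          disjoint (here refl) = h∉₁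
          disjoint (there e∈)  = walk-disjoint o₂! trail₂ (λ u≢w _ → closed₂ g→ trail₁ u≢w)
            (Out⇒In-other (to₂ (outgoing (hole near)))) h∉₁ e∈

          two-trail : ∀ {r es t e} → Out o X w r → Trail o₂ X w r [] es t → e ∈ r ∷ es → Two o₂ X e
          two-trail r→ trail (here refl) = Two-out (side w) (proj₂ (to₂ r→))
          two-trail r→ trail (there e∈)  = walk-two o₂! trail e∈

          untouched : ∀ {u e} → V ≡ just u → Inc u e → e ∉ h ∷ es₂
          untouched V≡′ u∈e e∈ with trans (sym V≡) V≡′
          ... | refl = disjoint e∈ (closed₂ g→ trail₁ (proj₁ (sink near V≡)) v∈x u∈e (two-trail g→ trail₁ x∈)
                                     (two-trail (outgoing (hole near)) trail₂ e∈) x∈)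

  -- If the distinguished color is missing at w, then w has a deficiency with respect to o₂ as well,
  -- and the flip through g eliminates it.
  rotate-missing : ∀ {o o₂ X w h g} {c c′ : K} → Distinct o → Distinct o₂ → Near o X w h nothing → Out o X w g → g ≢ h →
    out o₂ (side w) ≡ out o (side w) → (∀ {e} → ¬ In o₂ X w e) →
    ∃ λ W → flipₒ o₂ W X ∈ˢ ThreeColors.perturbDeficient G k (in′ o₂ (side w)) c c′ X w × (∀ u → Prop (flipₒ o₂ W X) u)
  rotate-missing {o} {o₂} {X} {w} {h} {g} {c} {c′} o! o₂! near g→ g≢h same-out no-in₂ with trail-exists o₂ X w g [] ([] ∷ [])
  ... | es , _ , trail = g ∷ es
    , ∈ˢ-perturbDeficient {o} {o₂} {c = c} {c′} o! (hole near) g→ g≢h same-out g→ (walkThrough-stops g→₂ trail λ e← → contradiction e← no-in₂)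
    , all-prop
    where
    g→₂ : Out o₂ X w g
    g→₂ = proj₁ g→ , trans (proj₂ g→) (sym same-out)

    hole₂ : Hole o₂ X w h
    hole₂ = record
      { outgoing = let w∈h , Xh = outgoing (hole near) in w∈h , trans Xh (sym same-out)
      ; no-in    = no-in₂
      ; off      = off (hole near)
      }

    all-prop : ∀ u → Prop (flipₒ o₂ (g ∷ es) X) u
    all-prop u with u ≟ᶠ w
    ... | yes refl = trail-flip-start o₂! g→₂ trail hole₂ g≢h
    ... | no u≢w   = trail-flip-prop o₂! g→₂ trail u≢w (prop near u≢w λ ())

-- Recovering the almost coloring by the initial flip of a step.

module Undoing (G : Graph) (bip : Bipartite G) (k : ℕ) where
  open Graph G
  open Local G bip k
  open Walks G bip k
  open Elimination G bip k

  -- Colors and directions are dropped because a sub-path is listed only from its smaller to its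
  -- larger end vertex, so the path may have to be reversed.
  data Route : Vertex → List Edge → List Vertex → Vertex → Set where
    []  : ∀ {u} → Route u [] [] u
    _∷_ : ∀ {u e es vs t} → Inc u e → Route (other e u) es vs t → Route u (e ∷ es) (other e u ∷ vs) t

  Path⇒Route : ∀ {o X u es vs t} → Path o X u es vs t → Route u es vs t
  Path⇒Route []          = []
  Path⇒Route (e→ ∷ path) = proj₁ e→ ∷ Path⇒Route path

  Path-two : ∀ {o X u es vs t e} → Path o X u es vs t → e ∈ es → Two o X e
  Path-two {u = u} (e→ ∷ _) (here refl) = Two-out (side u) (proj₂ e→)
  Path-two (_ ∷ path)       (there e∈)  = Path-two path e∈

  Path-head : ∀ {o X u e es vs t} → Path o X u (e ∷ es) vs t → Out o X u e
  Path-head (e→ ∷ _) = e→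

  Route-length : ∀ {u es vs t} → Route u es vs t → length es ≡ length vs
  Route-length []          = refl
  Route-length (_ ∷ route) = cong suc (Route-length route)

  Route-target : ∀ {u es vs t} → Route u es vs t → t ∈ u ∷ vs
  Route-target []          = here refl
  Route-target (_ ∷ route) = there (Route-target route)

  Route-∷ʳ : ∀ {u es vs t e} → Route u es vs t → Inc t e → Route u (es ++ [ e ]) (vs ++ [ other e t ]) (other e t)
  Route-∷ʳ []            t∈e = t∈e ∷ []
  Route-∷ʳ (u∈ ∷ route) t∈e = u∈ ∷ Route-∷ʳ route t∈e

  Reversed : Vertex → List Edge → List Vertex → Vertex → Set
  Reversed u es vs t = ∃₂ λ es′ vs′ → Route t es′ vs′ u × Unique (t ∷ vs′) × (∀ {v} → v ∈ t ∷ vs′ → v ∈ u ∷ vs) ×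
    (∀ {e} → e ∈ es → e ∈ es′) × (∀ {e} → e ∈ es′ → e ∈ es)

  Route-reverse : ∀ {u es vs t} → Route u es vs t → Unique (u ∷ vs) → Reversed u es vs t
  Route-reverse [] u! = [] , [] , [] , u! , (λ v∈ → v∈) , (λ e∈ → e∈) , (λ e∈ → e∈)
  Route-reverse {u} {e ∷ es} {_ ∷ vs} {t} (u∈e ∷ route) (u∉ ∷ vs!) with Route-reverse route vs!
  ... | es′ , vs′ , route′ , vs′! , vs′⊆ , es⊆ , es′⊆ =
    es′ ++ [ e ] , vs′ ++ [ u ]
    , subst (λ v → Route t (es′ ++ [ e ]) (vs′ ++ [ v ]) v) (other-other u∈e) (Route-∷ʳ route′ (inc-other e u))
    , Unique-++⁺ vs′! ([] ∷ []) (λ { (v∈ , here refl) → All.lookup u∉ (vs′⊆ v∈) refl })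
    , vertices⊆
    , (λ { (here refl) → ∈-++⁺ʳ es′ (here refl) ; (there e∈) → ∈-++⁺ˡ (es⊆ e∈) })
    , edges⊆
    where
    vertices⊆ : ∀ {v} → v ∈ t ∷ vs′ ++ [ u ] → v ∈ u ∷ other e u ∷ vs
    vertices⊆ v∈ with ∈-++⁻ (t ∷ vs′) v∈
    ... | inj₁ v∈vs′       = there (vs′⊆ v∈vs′)
    ... | inj₂ (here refl) = here refl

    edges⊆ : ∀ {f} → f ∈ es′ ++ [ e ] → f ∈ e ∷ es
    edges⊆ f∈ with ∈-++⁻ es′ f∈
    ... | inj₁ f∈es′       = there (es′⊆ f∈es′)
    ... | inj₂ (here refl) = here refl

  module _ (H : List Edge) where

    ∈-pathsFrom : ∀ {u es vs t} n visited → Route u es vs t → (∀ {e} → e ∈ es → e ∈ H) → Unique vs →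
                  (∀ {v} → v ∈ vs → v ∉ visited) → length es ≤ n → (es , t) ∈ pathsFrom G H n visited u
    ∈-pathsFrom zero    visited []            _  _         _   _         = here refl
    ∈-pathsFrom (suc n) visited []            _  _         _   _         = here refl
    ∈-pathsFrom {u} (suc n) visited (_∷_ {e = e} u∈e route) ⊆H (w∉ ∷ vs!) new (s≤s len) = there
      (∈-concatMap⁺ _ (lose
        (∈-filter⁺ (λ e → ¬? (_∈?_ _≟ᶠ_ (otherEnd G e u) visited)) (∈-filter⁺ (incident? G u) (⊆H (here refl)) u∈e) (new (here refl)))
        (∈-map⁺ _ (∈-pathsFrom n (other e u ∷ visited) route (⊆H ∘ there) vs!
          (λ { v∈ (here refl) → All.lookup w∉ v∈ refl ; v∈ (there v∈′) → new (there v∈) v∈′ }) len))))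

    SubPathBetween : Vertex → List Edge → Vertex → SubPath G H → Set
    SubPathBetween u es t (a , es′ , b) =
      ((a ≡ u × b ≡ t) ⊎ (a ≡ t × b ≡ u)) × (∀ {e} → e ∈ es → e ∈ es′) × (∀ {e} → e ∈ es′ → e ∈ es)

    private
      directed : ∀ {u es vs t} → Route u es vs t → Unique (u ∷ vs) → (∀ {e} → e ∈ es → e ∈ H) → u <ᶠ t →
                 (u , es , t) ∈ subPaths G H
      directed {u} {es} {vs} route (u∉ ∷ vs!) ⊆H u<t = ∈-filter⁺ (λ (u , _ , t) → u <ᶠ? t)
        (∈-concatMap⁺ (λ u → map (u ,_) (pathsFrom G H order [ u ] u)) (lose (∈-allFin u)
          (∈-map⁺ (u ,_) (∈-pathsFrom order [ u ] route ⊆H vs! (λ { v∈ (here refl) → All.lookup u∉ v∈ refl })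
            (ℕₚ.<⇒≤ (subst (_≤ order) (cong suc (sym (Route-length route))) bound)))))) u<t
        where
        bound : length (u ∷ vs) ≤ order
        bound = subst (length (u ∷ vs) ≤_) (length-tabulate {n = order} (λ v → v))
                  (Unique-length-≤ (u∉ ∷ vs!) λ {v} _ → ∈-allFin v)

    ∈-subPaths : ∀ {u e es vs t} → Route u (e ∷ es) vs t → Unique (u ∷ vs) → (∀ {f} → f ∈ e ∷ es → f ∈ H) →
                 ∃ λ P → P ∈ subPaths G H × SubPathBetween u (e ∷ es) t P
    ∈-subPaths {u} {e} {es} {vs} {t} route vs! ⊆H with <ᶠ-cmp u t
    ... | tri< u<t _ _ = (u , e ∷ es , t) , directed route vs! ⊆H u<t , inj₁ (refl , refl) , (λ e∈ → e∈) , (λ e∈ → e∈)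
    ... | tri≈ _ refl _ = contradiction refl (All.lookup (head vs!) (target route))
      where
      head : Unique (u ∷ vs) → All (u ≢_) vs
      head (u∉ ∷ _) = u∉

      target : ∀ {t} → Route u (e ∷ es) vs t → t ∈ vs
      target (_ ∷ route) = Route-target route
    ... | tri> _ _ t<u with Route-reverse route vs!
    ...   | es′ , vs′ , route′ , vs′! , _ , es⊆ , es′⊆ =
      (t , es′ , u) , directed route′ vs′! (⊆H ∘ es′⊆) t<u , inj₂ (refl , refl) , es⊆ , es′⊆

  Matches : Ori → K → K → Set
  Matches (a , b) c c′ = (c ≡ a × c′ ≡ b) ⊎ (c ≡ b × c′ ≡ a)

  opaque
    unfolding flipₒ

    flip-matches : ∀ {o c c′} → Matches o c c′ → ∀ D X → flip G k c c′ D X ≡ flipₒ o D X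
    flip-matches     (inj₁ (refl , refl)) D X = refl
    flip-matches {o} (inj₂ (refl , refl)) D X = flipₒ-op o D X

  opaque
    unfolding _!_

    ∈-colored₂⁺ : ∀ {o c c′ Y e} → Matches o c c′ → Two o Y e → e ∈ colored₂ G k Y c c′
    ∈-colored₂⁺ {o} {c} {c′} {Y} {e} matches two =
      ∈-filter⁺ (λ e → (lookup Y e ≟ᶠ c) ⊎-dec (lookup Y e ≟ᶠ c′)) (∈-allFin e) (lem matches two)
      where
      lem : Matches o c c′ → Two o Y e → lookup Y e ≡ c ⊎ lookup Y e ≡ c′
      lem (inj₁ (refl , refl)) two         = two
      lem (inj₂ (refl , refl)) (inj₁ eq) = inj₂ eq
      lem (inj₂ (refl , refl)) (inj₂ eq) = inj₁ eq

    ∈-colored₂⁻ : ∀ {o c c′ Y e} → Matches o c c′ → e ∈ colored₂ G k Y c c′ → Two o Y e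
    ∈-colored₂⁻ {o} {c} {c′} {Y} {e} matches e∈ =
      lem matches (proj₂ (∈-filter⁻ (λ e → (lookup Y e ≟ᶠ c) ⊎-dec (lookup Y e ≟ᶠ c′)) {xs = edges G} e∈))
      where
      lem : Matches o c c′ → lookup Y e ≡ c ⊎ lookup Y e ≡ c′ → Two o Y e
      lem (inj₁ (refl , refl)) two         = two
      lem (inj₂ (refl , refl)) (inj₁ eq) = inj₂ eq
      lem (inj₂ (refl , refl)) (inj₂ eq) = inj₁ eq

  module _ {o c c′} (matches : Matches o c c′) {Y : Col} where

    private
      H : List Edge
      H = colored₂ G k Y c c′

      H! : Unique H
      H! = Unique-filter⁺ (λ e → (lookup Y e ≟ᶠ c) ⊎-dec (lookup Y e ≟ᶠ c′)) (allFin⁺ size)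

    ¬EndVertex : ∀ {v e f} → Inc v e → Two o Y e → Inc v f → Two o Y f → e ≢ f → ¬ EndVertex G H v
    ¬EndVertex {v} v∈e two-e v∈f two-f e≢f len = e≢f (length≡1⇒≡ len
      (∈-filter⁺ (incident? G v) (∈-colored₂⁺ matches two-e) v∈e)
      (∈-filter⁺ (incident? G v) (∈-colored₂⁺ matches two-f) v∈f))

    LastAt⇒EndVertex : ∀ {v} → LastAt o Y v → EndVertex G H v
    LastAt⇒EndVertex {v} (ℓ , (v∈ℓ , two) , only) = length≡1 (Unique-filter⁺ (incident? G v) H!)
      (∈-filter⁺ (incident? G v) (∈-colored₂⁺ matches two) v∈ℓ)
      λ e∈ → let e∈H , v∈e = ∈-filter⁻ (incident? G v) {xs = H} e∈ in only v∈e (∈-colored₂⁻ matches e∈H)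

    -- `shape` excludes the trivial path, which is not among the sub-paths.
    record InnerPath (D : List Edge) : Set where
      field
        {start finish} : Vertex
        {e}    : Edge
        {es}   : List Edge
        {inners} : List Vertex
        shape  : D ≡ e ∷ es
        route  : Route start D inners finish
        distinct : Unique (start ∷ inners)
        ⊆H     : ∀ {f} → f ∈ D → Two o Y f
        inner  : ¬ EndVertex G H start

      member : e ∈ D
      member = subst (e ∈_) (sym shape) (here refl)

      listed : ∃ λ P → P ∈ subPaths G H × SubPathBetween H start D finish P
      listed = from-shape shape route (∈-colored₂⁺ matches ∘ ⊆H)
        where
        from-shape : ∀ {D} → D ≡ e ∷ es → Route start D inners finish → (∀ {f} → f ∈ D → f ∈ H) →
                     ∃ λ P → P ∈ subPaths G H × SubPathBetween H start D finish P
        from-shape refl route ⊆H = ∈-subPaths H route distinct ⊆H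

    open InnerPath

    private
      flip-listed : ∀ {D E} X → (∀ {e} → e ∈ D → e ∈ E) → (∀ {e} → e ∈ E → e ∈ D) →
                    flip G k c c′ E X ≡ flipₒ o D X
      flip-listed {D} {E} X D⊆E E⊆D = trans (flip-matches {o} matches E X) (flipₒ-cong {o} {E} {D} X E⊆D D⊆E)

    flipInitial-path₂ : ∀ {D} → InnerPath D → flipₒ o D Y ∈ˢ TwoColors.flipInitial G k c c′ Y
    flipInitial-path₂ {D} inner-path = let P , P∈ , _ , D⊆ , ⊆D = listed inner-path in
      ∈ˢ-++ʳ (scale third (return Y)) (∈ˢ-++ˡ (∈ˢ-scale third
        (∈ˢ-select (∈-++⁺ˡ (∈-map⁺ (pathEdges G H) P∈))
          (subst (_∈ˢ return (flip G k c c′ (pathEdges G H P) Y)) (flip-listed Y D⊆ ⊆D) ∈ˢ-return))))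

    flipInitial-path₃ : ∀ {b D} → InnerPath D → flipₒ o D Y ∈ˢ ThreeColors.flipInitial G k b c c′ Y
    flipInitial-path₃ {D = D} inner-path = let P , P∈ , ends , D⊆ , ⊆D = listed inner-path in
      ∈ˢ-++ʳ (scale third (return Y)) (∈ˢ-++ˡ (∈ˢ-scale third
        (∈ˢ-select (∈-filter⁺ (λ (u , _ , t) → ¬? (endVertex? G H u) ⊎-dec ¬? (endVertex? G H t)) P∈ (inner-end ends))
          (subst (_∈ˢ return (flip G k c c′ (pathEdges G H P) Y)) (flip-listed Y D⊆ ⊆D) ∈ˢ-return))))
      where
      inner-end : ∀ {u t} → (u ≡ start inner-path × t ≡ finish inner-path) ⊎ (u ≡ finish inner-path × t ≡ start inner-path) →
                  ¬ EndVertex G H u ⊎ ¬ EndVertex G H t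
      inner-end (inj₁ (refl , _)) = inj₁ (inner inner-path)
      inner-end (inj₂ (_ , refl)) = inj₂ (inner inner-path)

    flipInitial-two₃ : ∀ {b D E} → (p : InnerPath D) → EndVertex G H (finish p) → (q : InnerPath E) → EndVertex G H (finish q) →
      (∀ {e} → e ∈ D → e ∉ E) → flipₒ o (E ++ D) Y ∈ˢ ThreeColors.flipInitial G k b c c′ Y
    flipInitial-two₃ {D = D} {E} p p-end q q-end disjoint with listed p | listed q
    ... | P , P∈ , P-ends , D⊆ , ⊆D | Q , Q∈ , Q-ends , E⊆ , ⊆E =
      ∈ˢ-++ʳ (scale third (return Y)) (∈ˢ-++ʳ (scale third _) (∈ˢ-scale third in-pair))
      where
      one-inner : ∀ {D P} → (p : InnerPath D) → EndVertex G H (finish p) → P ∈ subPaths G H → SubPathBetween H (start p) D (finish p) P →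
                  P ∈ subPathsWithOneInnerEnd G H
      one-inner p end P∈ (ends , _) = ∈-filter⁺
        (λ (u , _ , t) → (endVertex? G H u ×-dec ¬? (endVertex? G H t)) ⊎-dec (¬? (endVertex? G H u) ×-dec endVertex? G H t))
        P∈ (case ends of λ where
          (inj₁ (refl , refl)) → inj₂ (inner p , end)
          (inj₂ (refl , refl)) → inj₁ (end , inner p))

      -- `pairs` selects without repetition, so the two sub-paths have to differ; they do, being
      -- disjoint and nonempty.
      P≢Q : P ≢ Q
      P≢Q refl = disjoint (member p) (⊆E (D⊆ (member p)))

      flips : ∀ {D E P Q} → (∀ {e} → e ∈ D → e ∈ pathEdges G H P) → (∀ {e} → e ∈ pathEdges G H P → e ∈ D) →
        (∀ {e} → e ∈ E → e ∈ pathEdges G H Q) → (∀ {e} → e ∈ pathEdges G H Q → e ∈ E) → (∀ {e} → e ∈ E → e ∉ D) →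
        flip G k c c′ (pathEdges G H Q) (flip G k c c′ (pathEdges G H P) Y) ≡ flipₒ o (E ++ D) Y
      flips {D} {E} {P} {Q} D⊆ ⊆D E⊆ ⊆E disjoint = trans
        (cong (flip G k c c′ (pathEdges G H Q)) (flip-listed {D} {pathEdges G H P} Y D⊆ ⊆D))
        (trans (flip-listed {E} {pathEdges G H Q} (flipₒ o D Y) E⊆ ⊆E) (flipₒ-++ {o} {E} {D} Y disjoint))

      ∈-++-comm : ∀ {e : Edge} xs {ys} → e ∈ xs ++ ys → e ∈ ys ++ xs
      ∈-++-comm xs {ys} e∈ with ∈-++⁻ xs e∈
      ... | inj₁ e∈xs = ∈-++⁺ʳ ys e∈xs
      ... | inj₂ e∈ys = ∈-++⁺ˡ e∈ys

      in-pair : flipₒ o (E ++ D) Y ∈ˢ flipTwo G k c c′ Y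
      in-pair with ∈-pairs (one-inner p p-end P∈ (P-ends , D⊆ , ⊆D)) (one-inner q q-end Q∈ (Q-ends , E⊆ , ⊆E)) P≢Q
      ... | inj₁ PQ∈ = ∈ˢ-select PQ∈ (subst (_∈ˢ return (flip G k c c′ (pathEdges G H Q) (flip G k c c′ (pathEdges G H P) Y)))
        (flips {D} {E} {P} {Q} D⊆ ⊆D E⊆ ⊆E (λ e∈ e∈′ → disjoint e∈′ e∈)) ∈ˢ-return)
      ... | inj₂ QP∈ = ∈ˢ-select QP∈ (subst (_∈ˢ return (flip G k c c′ (pathEdges G H P) (flip G k c c′ (pathEdges G H Q) Y)))
        (trans (flips {E} {D} {Q} {P} E⊆ ⊆E D⊆ ⊆D disjoint) (flipₒ-cong {o} {D ++ E} {E ++ D} Y (∈-++-comm D) (∈-++-comm E))) ∈ˢ-return)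

  private
    flip-back : ∀ {o D X Y} → Y ≡ flipₒ o D X → flipₒ o D Y ≡ X
    flip-back {o} {D} {X} refl = flipₒ-involutive {o} D X

  module _ {o c c′} (matches : Matches o c c′) {X Y : Col} where

    private
      Same : Set
      Same = ∀ {e} → Two o X e → Two o Y e

      same-flip : ∀ {D} → Y ≡ flipₒ o D X → Same
      same-flip {D} refl = flipₒ-Two {o} {D = D}

      LastAt-same : ∀ {D v} → Y ≡ flipₒ o D X → LastAt o X v → LastAt o Y v
      LastAt-same {D} refl (ℓ , (v∈ℓ , two) , only) =
        ℓ , (v∈ℓ , flipₒ-Two {o} {D = D} two) , λ v∈e two → only v∈e (Two-flipₒ⁻ {o} {D = D} two)

      from-hole : ∀ {s h V g D vs t} → Same → Near o X s h V → h ∉ g ∷ D → Path o X s (g ∷ D) vs t → Unique (s ∷ vs) →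
                  InnerPath matches {Y} (g ∷ D)
      from-hole {s} same near h∉ path simple = record
        { shape = refl ; route = Path⇒Route path ; distinct = simple
        ; ⊆H = same ∘ Path-two path
        ; inner = ¬EndVertex matches (proj₁ (outgoing (hole near))) (same (Two-out (side s) (proj₂ (outgoing (hole near)))))
            (proj₁ (Path-head path)) (same (Two-out (side s) (proj₂ (Path-head path)))) (λ { refl → h∉ (here refl) })
        }

      from-sink : ∀ {v r D₀ vs₀ t₀} → Same → SinkAt o X v → Path (op o) X v (r ∷ D₀) vs₀ t₀ → Unique (v ∷ vs₀) →
                  InnerPath matches {Y} (r ∷ D₀)
      from-sink {v} same sink-v path₀ simple₀ = record
        { shape = refl ; route = Path⇒Route path₀ ; distinct = simple₀
        ; ⊆H = same ∘ Two-op ∘ Path-two path₀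
        ; inner = ¬EndVertex matches (proj₁ (SinkAt.incoming sink-v)) (same (Two-in (side v) (proj₂ (SinkAt.incoming sink-v))))
            (proj₁ (outgoing (SinkAt.hole sink-v))) (same (Two-in (side v) (proj₂ (outgoing (SinkAt.hole sink-v)))))
            (SinkAt.different sink-v)
        }

    -- A flip is its own inverse, and Y has the same edges in the two colors as X. The paths start
    -- at inner vertices, as s and v have two such edges each. When two paths are needed, `LastAt`
    -- makes their other ends end vertices, as the choice of two sub-paths demands.
    undo₃ : ∀ {b s h g D V} → Config o X Y s h (g ∷ D) V → X ∈ˢ ThreeColors.flipInitial G k b c c′ Y
    undo₃ {b} {g = g} {D} config = by-ending (ending config) (sink (near config))
      where
      by-ending : ∀ {V} → Ending o X Y (g ∷ D) (vs config) (t config) V → (∀ {v} → V ≡ just v → v ≢ _ × SinkAt o X v) →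
           X ∈ˢ ThreeColors.flipInitial G k b c c′ Y
      one : Y ≡ flipₒ o (g ∷ D) X → X ∈ˢ ThreeColors.flipInitial G k b c c′ Y
      one eq = subst (_∈ˢ ThreeColors.flipInitial G k b c c′ Y) (flip-back {o} {g ∷ D} eq)
        (flipInitial-path₃ matches {Y} {b} (from-hole (same-flip {g ∷ D} eq) (near config) (fresh config) (path config) (simple config)))
      by-ending (alone eq)  _ = one eq
      by-ending (joined eq) _ = one eq
      by-ending (apart {r = r} {D₀} v∉ last path₀ simple₀ last₀ disjoint eq) sinks =
        subst (_∈ˢ ThreeColors.flipInitial G k b c c′ Y) (flip-back {o} {r ∷ D₀ ++ g ∷ D} eq)
          (flipInitial-two₃ matches {Y} {b}
            (from-hole (same-flip {r ∷ D₀ ++ g ∷ D} eq) (near config) (fresh config) (path config) (simple config))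
            (LastAt⇒EndVertex matches (LastAt-same {r ∷ D₀ ++ g ∷ D} eq last))
            (from-sink (same-flip {r ∷ D₀ ++ g ∷ D} eq) (proj₂ (sinks refl)) path₀ simple₀)
            (LastAt⇒EndVertex matches (LastAt-same {r ∷ D₀ ++ g ∷ D} eq last₀)) disjoint)

    -- As nothing is flipped from s, only the path from v has to be flipped back, and a step with
    -- two colors may flip any single sub-path.
    undo₂ : ∀ {s h v} → v ≢ s → Config o X Y s h [] (just v) → X ∈ˢ TwoColors.flipInitial G k c c′ Y
    undo₂ {v = v} v≢s config with path config | ending config
    ... | [] | joined _ = contradiction refl v≢s
    ... | [] | apart {r = r} {D₀} _ _ path₀ simple₀ _ _ eq =
      subst (_∈ˢ TwoColors.flipInitial G k c c′ Y) (flip-back {o} {r ∷ D₀} eq′)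
        (flipInitial-path₂ matches (from-sink (same-flip {r ∷ D₀} eq′) (proj₂ (sink (near config) refl)) path₀ simple₀))
      where
      eq′ : Y ≡ flipₒ o (r ∷ D₀) X
      eq′ = trans eq (cong (λ E → flipₒ o (r ∷ E) X) (++-identityʳ D₀))

-- Transitions assembled from initial flip, perturbation and elimination.

module Moves (G : Graph) (bip : Bipartite G) (k : ℕ) where
  open Graph G
  open Positivity G k
  open Local G bip k
  open Walks G bip k
  open Elimination G bip k
  open Popping G bip k
  open Rotation G bip k
  open Undoing G bip k

  -- A record, to keep M from being unfolded.
  record Transition (Y Z : Col) : Set where
    constructor transition
    field
      possible : Z ∈ˢ M G k Y

  data Steps : ℕ → Col → Col → Set where
    done : ∀ {Y} → Steps 0 Y Y
    step : ∀ {n Y Z W} → Transition Y Z → (∀ v → Prop Z v) → Steps n Z W → Steps (suc n) Y W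

  Steps-trans : ∀ {m n X Y Z} → Steps m X Y → Steps n Y Z → Steps (m + n) X Z
  Steps-trans done              steps = steps
  Steps-trans (step Z∈ prop ss) steps = step Z∈ prop (Steps-trans ss steps)

  Steps⇒Reaches : ∀ {n} (C D : EdgeColoring G k) → Steps n (proj₁ C) (proj₁ D) → Reaches G k n C D
  Steps⇒Reaches (C , _) (D , _) done                   = done refl
  Steps⇒Reaches C D (step {Z = Z} (transition Z∈) prop steps) =
    step-from-support {D = Z , Prop⇒Proper prop} Z∈ (Steps⇒Reaches (Z , Prop⇒Proper prop) D steps)

  Matches⇒HasBoth : ∀ {o c c′ cs} → Matches o c c′ → HasBoth o (c ∷ c′ ∷ cs)
  Matches⇒HasBoth (inj₁ (refl , refl)) = here refl , there (here refl)
  Matches⇒HasBoth (inj₂ (refl , refl)) = there (here refl) , here refl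

  change-edge : ∀ {o Y e Z} → Distinct o → (∀ v → Prop Y v) → Two o Y e →
    (∀ {cs} → HasBoth o cs → Z ∈ˢ eliminateAll G k cs (flipₒ o [ e ] Y)) → Transition Y Z
  change-edge {o} {Y} {e} o! prop two Z∈ = transition (∈ˢ-M₂ o! λ c c′ matches →
    ∈ˢ->>= {f = eliminateAll G k (c ∷ c′ ∷ [])}
      (∈ˢ->>= {d = TwoColors.flipInitial G k c c′ Y} {f = TwoColors.perturb G k c c′} (∈ˢ-++ˡ (∈ˢ-scale third ∈ˢ-return))
        (∈ˢ-select-none (no-deficientVertices prop) (∈ˢ-++ˡ (∈ˢ-scale half
          (∈ˢ-select (∈-colored₂⁺ matches two)
            (subst (_∈ˢ return (flip G k c c′ [ e ] Y)) (flip-matches {o} matches [ e ] Y) ∈ˢ-return))))))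
      (Z∈ (Matches⇒HasBoth matches)))

  change-edge-at-sink : ∀ {o X Y s h v r Z} → Distinct o → v ≢ s → Config o X Y s h [] (just v) → In o X v r →
    (∀ {cs} → HasBoth o cs → Z ∈ˢ eliminateAll G k cs (flipₒ o [ r ] X)) → Transition Y Z
  change-edge-at-sink {o} {X} {Y} {v = v} {r} o! v≢s config r← Z∈ = transition (∈ˢ-M₂ o! λ c c′ matches →
    ∈ˢ->>= {f = eliminateAll G k (c ∷ c′ ∷ [])}
      (∈ˢ->>= {d = TwoColors.flipInitial G k c c′ Y} {f = TwoColors.perturb G k c c′} (undo₂ matches v≢s config)
        (∈ˢ-select (∈-deficientVertices⁺ {X} (_ , _ , Hole⇒HasDeficiency op! (SinkAt.hole sink-v) (SinkAt.incoming sink-v) (SinkAt.different sink-v)))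
          (∈ˢ-select (∈-repeatedAt op! (SinkAt.hole sink-v) (SinkAt.incoming sink-v) (SinkAt.different sink-v) r←)
            (subst (_∈ˢ return (flip G k c c′ [ r ] X)) (flip-matches {o} matches [ r ] X) ∈ˢ-return))))
      (Z∈ (Matches⇒HasBoth matches)))
    where
    sink-v : SinkAt o X v
    sink-v = proj₂ (sink (near config) refl)

    op! : Distinct (op o)
    op! = ≢-sym o!

  perturbDeficient⊆perturb : ∀ {b c c′ X v Z} → v ∈ deficientVertices G k X → Z ∈ˢ ThreeColors.perturbDeficient G k b c c′ X v →
    Z ∈ˢ ThreeColors.perturb G k b c c′ X
  perturbDeficient⊆perturb {b} {c} {c′} {X = X} v∈ Z∈ with deficientVertices G k X | v∈
  ... | u ∷ []     | here refl = ∈ˢ-++ˡ (∈ˢ-scale half Z∈)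
  ... | u ∷ w ∷ us | v∈′       = ∈ˢ->>= {f = ThreeColors.perturbDeficient G k b c c′ X} (∈ˢ-uniform v∈′) Z∈

  rotate-at-hole : ∀ {o X Y s h g D V b X′ Z} → Distinct o → b ≢ proj₁ o → b ≢ proj₂ o → Config o X Y s h (g ∷ D) V →
    (∀ c c′ → X′ ∈ˢ ThreeColors.perturbDeficient G k b c c′ X s) →
    (∀ {cs} → HasBoth o cs → Z ∈ˢ eliminateAll G k cs X′) → Transition Y Z
  rotate-at-hole {o} {X} {Y} {s} {h} {g} {b = b} o! b≢₁ b≢₂ config X′∈ Z∈ = transition (∈ˢ-M₃ b≢₁ b≢₂ o! λ c c′ matches →
    ∈ˢ->>= {f = eliminateAll G k (c ∷ c′ ∷ b ∷ [])}
      (∈ˢ->>= {d = ThreeColors.flipInitial G k b c c′ Y} {f = ThreeColors.perturb G k b c c′} (undo₃ matches {b = b} config)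
        (perturbDeficient⊆perturb {b} {c} {c′} {X}
          (∈-deficientVertices⁺ {X} (_ , _ , Hole⇒HasDeficiency o! (hole (near config)) (Path-head (path config))
            λ { refl → fresh config (here refl) }))
          (X′∈ c c′)))
      (Z∈ (Matches⇒HasBoth matches)))

  Toward : Bool → K → K → Ori
  Toward true  a b = a , b
  Toward false a b = b , a

  out-Toward : ∀ s {a b} → out (Toward s a b) s ≡ a
  out-Toward true  = refl
  out-Toward false = refl

  in-Toward : ∀ s {a b} → in′ (Toward s a b) s ≡ b
  in-Toward true  = refl
  in-Toward false = refl

  Toward-distinct : ∀ s {a b} → a ≢ b → Distinct (Toward s a b)
  Toward-distinct true  a≢b = a≢b
  Toward-distinct false a≢b = ≢-sym a≢b

  Toward-both : ∀ s {a b cs} → a ∈ cs → b ∈ cs → HasBoth (Toward s a b) cs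
  Toward-both true  a∈ b∈ = a∈ , b∈
  Toward-both false a∈ b∈ = b∈ , a∈

  differs-from-both : ∀ {o b} s → b ≢ out o s → b ≢ in′ o s → b ≢ proj₁ o × b ≢ proj₂ o
  differs-from-both true  p q = p , q
  differs-from-both false p q = q , p

-- The number of edges on which the classes of c differ, and missing colors.

module Measure (G : Graph) (bip : Bipartite G) (k : ℕ) (C₂ : Coloring G k) where
  open Graph G
  open Local G bip k
  open Elimination G bip k

  -- All edges with an unfinished color, in one of the two colorings, have such
  -- a color in the other one, too.
  Inv : List K → Col → Set
  Inv cs X = ∀ e → (X ! e ∈ cs × C₂ ! e ∈ cs) ⊎ X ! e ≡ C₂ ! e

  Inv-∈ : ∀ {cs X} → Inv cs X → ∀ {e} → X ! e ∈ cs → C₂ ! e ∈ cs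
  Inv-∈ {cs} inv {e} Xe∈ with inv e
  ... | inj₁ (_ , C₂e∈) = C₂e∈
  ... | inj₂ eq         = subst (_∈ cs) eq Xe∈

  Inv-∈⁻ : ∀ {cs X} → Inv cs X → ∀ {e} → C₂ ! e ∈ cs → X ! e ∈ cs
  Inv-∈⁻ {cs} inv {e} C₂e∈ with inv e
  ... | inj₁ (Xe∈ , _) = Xe∈
  ... | inj₂ eq        = subst (_∈ cs) (sym eq) C₂e∈

  Inv-flip : ∀ {o cs X} D → HasBoth o cs → Inv cs X → Inv cs (flipₒ o D X)
  Inv-flip {o} {cs} {X} D both inv e with (X ! e ≟ᶠ proj₁ o) ⊎-dec (X ! e ≟ᶠ proj₂ o)
  ... | no ¬two = subst (λ d → (d ∈ cs × C₂ ! e ∈ cs) ⊎ d ≡ C₂ ! e) (sym (¬Two⇒flipₒ {o} {X} {D} ¬two)) (inv e)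
  ... | yes two = inj₁ (two-∈ (flipₒ-Two {o} {X} {D} two) , Inv-∈ {X = X} inv (two-∈ two))
    where
    two-∈ : ∀ {Z e} → Two o Z e → Z ! e ∈ cs
    two-∈ (inj₁ eq) = subst (_∈ cs) (sym eq) (proj₁ both)
    two-∈ (inj₂ eq) = subst (_∈ cs) (sym eq) (proj₂ both)

  module _ (c : K) where

    -- The symmetric difference of the two classes of c.
    Bad : Col → Edge → Set
    Bad X e = (X ! e ≡ c × C₂ ! e ≢ c) ⊎ (X ! e ≢ c × C₂ ! e ≡ c)

    bad? : ∀ X → Decidable (Bad X)
    bad? X e = ((X ! e ≟ᶠ c) ×-dec ¬? (C₂ ! e ≟ᶠ c)) ⊎-dec (¬? (X ! e ≟ᶠ c) ×-dec (C₂ ! e ≟ᶠ c))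

    opaque
      φ : Col → ℕ
      φ X = length (filter (bad? X) (allFin size))

      private
        bad! : ∀ X → Unique (filter (bad? X) (allFin size))
        bad! X = Unique-filter⁺ (bad? X) (allFin⁺ size)

        ∈-bad⁺ : ∀ {X e} → Bad X e → e ∈ filter (bad? X) (allFin size)
        ∈-bad⁺ {X} {e} = ∈-filter⁺ (bad? X) (∈-allFin e)

        ∈-bad⁻ : ∀ {X e} → e ∈ filter (bad? X) (allFin size) → Bad X e
        ∈-bad⁻ {X} e∈ = proj₂ (∈-filter⁻ (bad? X) {xs = allFin size} e∈)

      φ-≤ : ∀ {X Y} → (∀ {e} → Bad Y e → Bad X e) → φ Y ≤ φ X
      φ-≤ {X} {Y} sub = Unique-length-≤ (bad! Y) λ e∈ → ∈-bad⁺ (sub (∈-bad⁻ e∈))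

      φ-< : ∀ {X Y e} → (∀ {f} → Bad Y f → Bad X f) → Bad X e → ¬ Bad Y e → φ Y < φ X
      φ-< {X} {Y} {e} sub bad ¬bad = Unique-length-≤ {xs = e ∷ filter (bad? Y) (allFin size)}
        (All.tabulate (λ { f∈ refl → ¬bad (∈-bad⁻ f∈) }) ∷ bad! Y)
        λ { (here refl) → ∈-bad⁺ bad ; (there f∈) → ∈-bad⁺ (sub (∈-bad⁻ f∈)) }

    φ-cong : ∀ {X Y} → (∀ e → X ! e ≡ c → Y ! e ≡ c) → (∀ e → Y ! e ≡ c → X ! e ≡ c) → φ Y ≤ φ X
    φ-cong to from = φ-≤ λ where
      (inj₁ (Ye , C₂e)) → inj₁ (from _ Ye , C₂e)
      (inj₂ (Ye , C₂e)) → inj₂ (Ye ∘ to _ , C₂e)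

    φ-zero : ∀ {X} → (∀ e → ¬ Bad X e) → ∀ e → (X ! e ≡ c → C₂ ! e ≡ c) × (C₂ ! e ≡ c → X ! e ≡ c)
    φ-zero {X} ¬bad e with X ! e ≟ᶠ c | C₂ ! e ≟ᶠ c
    ... | yes p | yes q = (λ _ → q) , (λ _ → p)
    ... | yes p | no q  = contradiction (inj₁ (p , q)) (¬bad e)
    ... | no p  | yes q = contradiction (inj₂ (p , q)) (¬bad e)
    ... | no p  | no q  = (λ r → contradiction r p) , (λ r → contradiction r q)

    Bad-resp : ∀ {X Y e} → Y ! e ≡ X ! e → Bad Y e → Bad X e
    Bad-resp eq (inj₁ (Ye , C₂e)) = inj₁ (trans (sym eq) Ye , C₂e)
    Bad-resp eq (inj₂ (Ye , C₂e)) = inj₂ ((λ Xe → Ye (trans eq Xe)) , C₂e)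

    φ-gain : ∀ {o X e} → Two o X e → C₂ ! e ≡ c → X ! e ≢ c → flipₒ o [ e ] X ! e ≡ c → φ (flipₒ o [ e ] X) < φ X
    φ-gain {o} {X} {e} _ C₂e Xe X′e = φ-< sub (inj₂ (Xe , C₂e)) (¬bad)
      where
      ¬bad : ¬ Bad (flipₒ o [ e ] X) e
      ¬bad (inj₁ (_ , ≢c))  = ≢c C₂e
      ¬bad (inj₂ (≢c , _)) = ≢c X′e

      sub : ∀ {f} → Bad (flipₒ o [ e ] X) f → Bad X f
      sub {f} bad with f ≟ᶠ e
      ... | yes refl = contradiction bad ¬bad
      ... | no f≢e   = Bad-resp (flipₒ-∉ {o} {X} {[ e ]} λ { (here f≡e) → f≢e f≡e }) bad

    φ-drop : ∀ {o X e} → C₂ ! e ≢ c → X ! e ≡ c → flipₒ o [ e ] X ! e ≢ c → φ (flipₒ o [ e ] X) < φ X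
    φ-drop {o} {X} {e} C₂e Xe X′e = φ-< sub (inj₁ (Xe , C₂e)) ¬bad
      where
      ¬bad : ¬ Bad (flipₒ o [ e ] X) e
      ¬bad (inj₁ (≡c , _)) = X′e ≡c
      ¬bad (inj₂ (_ , ≡c)) = C₂e ≡c

      sub : ∀ {f} → Bad (flipₒ o [ e ] X) f → Bad X f
      sub {f} bad with f ≟ᶠ e
      ... | yes refl = contradiction bad ¬bad
      ... | no f≢e   = Bad-resp (flipₒ-∉ {o} {X} {[ e ]} λ { (here f≡e) → f≢e f≡e }) bad

    private
      Unique-map-on : ∀ {xs : List K} {f : K → K} → Unique xs → (∀ {x y} → x ∈ xs → y ∈ xs → f x ≡ f y → x ≡ y) →
                      Unique (map f xs)
      Unique-map-on {[]}     {f} _  _   = []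
      Unique-map-on {x ∷ xs} {f} (x∉ ∷ xs!) inj =
        All.tabulate (λ y∈ eq → let z , z∈ , y≡ = ∈-map⁻ f y∈ in All.lookup x∉ z∈ (inj (here refl) (there z∈) (trans eq y≡)))
        ∷ Unique-map-on xs! (λ x∈ y∈ → inj (there x∈) (there y∈))

    -- The edges at v with unfinished colors are fewer than these colors, as c
    -- is not used at v in C₂.
    missing : ∀ {cs X v x} → Unique cs → c ∈ cs → (∀ u → Prop C₂ u) → Inv cs X → Inc v x → X ! x ∈ cs →
      (∀ {e} → Inc v e → C₂ ! e ≢ c) →
      ∃ λ b → b ∈ cs × b ≢ c × (∀ {e} → Inc v e → X ! e ≡ b → e ≡ x)
    missing {cs} {X} {v} {x} cs! c∈ prop₂ inv v∈x Xx∈ no-c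
      with any? (λ b → (_∈?_ _≟ᶠ_ b cs ×-dec ¬? (b ≟ᶠ c)) ×-dec ¬? (any? λ e → (incident? G v e ×-dec (X ! e ≟ᶠ b)) ×-dec ¬? (e ≟ᶠ x)))
    ... | yes (b , (b∈ , b≢c) , none) = b , b∈ , b≢c , only
      where
      only : ∀ {e} → Inc v e → X ! e ≡ b → e ≡ x
      only {e} v∈e Xe with e ≟ᶠ x
      ... | yes e≡x = e≡x
      ... | no e≢x  = contradiction (e , (v∈e , Xe) , e≢x) none
    ... | no all-present = contradiction (Unique-length-≤ {xs = c ∷ map (λ b → C₂ ! ρ b) cs} unique sub)
        (ℕₚ.<⇒≱ (s≤s (ℕₚ.≤-reflexive (sym (length-map (λ b → C₂ ! ρ b) cs)))))
      where
      Found : K → Edge → Set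
      Found b e = (Inc v e × X ! e ≡ b) × e ≢ x

      found? : ∀ b → Dec (∃ (Found b))
      found? b = any? λ e → (incident? G v e ×-dec (X ! e ≟ᶠ b)) ×-dec ¬? (e ≟ᶠ x)

      choose : ∀ {b} → Dec (b ≡ c) → Dec (∃ (Found b)) → Edge
      choose (yes _) _             = x
      choose (no _)  (yes (e , _)) = e
      -- A default value: for colors in cs, this case is excluded by `all-present`.
      choose (no _)  (no _)        = x

      -- To c is assigned x, to every other color of cs an edge of that color at v different from x.
      -- These edges are distinct, so by `prop₂` they have as many colors in C₂ as cs has members.
      -- All of these are in cs, but c is not among them.
      ρ : K → Edge
      ρ b = choose (b ≟ᶠ c) (found? b)

      spec : ∀ {b} → b ∈ cs → (b ≡ c × ρ b ≡ x) ⊎ Found b (ρ b)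
      spec {b} b∈ with b ≟ᶠ c | found? b
      ... | yes b≡c | _             = inj₁ (b≡c , refl)
      ... | no _    | yes (e , found) = inj₂ found
      ... | no b≢c  | no none       = contradiction (b , (b∈ , b≢c) , none) all-present

      ρ-inc : ∀ {b} → b ∈ cs → Inc v (ρ b)
      ρ-inc b∈ with spec b∈
      ... | inj₁ (_ , eq)            = subst (Inc v) (sym eq) v∈x
      ... | inj₂ ((v∈e , _) , _) = v∈e

      ρ-∈ : ∀ {b} → b ∈ cs → C₂ ! ρ b ∈ cs
      ρ-∈ b∈ with spec b∈
      ... | inj₁ (_ , eq)         = subst (λ e → C₂ ! e ∈ cs) (sym eq) (Inv-∈ {X = X} inv Xx∈)
      ... | inj₂ ((_ , Xe) , _) = Inv-∈ {X = X} inv (subst (_∈ cs) (sym Xe) b∈)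

      ρ-injective : ∀ {a b} → a ∈ cs → b ∈ cs → ρ a ≡ ρ b → a ≡ b
      ρ-injective a∈ b∈ eq with spec a∈ | spec b∈
      ... | inj₁ (a≡c , _)       | inj₁ (b≡c , _)       = trans a≡c (sym b≡c)
      ... | inj₁ (_ , ρa)        | inj₂ (_ , ρb≢x)      = contradiction (trans (sym eq) ρa) ρb≢x
      ... | inj₂ (_ , ρa≢x)      | inj₁ (_ , ρb)        = contradiction (trans eq ρb) ρa≢x
      ... | inj₂ ((_ , Xa) , _) | inj₂ ((_ , Xb) , _) = trans (sym Xa) (trans (cong (X !_) eq) Xb)

      unique : Unique (c ∷ map (λ b → C₂ ! ρ b) cs)
      unique = All.tabulate (λ y∈ c≡y → let b , b∈ , y≡ = ∈-map⁻ _ y∈ in no-c (ρ-inc b∈) (sym (trans c≡y y≡)))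
             ∷ Unique-map-on cs! λ a∈ b∈ eq → ρ-injective a∈ b∈ (prop₂ v (ρ-inc a∈) (ρ-inc b∈) eq)

      sub : ∀ {y} → y ∈ c ∷ map (λ b → C₂ ! ρ b) cs → y ∈ cs
      sub (here refl) = c∈
      sub (there y∈) with ∈-map⁻ _ y∈
      ... | b , b∈ , refl = ρ-∈ b∈

-- Advancing the deficiency along a component.

module OneColor (G : Graph) (bip : Bipartite G) (k : ℕ) (C₂ : Coloring G k) where
  open Graph G
  open Local G bip k
  open Walks G bip k
  open Elimination G bip k
  open Popping G bip k
  open Rotation G bip k
  open Undoing G bip k
  open Moves G bip k
  open Measure G bip k C₂

  module _ {o : Ori} (o! : Distinct o) {X : Col} {s e} (e← : In o X s e) where

    private
      X₁ : Col
      X₁ = flipₒ o [ e ] X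

      u : Vertex
      u = other e s

    recolor-same : ∀ {f} → f ≢ e → X₁ ! f ≡ X ! f
    recolor-same f≢e = flipₒ-∉ {o} {X} {[ e ]} λ { (here f≡e) → f≢e f≡e }

    recolor-agree : ∀ {z} → z ≢ s → z ≢ u → Agree X X₁ z
    recolor-agree z≢s z≢u z∈f = sym (recolor-same λ { refl → case inc-cases (proj₁ e←) z∈f of λ where
      (inj₁ z≡s) → z≢s z≡s
      (inj₂ z≡u) → z≢u z≡u })

    recolor-opens : Prop X s → Hole o X₁ s e
    recolor-opens prop = hole-opens o! prop e← (flipₒ-In {o} {X} {[ e ]} e← (here refl)) (λ _ → recolor-same)

    recolor-opens-other : Prop X u → Hole (op o) X₁ u e
    recolor-opens-other prop = hole-opens (≢-sym o!) prop (In⇒Out-other e←)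
      (flipₒ-Out {o} {X} {[ e ]} (In⇒Out-other e←) (here refl)) (λ _ → recolor-same)

    recolor-missing : Prop X u → (∀ {f} → ¬ In o X u f) → Prop X₁ u
    recolor-missing prop none = hole-trivial (≢-sym o!) (recolor-opens-other prop) only
      where
      only : ∀ {f} → In o X₁ u f → f ≡ e
      only {f} (u∈f , X₁f) with f ≟ᶠ e
      ... | yes f≡e = f≡e
      ... | no f≢e  = contradiction (u∈f , trans (sym (recolor-same f≢e)) X₁f) none

    near-alone : Prop X s → (∀ {z} → z ≢ s → z ≢ u → Prop X z) → Prop X₁ u → Near o X₁ s e nothing
    near-alone prop-s props prop-u = record
      { hole = recolor-opens prop-s
      ; prop = λ {z} z≢s _ → case z ≟ᶠ u of λ where
          (yes refl) → prop-u
          (no z≢u)   → Prop-resp {X} (recolor-agree z≢s z≢u) (props z≢s z≢u)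
      ; sink = λ ()
      }

  module Fixing (prop₂ : ∀ v → Prop C₂ v) {cs : List K} (cs! : Unique cs) {c : K} (c∈ : c ∈ cs) where

    Final : Vertex → Set
    Final v = ∃ λ e → Inc v e × C₂ ! e ≡ c

    final? : ∀ v → Dec (Final v)
    final? v = any? λ e → incident? G v e ×-dec (C₂ ! e ≟ᶠ c)

    -- The hole arrives at its next vertex by giving up an edge of color c. This condition
    -- guarantees that C₂ has an edge of color c there, along which it can go on.
    Balanced : Col → Set
    Balanced X = ∀ {v e} → Inc v e → X ! e ≡ c → Final v

    -- An amortized bound: three steps are set aside for every bad edge that is left.
    Reach : Col → ℕ → Set
    Reach Y bound = ∃₂ λ n Z → Steps n Y Z × (∀ v → Prop Z v) × Inv cs Z × n + 3 * φ c Z ≤ bound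

    -- The loss of one bad edge pays for a step and for the extra 1 in the bound on what follows.
    budget : ∀ {n m t y x} → n ≤ 1 → m + t ≤ suc (3 * y) → y < x → (n + m) + t ≤ 3 * x
    budget {n} {m} {t} {y} {x} n≤1 m+t≤ y<x = begin
      n + m + t       ≡⟨ ℕₚ.+-assoc n m t ⟩
      n + (m + t)     ≤⟨ ℕₚ.+-mono-≤ n≤1 m+t≤ ⟩
      -- One of the three units per bad edge is left over.
      2 + 3 * y       ≤⟨ ℕₚ.n≤1+n _ ⟩
      3 + 3 * y       ≡⟨ sym (ℕₚ.*-suc 3 y) ⟩
      3 * suc y        ≤⟨ ℕₚ.*-monoʳ-≤ 3 y<x ⟩
      3 * x            ∎
      where open ℕₚ.≤-Reasoning

    after : ∀ {n Y Y′ y x} → n ≤ 1 → Steps n Y Y′ → Reach Y′ (suc (3 * y)) → y < x → Reach Y (3 * x)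
    after n≤1 steps (m , Z , steps′ , prop-Z , inv , bound) y<x =
      _ , Z , Steps-trans steps steps′ , prop-Z , inv , budget n≤1 bound y<x

    stay : ∀ {Y y} → (∀ v → Prop Y v) → Inv cs Y → φ c Y ≤ y → Reach Y (suc (3 * y))
    stay prop-Y inv ≤y = 0 , _ , done , prop-Y , inv , ℕₚ.m≤n⇒m≤1+n (ℕₚ.*-monoʳ-≤ 3 ≤y)

    weaken : ∀ {Y x y} → x ≤ y → Reach Y x → Reach Y y
    weaken x≤y (n , Z , steps , prop-Z , inv , bound) = n , Z , steps , prop-Z , inv , ℕₚ.≤-trans bound x≤y

    -- By `h-other`, the final edge at w can have the repeated color only if it is the other edge of
    -- the deficiency, that is, the first edge of D.
    record Stage (o : Ori) (X Y : Col) (w : Vertex) (h : Edge) (D : List Edge) (V : Maybe Vertex) : Set where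
      field
        o!      : Distinct o
        config  : Config o X Y w h D V
        lacks   : in′ o (side w) ≡ c
        both    : HasBoth o cs
        inv     : Inv cs X
        h-other : C₂ ! h ≢ c

    open Stage

    -- Either the hole has met the sink and the almost coloring has become Y, or the path has run
    -- out before a new stage, or there is a new stage. The last three arguments of `onward` carry
    -- `Balanced` over: the first two of them show that the new vertex is final, the third that the
    -- condition persists.
    data Popped (o : Ori) (X Y : Col) (s : Bool) (V : Maybe Vertex) : Set where
      finished  : Inv cs Y → φ c Y < φ c X → Popped o X Y s V
      exhausted : ∀ {X′ x e} → Config o X′ Y x e [] V → Inv cs X′ → φ c X′ < φ c X → Popped o X Y s V
      onward    : ∀ {X′ w f D} → Stage o X′ Y w f D V → side w ≡ s → φ c X′ < φ c X → X ! f ≡ c → Inc w f →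
                  (∀ {e} → X′ ! e ≡ c → X ! e ≡ c ⊎ C₂ ! e ≡ c) → Popped o X Y s V

    -- The final edge e at x has received color c, so the other edge f of color c there is not
    -- final. Dropping f from the path removes a bad edge and leaves c missing at the other end of
    -- f.
    pop-c : ∀ {o X Y x e D V} → Distinct o → Config o X Y x e D V → out o (side x) ≡ c → HasBoth o cs → Inv cs X →
            C₂ ! e ≡ c → Popped o X Y (not (side x)) V ⊎ D ≡ []
    pop-c {D = []}                   _  _      _    _    _   _    = inj₂ refl
    pop-c {o} {X} {Y} {x} {e} {f ∷ D} o! config out-c both inv C₂e = inj₁ result
      where
      f→ : Out o X x f
      f→ = Path-head (path config)

      Xf : X ! f ≡ c
      Xf = trans (proj₂ f→) out-c

      C₂f : C₂ ! f ≢ c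
      C₂f eq = fresh config (here (prop₂ x (proj₁ (outgoing (hole (near config)))) (proj₁ f→) (trans C₂e (sym eq))))

      X′ : Col
      X′ = flipₒ o [ f ] X

      X′f : X′ ! f ≢ c
      X′f eq = out≢in o! (side x) (trans out-c (trans (sym eq) (flipₒ-Out {o} {X} {[ f ]} f→ (here refl))))

      less : φ c X′ < φ c X
      less = φ-drop c {o} {X} C₂f Xf X′f

      inv′ : Inv cs X′
      inv′ = Inv-flip {o} {cs} {X} [ f ] both inv

      class : ∀ {g} → X′ ! g ≡ c → X ! g ≡ c
      class {g} X′g with g ≟ᶠ f
      ... | yes refl = contradiction X′g X′f
      ... | no g≢f   = trans (sym (flipₒ-∉ {o} {X} {[ f ]} λ { (here g≡f) → g≢f g≡f })) X′g

      result : Popped o X Y (not (side x)) _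
      result with pop o! config
      ... | inj₁ eq      = finished (subst (Inv cs) eq inv′) (subst (λ Z → φ c Z < φ c X) eq less)
      ... | inj₂ config′ = onward
        (record { o! = o! ; config = config′
                ; lacks = trans (cong (in′ o) (side-other (proj₁ f→))) (trans (in-not {o} (side x)) out-c)
                ; both = both ; inv = inv′ ; h-other = C₂f })
        (side-other (proj₁ f→)) less Xf (inc-other f x) (inj₁ ∘ class)

    pop-final : ∀ {o X Y w h e D V} → Stage o X Y w h (e ∷ D) V → C₂ ! e ≡ c → Popped o X Y (side w) V
    pop-final {o} {X} {Y} {w} {h} {e} {D} {V} stage C₂e = result
      where
      e→ : Out o X w e
      e→ = Path-head (path (config stage))

      X₁ : Col
      X₁ = flipₒ o [ e ] X

      Xe : X ! e ≢ c
      Xe eq = out≢in (o! stage) (side w) (trans (sym (proj₂ e→)) (trans eq (sym (lacks stage))))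

      less : φ c X₁ < φ c X
      less = φ-gain c {o} {X} (Two-out (side w) (proj₂ e→)) C₂e Xe
        (trans (flipₒ-Out {o} {X} {[ e ]} e→ (here refl)) (lacks stage))

      inv₁ : Inv cs X₁
      inv₁ = Inv-flip {o} {cs} {X} [ e ] (both stage) (inv stage)

      back-class : ∀ {g} → X₁ ! g ≡ c → X ! g ≡ c ⊎ C₂ ! g ≡ c
      back-class {g} X₁g with g ≟ᶠ e
      ... | yes refl = inj₂ C₂e
      ... | no g≢e   = inj₁ (trans (sym (flipₒ-∉ {o} {X} {[ e ]} λ { (here g≡e) → g≢e g≡e })) X₁g)

      out-c : out o (side (other e w)) ≡ c
      out-c = trans (cong (out o) (side-other (proj₁ e→))) (trans (out-not {o} (side w)) (lacks stage))

      not-not : ∀ b → not (not b) ≡ b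
      not-not true  = refl
      not-not false = refl

      result : Popped o X Y (side w) V
      result with pop (o! stage) (config stage)
      ... | inj₁ eq = finished (subst (Inv cs) eq inv₁) (subst (λ Z → φ c Z < φ c X) eq less)
      ... | inj₂ config₁ with pop-c (o! stage) config₁ out-c (both stage) inv₁ C₂e
      ...   | inj₂ refl = exhausted config₁ inv₁ less
      ...   | inj₁ (finished inv-Y less′) = finished inv-Y (ℕₚ.<-trans less′ less)
      ...   | inj₁ (exhausted config₂ inv₂ less′) = exhausted config₂ inv₂ (ℕₚ.<-trans less′ less)
      ...   | inj₁ (onward {f = f} stage₂ side-eq less′ X₁f w₂∈f class) = onward stage₂
        (trans side-eq (trans (cong not (side-other (proj₁ e→))) (not-not (side w))))
        (ℕₚ.<-trans less′ less)
        -- The edge given up is not final, so its color c is not due to the recoloring of e.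
        (case back-class X₁f of λ where
          (inj₁ Xf)  → Xf
          (inj₂ C₂f) → contradiction C₂f (h-other stage₂))
        w₂∈f
        (λ X₂g → case class X₂g of λ where
          (inj₁ X₁g) → back-class X₁g
          (inj₂ C₂g) → inj₂ C₂g)

    record Advanced (o : Ori) (X Y : Col) (w : Vertex) (e : Edge) (V : Maybe Vertex) : Set where
      field
        {n}     : ℕ
        {X′ Y′} : Col
        {h′}    : Edge
        {D′}    : List Edge
        n≤1     : n ≤ 1
        steps   : Steps n Y Y′
        stage′  : Stage o X′ Y′ w h′ (e ∷ D′) V
        φ≤      : φ c X′ ≤ φ c X
        class   : ∀ e → X′ ! e ≡ c → X ! e ≡ c

    advance : ∀ {o X Y w h g D V e} → Stage o X Y w h (g ∷ D) V → (∀ {v} → V ≡ just v → side v ≡ side w) →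
      Inc w e → C₂ ! e ≡ c → Advanced o X Y w e V
    advance {o} {X} {Y} {w} {h} {g} {D} {V} {e} stage same-side w∈e C₂e with X ! e ≟ᶠ out o (side w)
    ... | yes Xe = record
      { n≤1 = z≤n ; steps = done ; stage′ = subst (λ e → Stage o X Y w h (e ∷ D) V) (sym e≡g) stage
      ; φ≤ = ℕₚ.≤-refl ; class = λ _ eq → eq }
      where
      g→ : Out o X w g
      g→ = Path-head (path (config stage))

      e≡g : e ≡ g
      e≡g = off (hole (near (config stage))) w∈e (proj₁ g→) (λ { refl → h-other stage C₂e })
        (λ { refl → fresh (config stage) (here refl) }) (trans Xe (sym (proj₂ g→)))
    ... | no Xe≢a = rotated (rotate (o! stage) o₂! (near (config stage)) g→ g≢h (out-Toward (side w))
                               (λ eq → b≢c (trans (sym (in-Toward (side w))) (trans eq (lacks stage)))) same-side {c = c} {c′ = c}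
                               (w∈e , sym (in-Toward (side w))))
      where
      a b : K
      a = out o (side w)
      b = X ! e

      b≢c : b ≢ c
      b≢c eq = no-in (hole (near (config stage))) (w∈e , trans eq (sym (lacks stage)))

      a≢c : a ≢ c
      a≢c eq = out≢in (o! stage) (side w) (trans eq (sym (lacks stage)))

      o₂ : Ori
      o₂ = Toward (side w) a b

      o₂! : Distinct o₂
      o₂! = Toward-distinct (side w) (≢-sym Xe≢a)

      both₂ : HasBoth o₂ cs
      both₂ = Toward-both (side w) (HasBoth-out (side w) (both stage)) (Inv-∈⁻ {X = X} (inv stage) (subst (_∈ cs) (sym C₂e) c∈))

      g→ : Out o X w g
      g→ = Path-head (path (config stage))

      g≢h : g ≢ h
      g≢h refl = fresh (config stage) (here refl)

      not-two : ∀ {Z f} → Z ! f ≡ c → ¬ Two o₂ Z f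
      not-two Zf two with Two⇒ (side w) two
      ... | inj₁ eq = a≢c (trans (sym (out-Toward (side w))) (trans (sym eq) Zf))
      ... | inj₂ eq = b≢c (trans (sym (in-Toward (side w))) (trans (sym eq) Zf))

      differs : in′ o₂ (side w) ≢ proj₁ o × in′ o₂ (side w) ≢ proj₂ o
      differs = subst (λ d → d ≢ proj₁ o × d ≢ proj₂ o) (sym (in-Toward (side w)))
        (differs-from-both {o} (side w) Xe≢a λ eq → b≢c (trans eq (lacks stage)))

      rotated : Rotated (o! stage) o₂! (near (config stage)) g→ g≢h _ _ same-side c c e → Advanced o X Y w e V
      rotated record { W = W ; h′ = h′ ; possible = possible ; near′ = near′ ; out′ = out′ ; e′≢h′ = e≢h′ }
        with eliminate-near (o! stage) out′ e≢h′ near′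
      ... | D′ , Y′ , config′ , Y′∈ = record
        { n≤1    = ℕₚ.≤-refl
        ; steps  = step (rotate-at-hole (o! stage) (proj₁ differs) (proj₂ differs) (config stage) (λ _ _ → possible) Y′∈)
                     (proper config′) done
        ; stage′ = record
          { o! = o! stage ; config = config′ ; lacks = lacks stage ; both = both stage
          ; inv = Inv-flip {o₂} {cs} {X} W both₂ (inv stage)
          ; h-other = λ C₂h′ → e≢h′ (prop₂ w w∈e (proj₁ (outgoing (hole near′))) (trans C₂e (sym C₂h′)))
          }
        -- The flip involves only the colors a and b, so the class of c stays the same.
        ; φ≤     = φ-cong c to from
        ; class  = from
        }
        where
        from : ∀ f → flipₒ o₂ W X ! f ≡ c → X ! f ≡ c
        from f X′f = trans (sym (¬Two⇒flipₒ {o₂} {X} {W} (λ two → not-two X′f (flipₒ-Two {o₂} {X} {W} two)))) X′f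

        to : ∀ f → X ! f ≡ c → flipₒ o₂ W X ! f ≡ c
        to f Xf = trans (¬Two⇒flipₒ {o₂} {X} {W} (not-two Xf)) Xf

-- Removing whole components, until one color is final.

module Loops (G : Graph) (bip : Bipartite G) (k : ℕ) (C₂ : Coloring G k) where
  open Graph G
  open Local G bip k
  open Walks G bip k
  open Elimination G bip k
  open Popping G bip k
  open Rotation G bip k
  open Undoing G bip k
  open Moves G bip k
  open Measure G bip k C₂
  open OneColor G bip k C₂

  module _ (prop₂ : ∀ v → Prop C₂ v) {cs : List K} (cs! : Unique cs) {c : K} (c∈ : c ∈ cs) where
    open Fixing prop₂ cs! c∈
    open Stage
    open Advanced

    finish-missing : ∀ {o X Y w h g D} → Stage o X Y w h (g ∷ D) nothing → ¬ Final w → Reach Y (suc (3 * φ c X))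
    finish-missing {o} {X} {Y} {w} {h} {g} stage ¬final
      -- The color a occurs twice at w; with g left out of the count, h still shows that b is not a.
      with missing c {X = X} {v = w} {x = g} cs! c∈ prop₂ (inv stage) (proj₁ (Path-head (path (config stage))))
             (subst (_∈ cs) (sym (proj₂ (Path-head (path (config stage))))) (HasBoth-out (side w) (both stage)))
             (λ w∈e C₂e → ¬final (_ , w∈e , C₂e))
    ... | b , b∈ , b≢c , only =
      let W , possible , all-prop = rotate-missing {c = c} {c′ = c} (o! stage) o₂! (near (config stage)) g→ g≢h (out-Toward (side w)) no-in₂
      in 1 , flipₒ o₂ W X
       , step (rotate-at-hole (o! stage) (proj₁ differs) (proj₂ differs) (config stage) (λ _ _ → possible) (λ _ → eliminate-proper order all-prop))
           all-prop done
       , all-prop , Inv-flip {o₂} {cs} {X} W both₂ (inv stage)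
       , s≤s (ℕₚ.*-monoʳ-≤ 3 (φ-cong c (to W) (from W)))
      where
      g→ : Out o X w g
      g→ = Path-head (path (config stage))

      g≢h : g ≢ h
      g≢h refl = fresh (config stage) (here refl)

      a : K
      a = out o (side w)

      a≢b : a ≢ b
      a≢b eq = g≢h (sym (only (proj₁ (outgoing (hole (near (config stage))))) (trans (proj₂ (outgoing (hole (near (config stage))))) eq)))

      a≢c : a ≢ c
      a≢c eq = out≢in (o! stage) (side w) (trans eq (sym (lacks stage)))

      o₂ : Ori
      o₂ = Toward (side w) a b

      o₂! : Distinct o₂
      o₂! = Toward-distinct (side w) a≢b

      both₂ : HasBoth o₂ cs
      both₂ = Toward-both (side w) (HasBoth-out (side w) (both stage)) b∈

      no-in₂ : ∀ {e} → ¬ In o₂ X w e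
      no-in₂ (w∈e , Xe) with only w∈e (trans Xe (in-Toward (side w)))
      ... | refl = a≢b (trans (sym (proj₂ g→)) (trans Xe (in-Toward (side w))))

      differs : in′ o₂ (side w) ≢ proj₁ o × in′ o₂ (side w) ≢ proj₂ o
      differs = subst (λ d → d ≢ proj₁ o × d ≢ proj₂ o) (sym (in-Toward (side w)))
        (differs-from-both {o} (side w) (≢-sym a≢b) λ eq → b≢c (trans eq (lacks stage)))

      not-two : ∀ {Z f} → Z ! f ≡ c → ¬ Two o₂ Z f
      not-two Zf two with Two⇒ (side w) two
      ... | inj₁ eq = a≢c (trans (sym (out-Toward (side w))) (trans (sym eq) Zf))
      ... | inj₂ eq = b≢c (trans (sym (in-Toward (side w))) (trans (sym eq) Zf))

      from : ∀ W f → flipₒ o₂ W X ! f ≡ c → X ! f ≡ c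
      from W f X′f = trans (sym (¬Two⇒flipₒ {o₂} {X} {W} (λ two → not-two X′f (flipₒ-Two {o₂} {X} {W} two)))) X′f

      to : ∀ W f → X ! f ≡ c → flipₒ o₂ W X ! f ≡ c
      to W f Xf = trans (¬Two⇒flipₒ {o₂} {X} {W} (not-two Xf)) Xf

    -- Follows a path component of the symmetric difference of the color classes
    -- of c; follow-cycle does the same for a cycle.
    follow-path : ∀ m {o X Y w h D} → φ c X < m → Stage o X Y w h D nothing → Reach Y (suc (3 * φ c X))
    follow-path (suc m) {X = X} {D = []} _ stage with config-alone-done (o! stage) (config stage)
    ... | refl = stay (proper (config stage)) (inv stage) ℕₚ.≤-refl
    follow-path (suc m) {o} {X} {Y} {w} {D = _ ∷ _} (s≤s φ≤m) stage with final? w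
    ... | no ¬final          = finish-missing stage ¬final
    ... | yes (e , w∈e , C₂e) = weaken (ℕₚ.m≤n⇒m≤1+n (ℕₚ.*-monoʳ-≤ 3 (φ≤ adv))) (go-on (pop-final (stage′ adv) C₂e))
      where
      adv : Advanced o X Y w e nothing
      adv = advance stage (λ ()) w∈e C₂e

      go-on : Popped o (X′ adv) (Y′ adv) (side w) nothing → Reach Y (3 * φ c (X′ adv))
      go-on (finished inv-Y less) =
        after (n≤1 adv) (steps adv) (stay (proper (config (stage′ adv))) inv-Y ℕₚ.≤-refl) less
      go-on (exhausted config″ inv″ less) with config-alone-done (o! stage) config″
      ... | refl = after (n≤1 adv) (steps adv) (stay (proper config″) inv″ ℕₚ.≤-refl) less
      go-on (onward stage″ _ less _ _ _) = after (n≤1 adv) (steps adv)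
        (follow-path m (ℕₚ.<-≤-trans less (ℕₚ.≤-trans (φ≤ adv) φ≤m)) stage″) less

    follow : ∀ {o X Y w h D} → Stage o X Y w h D nothing → Reach Y (suc (3 * φ c X))
    follow {X = X} = follow-path (suc (φ c X)) ℕₚ.≤-refl

    -- When only the deficiency at v is left, one of its two edges of color c is
    -- not final; recoloring it opens a hole at its other end.
    module _ {o X Y s h v} (o! : Distinct o) (config : Config o X Y s h [] (just v)) (in-c : in′ o (side v) ≡ c)
             (both : HasBoth o cs) (inv : Inv cs X) where

      private
        recolor-at : ∀ {h r} → Hole (op o) X v h → In o X v r → r ≢ h → C₂ ! r ≢ c → Reach Y (3 * φ c X)
        recolor-at {h} {r} hole-v r← r≢h C₂r with settle op! near₁
          where
          op! : Distinct (op o)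
          op! = ≢-sym o!

          r→ : Out o X (other r v) r
          r→ = In⇒Out-other r←

          back-at-v : other r (other r v) ≡ v
          back-at-v = other-other (proj₁ r←)

          near₁ : Near (op o) (flipₒ (op o) [ r ] X) (other r v) r nothing
          near₁ = near-alone op! r→ (config-prop o! config (other≢ (proj₁ r←)))
            (λ z≢s z≢u → config-prop o! config (λ { refl → z≢u (sym back-at-v) }))
            (subst (Prop _) (sym back-at-v) (hole-closes op! hole-v r← r≢h
              (flipₒ-Out {op o} {X} {[ r ]} r← (here refl))
              (λ _ f≢r → flipₒ-∉ {op o} {X} {[ r ]} λ { (here f≡r) → f≢r f≡r })))
        ... | D , Y₁ , config₁ , Y₁∈ = after ℕₚ.≤-refl
          (step (change-edge-at-sink o! (proj₁ (sink (near config) refl)) config r←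
            (λ {cs} both → subst (λ Z → Y₁ ∈ˢ eliminateAll G k cs Z) (flipₒ-op o [ r ] X) (Y₁∈ (proj₂ both , proj₁ both))))
            (proper config₁) done)
          (follow (record
            { o! = ≢-sym o! ; config = config₁
            ; lacks = trans (cong (out o) (side-other (proj₁ r←))) (trans (out-not {o} (side v)) in-c)
            ; both = proj₂ both , proj₁ both ; inv = Inv-flip {op o} {cs} {X} [ r ] (proj₂ both , proj₁ both) inv
            ; h-other = C₂r }))
          (φ-drop c {op o} {X} C₂r (trans (proj₂ r←) in-c) λ X₁r → out≢in o! (side v)
            (trans (sym (flipₒ-Out {op o} {X} {[ r ]} r← (here refl))) (trans X₁r (sym in-c))))

      transfer : Reach Y (3 * φ c X)
      transfer with sink (near config) refl
      ... | _ , sinkAt {h₀} hole₀ r₀← r₀≢h₀ with C₂ ! h₀ ≟ᶠ c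
      ...   | no C₂h₀  = recolor-at (hole-swap (≢-sym o!) hole₀ r₀←) (outgoing hole₀) (≢-sym r₀≢h₀) C₂h₀
      ...   | yes C₂h₀ = recolor-at hole₀ r₀← r₀≢h₀ λ C₂r₀ →
        r₀≢h₀ (prop₂ v (proj₁ r₀←) (proj₁ (outgoing hole₀)) (trans C₂r₀ (sym C₂h₀)))

    follow-cycle : ∀ m {o X Y w h D v} → φ c X < m → Stage o X Y w h D (just v) → side v ≡ side w → Final w → Balanced X →
                   Reach Y (suc (3 * φ c X))
    -- The hole at w is trivial here, by `config-prop`; only the deficiency at v remains.
    follow-cycle (suc m) {o} {X} {D = []} _ stage same-side _ _ = weaken (ℕₚ.n≤1+n _)
      (transfer (o! stage) (config stage) (trans (cong (in′ o) same-side) (lacks stage)) (both stage) (inv stage))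
    follow-cycle (suc m) {o} {X} {Y} {w} {D = _ ∷ _} {v} (s≤s φ≤m) stage same-side (e , w∈e , C₂e) balanced =
      weaken (ℕₚ.m≤n⇒m≤1+n (ℕₚ.*-monoʳ-≤ 3 (φ≤ adv))) (go-on (pop-final (stage′ adv) C₂e))
      where
      adv : Advanced o X Y w e (just v)
      adv = advance stage (λ { refl → same-side }) w∈e C₂e

      go-on : Popped o (X′ adv) (Y′ adv) (side w) (just v) → Reach Y (3 * φ c (X′ adv))
      go-on (finished inv-Y less) =
        after (n≤1 adv) (steps adv) (stay (proper (config (stage′ adv))) inv-Y ℕₚ.≤-refl) less
      go-on (exhausted config″ inv″ less) = after (n≤1 adv) (steps adv)
        (weaken (ℕₚ.n≤1+n _) (transfer (o! stage) config″ (trans (cong (in′ o) same-side) (lacks stage)) (both stage) inv″)) less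
      go-on (onward stage″ side-eq less X′f w₂∈f class-f) = after (n≤1 adv) (steps adv)
        (follow-cycle m (ℕₚ.<-≤-trans less (ℕₚ.≤-trans (φ≤ adv) φ≤m)) stage″ (trans same-side (sym side-eq))
          -- The edge f just given up had color c in X as well, so its end is final.
          (balanced w₂∈f (class adv _ X′f))
          (λ u∈e X″e → case class-f X″e of λ where
            (inj₁ X′e) → balanced u∈e (class adv _ X′e)
            (inj₂ C₂e) → _ , u∈e , C₂e)) less

    continue-path : ∀ {o X Y x e D s} → Distinct o → Config o X Y x e D nothing → Inv cs X →
      Popped o X Y s nothing ⊎ D ≡ [] → Reach Y (suc (3 * φ c X))
    continue-path o! config inv (inj₂ refl) with config-alone-done o! config
    ... | refl = stay (proper config) inv ℕₚ.≤-refl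
    continue-path o! config _ (inj₁ (finished inv less)) = stay (proper config) inv (ℕₚ.<⇒≤ less)
    continue-path o! _ _ (inj₁ (exhausted config inv less)) with config-alone-done o! config
    ... | refl = stay (proper config) inv (ℕₚ.<⇒≤ less)
    continue-path o! _ _ (inj₁ (onward stage _ less _ _ _)) = weaken (s≤s (ℕₚ.*-monoʳ-≤ 3 (ℕₚ.<⇒≤ less))) (follow stage)

    -- The elimination has flipped a path that starts with f, so the alternative of an empty path is
    -- absurd.
    continue-cycle : ∀ {o X Y s u} {f : Edge} {D : List Edge} → Distinct o → in′ o (side u) ≡ c → HasBoth o cs → Balanced X → side u ≡ s →
      (∀ v → Prop Y v) → Popped o X Y s (just u) ⊎ f ∷ D ≡ [] → Reach Y (suc (3 * φ c X))
    continue-cycle o! in-c both balanced side-u proper-Y (inj₁ (finished inv less)) = stay proper-Y inv (ℕₚ.<⇒≤ less)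
    continue-cycle o! in-c both balanced side-u proper-Y (inj₁ (exhausted config inv less)) =
      weaken (ℕₚ.m≤n⇒m≤1+n (ℕₚ.*-monoʳ-≤ 3 (ℕₚ.<⇒≤ less))) (transfer o! config in-c both inv)
    continue-cycle o! in-c both balanced side-u proper-Y (inj₁ (onward {X′ = X′} stage side-eq less Xf w∈f class-f)) =
      weaken (s≤s (ℕₚ.*-monoʳ-≤ 3 (ℕₚ.<⇒≤ less)))
        (follow-cycle (suc (φ c X′)) ℕₚ.≤-refl stage (trans side-u (sym side-eq)) (balanced w∈f Xf)
          (λ z∈g X′g → case class-f X′g of λ where
            (inj₁ Xg)  → balanced z∈g Xg
            (inj₂ C₂g) → _ , z∈g , C₂g))

    -- In all uses y is the value of φ at the almost coloring obtained by recoloring one edge of Y,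
    -- which already removes a bad edge.
    record Improvable (Y : Col) : Set where
      field
        {Y₁}      : Col
        {y}       : ℕ
        first     : Transition Y Y₁
        proper₁   : ∀ v → Prop Y₁ v
        rest      : Reach Y₁ (suc (3 * y))
        improving : y < φ c Y

    module _ {Y : Col} (all-prop : ∀ v → Prop Y v) (inv-Y : Inv cs Y) where

      private
        module Start {o x e} (o! : Distinct o) (both : HasBoth o cs) (e← : In o Y x e) where

          u : Vertex
          u = other e x

          X₁ : Col
          X₁ = flipₒ o [ e ] Y

          inv₁ : Inv cs X₁
          inv₁ = Inv-flip {o} {cs} {Y} [ e ] both inv-Y

          first-step : ∀ {Z} → (∀ {cs} → HasBoth o cs → Z ∈ˢ eliminateAll G k cs X₁) → Transition Y Z
          first-step = change-edge {o} o! all-prop (Two-in (side x) (proj₂ e←))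

          alone-start : (∀ {f} → ¬ In o Y u f) → ∃₂ λ D Y₁ → Config o X₁ Y₁ x e D nothing × Transition Y Y₁
          alone-start none =
            let D , Y₁ , config , Y₁∈ = settle o! (near-alone o! e← (all-prop x) (λ _ _ → all-prop _) (recolor-missing o! e← (all-prop u) none))
            in D , Y₁ , config , first-step Y₁∈

          module _ (out-c : out o (side x) ≡ c) (C₂e : C₂ ! e ≡ c) where

            Ye : Y ! e ≢ c
            Ye eq = out≢in o! (side x) (trans out-c (trans (sym eq) (proj₂ e←)))

            in-c : in′ o (side u) ≡ c
            in-c = trans (cong (in′ o) (side-other (proj₁ e←))) (trans (in-not {o} (side x)) out-c)

            X₁e : X₁ ! e ≡ c
            X₁e = trans (flipₒ-In {o} {Y} {[ e ]} e← (here refl)) out-c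

            less : φ c X₁ < φ c Y
            less = φ-gain c {o} {Y} (Two-in (side x) (proj₂ e←)) C₂e Ye X₁e

            -- As c is absent at u, recoloring e can make only x deficient.
            start-path : (∀ {f} → Inc u f → Y ! f ≢ c) → Improvable Y
            start-path none =
              let D , Y₁ , config , move = alone-start (λ (u∈f , Yf) → none u∈f (trans Yf in-c)) in record
              { first = move ; proper₁ = proper config ; improving = less
              ; rest = continue-path o! config inv₁ (pop-c o! config out-c both inv₁ C₂e) }

            -- Both ends of e have color c already, so both become deficient. The component need not
            -- be a cycle: on a path the hole comes to an end without meeting u, and the other half
            -- is then followed from u by `transfer`.
            start-cycle : ∀ {r f} → Inc u r → Y ! r ≡ c → Inc x f → Y ! f ≡ c → Balanced Y → Improvable Y
            start-cycle {r} {f} u∈r Yr x∈f Yf balanced =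
              let D , Y₁ , config , Y₁∈ = eliminate-near o! f→ f≢e near₁ in record
              { first = first-step Y₁∈ ; proper₁ = proper config ; improving = less
              ; rest = continue-cycle o! in-c both balanced₁ (side-other (proj₁ e←)) (proper config)
                  (pop-c o! config out-c both inv₁ C₂e) }
              where
              f≢e : f ≢ e
              f≢e refl = Ye Yf

              r≢e : r ≢ e
              r≢e refl = Ye Yr

              f→ : Out o X₁ x f
              f→ = x∈f , trans (recolor-same o! e← f≢e) (trans Yf (sym out-c))

              near₁ : Near o X₁ x e (just u)
              near₁ = record
                { hole = recolor-opens o! e← (all-prop x)
                ; prop = λ {z} z≢x z≢u → Prop-resp {Y} (recolor-agree o! e← z≢x (λ { refl → z≢u refl })) (all-prop z)
                ; sink = λ { refl → other≢ (proj₁ e←) , sinkAt (recolor-opens-other o! e← (all-prop u))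
                    (u∈r , trans (recolor-same o! e← r≢e) (trans Yr (sym in-c))) r≢e }
                }

              balanced₁ : Balanced X₁
              balanced₁ {z} {g} z∈g X₁g with g ≟ᶠ e
              ... | yes refl = e , z∈g , C₂e
              ... | no g≢e   = balanced z∈g (trans (sym (recolor-same o! e← g≢e)) X₁g)

          start-other : in′ o (side x) ≡ c → C₂ ! e ≢ c → (∀ {f} → ¬ In o Y u f) → Improvable Y
          start-other in-c C₂e none =
            let D , Y₁ , config , move = alone-start none in record
            { first = move ; proper₁ = proper config
            ; rest = follow (record { o! = o! ; config = config ; lacks = in-c ; both = both ; inv = inv₁ ; h-other = C₂e })
            ; improving = φ-drop c {o} {Y} C₂e (trans (proj₂ e←) in-c) λ X₁e → out≢in o! (side x)
                (trans (sym (flipₒ-In {o} {Y} {[ e ]} e← (here refl))) (trans X₁e (sym in-c)))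
            }

        has-c? : ∀ v → Dec (∃ λ f → Inc v f × Y ! f ≡ c)
        has-c? v = any? λ f → incident? G v f ×-dec (Y ! f ≟ᶠ c)

      improve-final : ∀ {x e} → Inc x e → C₂ ! e ≡ c → Y ! e ≢ c → Balanced Y → Improvable Y
      improve-final {x} {e} x∈e C₂e Ye balanced = by-ends (has-c? x) (has-c? (other e x))
        where
        Ye∈ : Y ! e ∈ cs
        Ye∈ = Inv-∈⁻ {X = Y} inv-Y (subst (_∈ cs) (sym C₂e) c∈)

        by-ends : Dec (∃ λ f → Inc x f × Y ! f ≡ c) → Dec (∃ λ f → Inc (other e x) f × Y ! f ≡ c) → Improvable Y
        by-ends (yes (f , x∈f , Yf)) (yes (r , u∈r , Yr)) =
          Start.start-cycle {Toward (side x) c (Y ! e)} (Toward-distinct (side x) (≢-sym Ye)) (Toward-both (side x) c∈ Ye∈)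
            (x∈e , sym (in-Toward (side x))) (out-Toward (side x)) C₂e u∈r Yr x∈f Yf balanced
        by-ends _ (no none) =
          Start.start-path {Toward (side x) c (Y ! e)} (Toward-distinct (side x) (≢-sym Ye)) (Toward-both (side x) c∈ Ye∈)
            (x∈e , sym (in-Toward (side x))) (out-Toward (side x)) C₂e (λ u∈f Yf → none (_ , u∈f , Yf))
        by-ends (no none) (yes _) =
          Start.start-path {Toward (side u) c (Y ! e)} (Toward-distinct (side u) (≢-sym Ye)) (Toward-both (side u) c∈ Ye∈)
            (inc-other e x , sym (in-Toward (side u))) (out-Toward (side u)) C₂e
            (λ x∈f Yf → none (_ , subst (λ v → Inc v _) (other-other x∈e) x∈f , Yf))
          where
          u : Vertex
          u = other e x

      -- Some unfinished color d is missing at v. Recoloring f with d keeps v proper, and at the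
      -- other end of f it makes c the missing color, which is the start of a path.
      improve-superfluous : ∀ {v f} → Inc v f → Y ! f ≡ c → ¬ Final v → Improvable Y
      improve-superfluous {v} {f} v∈f Yf ¬final
        with missing c {X = Y} cs! c∈ prop₂ inv-Y v∈f (subst (_∈ cs) (sym Yf) c∈) (λ v∈e C₂e → ¬final (_ , v∈e , C₂e))
      ... | d , d∈ , d≢c , only =
        Start.start-other {Toward (side x) d c} (Toward-distinct (side x) d≢c) (Toward-both (side x) d∈ c∈)
          (inc-other f v , trans Yf (sym (in-Toward (side x)))) (in-Toward (side x)) (λ C₂f → ¬final (f , v∈f , C₂f)) none
        where
        x : Vertex
        x = other f v

        in-d : in′ (Toward (side x) d c) (side (other f x)) ≡ d
        in-d = trans (cong (in′ (Toward (side x) d c)) (side-other (inc-other f v)))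
          (trans (in-not {Toward (side x) d c} (side x)) (out-Toward (side x)))

        none : ∀ {g} → ¬ In (Toward (side x) d c) Y (other f x) g
        none {g} (v∈g , Yg) with only (subst (λ z → Inc z g) (other-other v∈f) v∈g) (trans Yg in-d)
        ... | refl = d≢c (trans (sym (trans Yg in-d)) Yf)

      improve : ∀ {e} → Bad c Y e → Improvable Y
      -- Vertices with color c in Y but not in C₂ come first; if there are none, Y is balanced, as
      -- the pursuit of two deficiencies requires.
      improve {e} bad with any? (λ v → any? (λ f → (incident? G v f ×-dec (Y ! f ≟ᶠ c)) ×-dec ¬? (final? v)))
      ... | yes (v , f , (v∈f , Yf) , ¬final) = improve-superfluous v∈f Yf ¬final
      ... | no all-final = by-badness bad
        where
        balanced : Balanced Y
        balanced {v} {f} v∈f Yf with final? v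
        ... | yes final = final
        ... | no ¬final = contradiction (v , f , (v∈f , Yf) , ¬final) all-final

        by-badness : Bad c Y e → Improvable Y
        by-badness (inj₂ (Ye , C₂e)) = improve-final (inj₁ refl) C₂e Ye balanced
        -- At an end of e there is a final edge f, by balance. It is not e, so it lacks color c in Y
        -- and can be recolored instead.
        by-badness (inj₁ (Ye , C₂e)) with balanced {proj₁ (ends e)} (inj₁ refl) Ye
        ... | f , v∈f , C₂f = improve-final v∈f C₂f
          (λ Yf → C₂e (subst (λ g → C₂ ! g ≡ c) (all-prop _ v∈f (inj₁ refl) (trans Yf (sym Ye))) C₂f)) balanced

    Fixed : Col → Set
    Fixed Y = ∃₂ λ n Z → Steps n Y Z × (∀ v → Prop Z v) × Inv cs Z × (∀ e → ¬ Bad c Z e) × n ≤ 3 * φ c Y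

    fix-color : ∀ m {Y} → φ c Y < m → (∀ v → Prop Y v) → Inv cs Y → Fixed Y
    fix-color (suc m) {Y} (s≤s φ≤m) all-prop inv-Y with any? (bad? c Y)
    ... | no ¬bad = 0 , Y , done , all-prop , inv-Y , (λ e bad → ¬bad (e , bad)) , z≤n
    ... | yes (e , bad) with improve all-prop inv-Y bad
    ...   | record { first = first ; proper₁ = proper₁ ; improving = improving
                   ; rest = n₁ , Z , steps , prop-Z , inv-Z , bound } = combine (fix-color m (ℕₚ.<-≤-trans φZ<φY φ≤m) prop-Z inv-Z)
      where
      total : suc n₁ + 3 * φ c Z ≤ 3 * φ c Y
      total = budget {1} {n₁} ℕₚ.≤-refl bound improving

      -- The first step, counted in `total`, makes this strict.
      φZ<φY : φ c Z < φ c Y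
      φZ<φY = ℕₚ.*-cancelˡ-< 3 _ _ (ℕₚ.≤-trans (s≤s (ℕₚ.m≤n+m _ n₁)) total)

      combine : Fixed Z → Fixed Y
      combine (n₂ , W , steps′ , prop-W , inv-W , ¬bad , n₂≤) =
        suc n₁ + n₂ , W , Steps-trans (step first proper₁ steps) steps′ , prop-W , inv-W , ¬bad ,
        ℕₚ.≤-trans (ℕₚ.+-monoʳ-≤ (suc n₁) n₂≤) total

-- Finishing all colors, and the total count of steps.

module AllColors (G : Graph) (bip : Bipartite G) (k : ℕ) (C₂ : Coloring G k) where
  open Graph G
  open Local G bip k
  open Moves G bip k
  open Measure G bip k C₂
  open Loops G bip k C₂

  colorClass : Col → K → List Edge
  colorClass X c = filter (λ e → X ! e ≟ᶠ c) (allFin size)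

  colorClasses : Col → List K → List Edge
  colorClasses X = concatMap (colorClass X)

  count : Col → K → ℕ
  count X c = length (colorClass X c)

  ∈-colorClass⁻ : ∀ X {c e} → e ∈ colorClass X c → X ! e ≡ c
  ∈-colorClass⁻ X {c} e∈ = proj₂ (∈-filter⁻ (λ e → X ! e ≟ᶠ c) {xs = allFin size} e∈)

  ∈-colorClass⁺ : ∀ X {c e} → X ! e ≡ c → e ∈ colorClass X c
  ∈-colorClass⁺ X {c} {e} = ∈-filter⁺ (λ e → X ! e ≟ᶠ c) (∈-allFin e)

  ∈-colorClasses⁻ : ∀ X cs {e} → e ∈ colorClasses X cs → X ! e ∈ cs
  ∈-colorClasses⁻ X (c ∷ cs) e∈ with ∈-++⁻ (colorClass X c) e∈
  ... | inj₁ e∈c  = here (∈-colorClass⁻ X e∈c)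
  ... | inj₂ e∈cs = there (∈-colorClasses⁻ X cs e∈cs)

  ∈-colorClasses⁺ : ∀ X {cs e} → X ! e ∈ cs → e ∈ colorClasses X cs
  ∈-colorClasses⁺ X {_ ∷ _}  (here eq)  = ∈-++⁺ˡ (∈-colorClass⁺ X eq)
  ∈-colorClasses⁺ X {c ∷ cs} (there e∈) = ∈-++⁺ʳ (colorClass X c) (∈-colorClasses⁺ X e∈)

  Unique-colorClasses : ∀ X {cs} → Unique cs → Unique (colorClasses X cs)
  Unique-colorClasses X []                     = []
  Unique-colorClasses X {c ∷ cs} (c∉ ∷ cs!) =
    Unique-++⁺ (Unique-filter⁺ (λ e → X ! e ≟ᶠ c) (allFin⁺ size)) (Unique-colorClasses X cs!)
      λ (e∈c , e∈cs) → All.lookup c∉ (∈-colorClasses⁻ X cs e∈cs) (sym (∈-colorClass⁻ X e∈c))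

  opaque
    unfolding φ

    φ≤counts : ∀ c X → φ c X ≤ count X c + count C₂ c
    φ≤counts c X = subst (φ c X ≤_) (length-++ (colorClass X c)) (Unique-length-≤ (Unique-filter⁺ (bad? c X) (allFin⁺ size)) bad⊆)
      where
      bad⊆ : ∀ {e} → e ∈ filter (bad? c X) (allFin size) → e ∈ colorClass X c ++ colorClass C₂ c
      bad⊆ e∈ with proj₂ (∈-filter⁻ (bad? c X) {xs = allFin size} e∈)
      ... | inj₁ (Xe , _)  = ∈-++⁺ˡ (∈-colorClass⁺ X Xe)
      ... | inj₂ (_ , C₂e) = ∈-++⁺ʳ (colorClass X c) (∈-colorClass⁺ C₂ C₂e)

  -- As both colorings use the colors cs for the same edges, some color is used
  -- at most as often in X as in C₂.
  choose-color : ∀ X c cs → length (colorClasses X (c ∷ cs)) ≤ length (colorClasses C₂ (c ∷ cs)) →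
                 ∃ λ d → d ∈ c ∷ cs × count X d ≤ count C₂ d
  choose-color X c cs total≤ with count X c ≤? count C₂ c
  ... | yes ≤c = c , here refl , ≤c
  ... | no ≰c  = from-rest cs rest<
    where
    rest< : length (colorClasses X cs) < length (colorClasses C₂ cs)
    rest< = ℕₚ.+-cancelˡ-< (count X c) _ _ (begin-strict
      count X c + length (colorClasses X cs)   ≡⟨ sym (length-++ (colorClass X c)) ⟩
      length (colorClasses X (c ∷ cs))          ≤⟨ total≤ ⟩
      length (colorClasses C₂ (c ∷ cs))         ≡⟨ length-++ (colorClass C₂ c) ⟩
      count C₂ c + length (colorClasses C₂ cs) <⟨ ℕₚ.+-monoˡ-< _ (ℕₚ.≰⇒> ≰c) ⟩
      count X c + length (colorClasses C₂ cs)  ∎)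
      where open ℕₚ.≤-Reasoning

    from-rest : ∀ cs → length (colorClasses X cs) < length (colorClasses C₂ cs) → ∃ λ d → d ∈ c ∷ cs × count X d ≤ count C₂ d
    from-rest (d ∷ ds) less with choose-color X d ds (ℕₚ.<⇒≤ less)
    ... | b , b∈ , ≤b = b , there b∈ , ≤b

  module _ (prop₂ : ∀ v → Prop C₂ v) where

    fix-all : ∀ m cs {Y} → length cs ≤ m → Unique cs → (∀ v → Prop Y v) → Inv cs Y →
              ∃ λ n → Steps n Y C₂ × n ≤ 6 * length (colorClasses C₂ cs)
    fix-all m [] {Y} _ _ _ inv with ext {Y} {C₂} (λ e → case inv e of λ { (inj₂ eq) → eq })
    ... | refl = 0 , done , z≤n
    fix-all (suc m) cs₀@(c ∷ cs) {Y} (s≤s len) cs! prop-Y inv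
      with choose-color Y c cs (Unique-length-≤ (Unique-colorClasses Y cs!) λ e∈ →
             ∈-colorClasses⁺ C₂ (Inv-∈ {X = Y} inv (∈-colorClasses⁻ Y (c ∷ cs) e∈)))
    ... | d , d∈ , count≤ with fix-color prop₂ cs! d∈ (suc (φ d Y)) ℕₚ.≤-refl prop-Y inv
    ...   | n , Z , steps , prop-Z , inv-Z , ¬bad , n≤ =
      let n′ , steps′ , n′≤ = fix-all m ds (ℕₚ.≤-pred (ℕₚ.≤-trans shorter (s≤s len))) ds! prop-Z inv′
      in n + n′ , Steps-trans steps steps′ , bound n′ n′≤
      where
      keep? : ∀ b → Dec (b ≢ d)
      keep? b = ¬? (b ≟ᶠ d)

      ds : List K
      ds = filter keep? cs₀

      ds! : Unique ds
      ds! = Unique-filter⁺ keep? cs!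

      d∷ds! : Unique (d ∷ ds)
      d∷ds! = All.tabulate (λ { b∈ refl → proj₂ (∈-filter⁻ keep? {xs = cs₀} b∈) refl }) ∷ ds!

      d∷ds⊆ : ∀ {b} → b ∈ d ∷ ds → b ∈ cs₀
      d∷ds⊆ (here refl) = d∈
      d∷ds⊆ (there b∈)  = proj₁ (∈-filter⁻ keep? {xs = cs₀} b∈)

      shorter : length (d ∷ ds) ≤ length cs₀
      shorter = Unique-length-≤ d∷ds! d∷ds⊆

      inv′ : Inv ds Z
      inv′ e with inv-Z e | C₂ ! e ≟ᶠ d
      ... | inj₂ eq          | _       = inj₂ eq
      -- The class of d is final, so an edge with color d in C₂ has it in Z as well and leaves the
      -- unfinished part.
      ... | inj₁ _           | yes C₂e = inj₂ (trans (proj₂ (φ-zero d {Z} ¬bad e) C₂e) (sym C₂e))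
      ... | inj₁ (Ze∈ , C₂e∈) | no C₂e = inj₁
        (∈-filter⁺ keep? Ze∈ (C₂e ∘ proj₁ (φ-zero d {Z} ¬bad e)) , ∈-filter⁺ keep? C₂e∈ C₂e)

      bound : ∀ n′ → n′ ≤ 6 * length (colorClasses C₂ ds) → n + n′ ≤ 6 * length (colorClasses C₂ cs₀)
      bound n′ n′≤ = begin
        n + n′
          -- The constant 6 arises here: three steps per bad edge, and by the choice of d at most
          -- twice as many bad edges as C₂ has edges of color d.
          ≤⟨ ℕₚ.+-mono-≤ (ℕₚ.≤-trans n≤ (ℕₚ.*-monoʳ-≤ 3 (ℕₚ.≤-trans (φ≤counts d Y) (ℕₚ.+-monoˡ-≤ (count C₂ d) count≤)))) n′≤ ⟩
        3 * (count C₂ d + count C₂ d) + 6 * length (colorClasses C₂ ds)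
          ≡⟨ cong (_+ 6 * length (colorClasses C₂ ds)) (twice (count C₂ d)) ⟩
        6 * count C₂ d + 6 * length (colorClasses C₂ ds)
          ≡⟨ sym (ℕₚ.*-distribˡ-+ 6 (count C₂ d) _) ⟩
        6 * (count C₂ d + length (colorClasses C₂ ds))
          ≡⟨ cong (6 *_) (sym (length-++ (colorClass C₂ d))) ⟩
        6 * length (colorClasses C₂ (d ∷ ds))
          ≤⟨ ℕₚ.*-monoʳ-≤ 6 (Unique-length-≤ (Unique-colorClasses C₂ d∷ds!) λ e∈ →
               ∈-colorClasses⁺ C₂ (d∷ds⊆ (∈-colorClasses⁻ C₂ (d ∷ ds) e∈))) ⟩
        6 * length (colorClasses C₂ cs₀) ∎
        where
        open ℕₚ.≤-Reasoning

        twice : ∀ x → 3 * (x + x) ≡ 6 * x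
        twice x = trans (cong (λ y → 3 * (x + y)) (sym (ℕₚ.+-identityʳ x))) (sym (ℕₚ.*-assoc 3 2 x))

    reach-all : ∀ {Y} → (∀ v → Prop Y v) → ∃ λ n → n ≤ 6 * size × Steps n Y C₂
    reach-all prop-Y =
      let n , steps , n≤ = fix-all k (allFin k) (ℕₚ.≤-reflexive (length-tabulate {n = k} (λ c → c))) (allFin⁺ k) prop-Y
                             (λ e → inj₁ (∈-allFin _ , ∈-allFin _))
      in n , ℕₚ.≤-trans n≤ (ℕₚ.*-monoʳ-≤ 6 (subst (length (colorClasses C₂ (allFin k)) ≤_) (length-tabulate {n = size} (λ e → e))
               (Unique-length-≤ (Unique-colorClasses C₂ (allFin⁺ k)) λ {e} _ → ∈-allFin e))) , steps

theorem3p1 : (G : Graph) → Bipartite G →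
    (k : ℕ) → maxDegree G ≤ k →
    (C₁ C₂ : EdgeColoring G k) →
    ∃[ n ] (n ≤ 6 * Graph.size G × Reaches G k n C₁ C₂)
theorem3p1 G bip k _ C₁ C₂ =
  let n , n≤ , steps = AllColors.reach-all G bip k (proj₁ C₂) (Local.Proper⇒Prop G bip k (proj₂ C₂))
                         (Local.Proper⇒Prop G bip k (proj₂ C₁))
  in n , n≤ , Moves.Steps⇒Reaches G bip k C₁ C₂ steps
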